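{- Let $p=p(n)\in(0,1)$ and let $K_{n,p}$ denote the number of edges of the random symmetric edge polytope $P_{n,p}$. Then $$\mathbb{E}[K_{n,p}]=12\binom{n}{4}p^2(1-p^2)+6\binom{n}{3}p^2\Bigl(1+(1-p)(1-p^2)^{n-3}\Bigr).$$ As $n\to\infty$, this yields $$\mathbb{E}[K_{n,p}]\simeq n^4p^2(1-p)+n^3p^2\simeq\begin{cases} n^3p^2, & \text{if } 1-p\ll n^{ -1},\\ n^4p^2(1-p), & \text{if } 1-p\gtrsim n^{ -1}.\end{cases}$$ In particular, $\mathbb{E}[K_{n,p}]\to\infty$ if and only if $p\gg n^{ -2}$.
   Context: For a finite simple graph $G=(V,E)$ (elements of $V$ are nodes, elements of $E\subseteq\binom V2$ are arcs), with $(\mathbf{e}_i)_{i\in V}$ the standard basis of $\mathbb{R}^V$, the symmetric edge polytope is $P_G:=\operatorname{conv}\{\pm(\mathbf{e}_i-\mathbf{e}_j):\{i,j\}\in E\}\subset\mathbb{R}^V$ (empty if $E=\emptyset$). A face of a polytope is its intersection with a supporting hyperplane; the polytope itself is not regarded as a face. Edges of a polytope are its $1$-dimensional faces (so if $G$ has exactly one arc, $P_G$ has no edges). $G_{n,p}$ is the Erdős–Rényi random graph on node set $[n]$, each arc of the complete graph being retained independently with probability $p=p(n)\in(0,1)$; $P_{n,p}:=P_{G_{n,p}}$. Asymptotic notation for sequences: $a_n\simeq b_n$ means $0<\liminf|a_n/b_n|\le\limsup|a_n/b_n|<\infty$; $a_n\ll b_n$ means $\limsup|a_n/b_n|=0$;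 $a_n\gg b_n$ means $\liminf|a_n/b_n|=\infty$; $a_n\gtrsim b_n$ means $\liminf|a_n/b_n|>0$. A case distinction means: if the sequence $p=p(n)$ satisfies the asymptotic condition, then the corresponding relation holds. -}

module Defs where

open import Algebra.Apartness.Bundles using (HeytingField; HeytingCommutativeRing)
open import Algebra.Bundles using (CommutativeRing; Semiring)
import Algebra.Apartness.Properties.HeytingCommutativeRing as HeytingProperties
import Algebra.Definitions.RawSemiring as RawSemiringDefinitions
import Algebra.Properties.Ring as RingProperties
open import Data.Bool.Base using (if_then_else_)
open import Data.Fin.Base using (Fin)
open import Data.Fin.Properties using (_<?_; _≟_)
open import Data.Fin.Subset using (Subset; inside; outside; _∈_)
open import Data.List.Base using (List; allFin; cartesianProduct; filter; length; lookup)
open import Data.Nat.Base as ℕ using (ℕ; zero; suc)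
open import Data.Product.Base using (Σ-syntax; ∃-syntax; _×_; _,_; proj₁)
open import Data.Sum.Base using (_⊎_; fromInj₁)
open import Data.Vec.Base as Vec using ([]; _∷_)
open import Data.Vec.Functional using (Vector)
open import Function.Bundles using (Bijection)
open import Level using (Level; _⊔_)
open import Relation.Binary.Bundles using (Setoid)
open import Relation.Binary.Core using (Rel)
import Relation.Binary.Construct.On as On
open import Relation.Binary.Lattice.Definitions using (Supremum)
open import Relation.Binary.PropositionalEquality using () renaming (setoid to ≡-setoid)
open import Relation.Binary.Structures using (IsStrictPartialOrder)
open import Relation.Nullary.Decidable using (does)
open import Relation.Nullary.Negation using (¬_)
open import Relation.Unary using (Pred; _≐_)
open import Relation.Unary.Relation.Binary.Equality using (≐-setoid)

-- The real numbers, given by their axioms: a Cauchy-complete Archimedean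
-- ordered field with binary maxima.  Classically such a field is unique up to
-- unique isomorphism; constructively the strict order is primitive and x ≤ y
-- means ¬ (y < x).  Cotransitivity of _<_ follows from that of _#_.

record Reals (c ℓ₁ ℓ₂ : Level) : Set (Level.suc (c ⊔ ℓ₁ ⊔ ℓ₂)) where
  infix 4 _<_ _≤_

  field
    heytingField : HeytingField c ℓ₁ ℓ₂

  open HeytingField heytingField public

  field
    _<_                  : Rel Carrier ℓ₂
    isStrictPartialOrder : IsStrictPartialOrder _≈_ _<_
    <⇒#                  : ∀ {x y} → x < y → x # y
    #⇒<                  : ∀ {x y} → x # y → x < y ⊎ y < x
    +-monoʳ-<            : ∀ z {x y} → x < y → z + x < z + y
    *-positive           : ∀ {x y} → 0# < x → 0# < y → 0# < x * y

  _≤_ : Rel Carrier ℓ₂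
  x ≤ y = ¬ (y < x)

  field
    max      : Carrier → Carrier → Carrier
    supremum : Supremum _≤_ max

  ∣_∣ : Carrier → Carrier
  ∣ x ∣ = max x (- x)

  commutativeRing : CommutativeRing c ℓ₁
  commutativeRing = HeytingCommutativeRing.commutativeRing heytingCommutativeRing

  -- _×ₙ_ is multiplication by a natural number.
  open RawSemiringDefinitions (Semiring.rawSemiring (CommutativeRing.semiring commutativeRing)) public
    using (sum; product; _^_) renaming (_×_ to _×ₙ_)

  fromℕ : ℕ → Carrier
  fromℕ n = n ×ₙ 1#

  Cauchy : (ℕ → Carrier) → Set (c ⊔ ℓ₂)
  Cauchy s = ∀ ε → 0# < ε → ∃[ N ] ∀ m n → N ℕ.≤ m → N ℕ.≤ n → ∣ s m - s n ∣ < ε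

  _ConvergesTo_ : (ℕ → Carrier) → Carrier → Set (c ⊔ ℓ₂)
  s ConvergesTo x = ∀ ε → 0# < ε → ∃[ N ] ∀ n → N ℕ.≤ n → ∣ s n - x ∣ < ε

  field
    archimedean : ∀ x → ∃[ n ] x < fromℕ n
    complete    : ∀ s → Cauchy s → ∃[ x ] s ConvergesTo x

  private module < = IsStrictPartialOrder isStrictPartialOrder

  open RingProperties (CommutativeRing.ring commutativeRing)
    using (-‿distribˡ-*; -‿involutive)

  0<1 : 0# < 1#
  0<1 = fromInj₁ 1<0⇒0<1 (#⇒< (#-sym (HeytingProperties.1#0 heytingCommutativeRing)))
    where
    1<0⇒0<1 : 1# < 0# → 0# < 1#
    1<0⇒0<1 1<0 = <.<-respʳ-≈ -1*-1≈1 (*-positive 0<-1 0<-1)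
      where
      0<-1 : 0# < - 1#
      0<-1 = <.<-respʳ-≈ (+-identityʳ (- 1#))
               (<.<-respˡ-≈ (-‿inverseˡ 1#) (+-monoʳ-< (- 1#) 1<0))
      -1*-1≈1 : - 1# * - 1# ≈ 1#
      -1*-1≈1 = trans (sym (-‿distribˡ-* 1# (- 1#)))
                  (trans (-‿cong (*-identityˡ (- 1#))) (-‿involutive 1#))

  0<fromℕ-suc : ∀ n → 0# < fromℕ (suc n)
  0<fromℕ-suc zero    = <.<-respʳ-≈ (sym (+-identityʳ 1#)) 0<1
  0<fromℕ-suc (suc n) = <.trans 0<1
    (<.<-respˡ-≈ (+-identityʳ 1#) (+-monoʳ-< 1# (0<fromℕ-suc n)))

  -- #⇒invertible gives an inverse of y - 0#.
  divide : (x y : Carrier) → y # 0# → Carrier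
  divide x y y#0 = x * proj₁ (#⇒invertible y#0)

-- The list of pairs (i , j) with i < j, standing for the arcs {i , j} of the
-- complete graph on the node set Fin n.

completeArcs : ∀ n → List (Fin n × Fin n)
completeArcs n =
  filter (λ (i , j) → i <? j) (cartesianProduct (allFin n) (allFin n))

arc : ∀ n → Fin (length (completeArcs n)) → Fin n × Fin n
arc n = lookup (completeArcs n)

record Graph (n : ℕ) : Set where
  constructor graph
  field
    arcs : Subset (length (completeArcs n))

open Graph public

module Theory {c ℓ₁ ℓ₂ : Level} (ℝ : Reals c ℓ₁ ℓ₂) where

  open Reals ℝ public

  infix 4 _≋_

  Point : ℕ → Set c
  Point n = Vector Carrier n

  _≋_ : ∀ {n} → Rel (Point n) ℓ₁
  x ≋ y = ∀ i → x i ≈ y i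

  𝐞 : ∀ {n} → Fin n → Point n
  𝐞 i j = if does (i ≟ j) then 1# else 0#

  ⟨_,_⟩ : ∀ {n} → Point n → Point n → Carrier
  ⟨ a , x ⟩ = sum (λ i → a i * x i)

  combination : ∀ {n m} → Vector Carrier m → Vector (Point n) m → Point n
  combination w v i = sum (λ k → w k * v k i)

  conv : ∀ {n ℓ} → Pred (Point n) ℓ → Pred (Point n) (c ⊔ ℓ₁ ⊔ ℓ₂ ⊔ ℓ)
  conv {n} S x =
    Σ[ m ∈ ℕ ] Σ[ w ∈ Vector Carrier m ] Σ[ v ∈ Vector (Point n) m ]
      (∀ k → 0# ≤ w k) × sum w ≈ 1# × (∀ k → S (v k)) × x ≋ combination w v

  -- The two orientations of an arc give the two signs.
  generator : ∀ {n} → Graph n → Pred (Point n) ℓ₁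
  generator {n} G x =
    Σ[ k ∈ Fin (length (completeArcs n)) ] k ∈ arcs G ×
      (let (i , j) = arc n k in
         x ≋ (λ l → 𝐞 i l - 𝐞 j l) ⊎ x ≋ (λ l → - (𝐞 i l - 𝐞 j l)))

  symmetricEdgePolytope : ∀ {n} → Graph n → Pred (Point n) (c ⊔ ℓ₁ ⊔ ℓ₂)
  symmetricEdgePolytope G = conv (generator G)

  section : ∀ {n ℓ} → Pred (Point n) ℓ → Point n → Carrier → Pred (Point n) (ℓ₁ ⊔ ℓ)
  section P a b x = P x × ⟨ a , x ⟩ ≈ b

  -- Proper faces, presented by a supporting hyperplane {x : ⟨ a , x ⟩ = b}.
  -- Different hyperplanes may cut out the same face; edges are identified
  -- below when they have the same points.
  record Face {n ℓ} (P : Pred (Point n) ℓ) : Set (c ⊔ ℓ₁ ⊔ ℓ₂ ⊔ ℓ) where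
    field
      normal    : Point n
      offset    : Carrier
      normal#0  : ∃[ i ] normal i # 0#
      halfspace : ∀ x → P x → ⟨ normal , x ⟩ ≤ offset

    points : Pred (Point n) (ℓ₁ ⊔ ℓ)
    points = section P normal offset

    field
      touches : ∃[ x ] points x
      proper  : ¬ (points ≐ P)

  -- Independence in its positive form: a nontrivial weight vector with sum 0
  -- gives a combination apart from 0 (classically, the usual contrapositive).
  AffinelyIndependent : ∀ {n m} → Vector (Point n) m → Set (c ⊔ ℓ₁ ⊔ ℓ₂)
  AffinelyIndependent v =
    ∀ w → sum w ≈ 0# → (∃[ k ] w k # 0#) → ∃[ i ] combination w v i # 0#

  HasDimension : ∀ {n ℓ} → Pred (Point n) ℓ → ℕ → Set (c ⊔ ℓ₁ ⊔ ℓ₂ ⊔ ℓ)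
  HasDimension {n} F d =
    Σ[ v ∈ Vector (Point n) (suc d) ]
      (∀ k → F (v k)) × AffinelyIndependent v ×
      (∀ x → F x → ∃[ w ] sum w ≈ 1# × x ≋ combination w v)

  Edge : ∀ {n ℓ} → Pred (Point n) ℓ → Set (c ⊔ ℓ₁ ⊔ ℓ₂ ⊔ ℓ)
  Edge P = Σ[ F ∈ Face P ] HasDimension (Face.points F) 1

  edgeSetoid : ∀ {n ℓ} → Pred (Point n) ℓ → Setoid (c ⊔ ℓ₁ ⊔ ℓ₂ ⊔ ℓ) (c ⊔ ℓ₁ ⊔ ℓ)
  edgeSetoid {n} {ℓ} P =
    On.setoid (≐-setoid (Point n) (ℓ₁ ⊔ ℓ)) (λ (e : Edge P) → Face.points (proj₁ e))

  _HasEdgeCount_ : ∀ {n ℓ} → Pred (Point n) ℓ → ℕ → Set (c ⊔ ℓ₁ ⊔ ℓ₂ ⊔ ℓ)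
  P HasEdgeCount k = Bijection (≡-setoid (Fin k)) (edgeSetoid P)

  sumSubsets : ∀ {m} → (Subset m → Carrier) → Carrier
  sumSubsets {zero}  f = f []
  sumSubsets {suc m} f =
    sumSubsets (λ S → f (inside ∷ S)) + sumSubsets (λ S → f (outside ∷ S))

  sumGraphs : ∀ {n} → (Graph n → Carrier) → Carrier
  sumGraphs f = sumSubsets (λ S → f (graph S))

  -- The probability of G under independent retention of the arcs of the
  -- complete graph, each with probability p.
  probability : ∀ {n} → Carrier → Graph n → Carrier
  probability p G = product (λ k → if Vec.lookup (arcs G) k then p else 1# - p)

  𝔼 : ∀ {n} → Carrier → (Graph n → ℕ) → Carrier
  𝔼 p X = sumGraphs (λ G → probability p G * fromℕ (X G))

  Sequence : Set c
  Sequence = ℕ → Carrier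

  infix 4 _≃_ _≪_ _≫_ _≳_

  Eventually : ∀ {ℓ} → Pred ℕ ℓ → Set ℓ
  Eventually Q = ∃[ N ] ∀ n → N ℕ.≤ n → Q n

  -- Q holds of ∣ a n / b n ∣ for all large n; in particular the quotient is
  -- eventually defined.
  EventuallyRatio : ∀ {ℓ} → Sequence → Sequence → Pred Carrier ℓ → Set (ℓ₂ ⊔ ℓ)
  EventuallyRatio a b Q =
    Eventually (λ n → Σ[ bn#0 ∈ b n # 0# ] Q ∣ divide (a n) (b n) bn#0 ∣)

  -- Limits superior and inferior need not exist constructively, so conditions
  -- on them are expressed by the eventual bounds that they mean.

  -- 0 < liminf ∣ a n / b n ∣
  _≳_ : Sequence → Sequence → Set (c ⊔ ℓ₂)
  a ≳ b = ∃[ δ ] 0# < δ × EventuallyRatio a b (δ ≤_)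

  -- limsup ∣ a n / b n ∣ < ∞
  RatioBounded : Sequence → Sequence → Set (c ⊔ ℓ₂)
  RatioBounded a b = ∃[ M ] EventuallyRatio a b (_≤ M)

  _≃_ : Sequence → Sequence → Set (c ⊔ ℓ₂)
  a ≃ b = a ≳ b × RatioBounded a b

  -- limsup ∣ a n / b n ∣ = 0
  _≪_ : Sequence → Sequence → Set (c ⊔ ℓ₂)
  a ≪ b = ∀ ε → 0# < ε → EventuallyRatio a b (_≤ ε)

  -- liminf ∣ a n / b n ∣ = ∞
  _≫_ : Sequence → Sequence → Set (c ⊔ ℓ₂)
  a ≫ b = ∀ M → EventuallyRatio a b (M ≤_)

  TendsTo∞ : Sequence → Set (c ⊔ ℓ₂)
  TendsTo∞ a = ∀ M → Eventually (λ n → M ≤ a n)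

  -- The value at 0 is a placeholder; only large n matter.
  n⁻¹ : Sequence
  n⁻¹ zero    = 0#
  n⁻¹ (suc n) = divide 1# (fromℕ (suc n)) (#-sym (<⇒# (0<fromℕ-suc n)))

  n⁻² : Sequence
  n⁻² n = n⁻¹ n ^ 2

-- Write e_i - e_j for the vertex of an oriented arc (i , j).  All these vectors
-- have length √2, so no three of them are collinear, and a one-dimensional face
-- contains exactly two.  A pair of vertices spans an edge iff
--   * the arcs are disjoint, g = (i , j) and h = (k , l), and {i , l} and {k , j}
--     are not both present, since e_i - e_l and e_k - e_j have the same sum; or
--   * the arcs have a common source or a common target; or
--   * they form a path k → i → j, {k , j} is absent, and k and j have no common
--     neighbour u other than i, since e_k - e_u and e_u - e_j have the same sum.
-- In each case an explicit potential on the nodes gives the supporting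
-- hyperplane.  By independence the three kinds of pairs are edges with
-- probability p²(1 - p²), p² and p²(1 - p)(1 - p²)^(n - 3); summing over all
-- ordered pairs of orientations counts every edge twice and gives the formula.
-- The asymptotics follow from A / 16 ≤ E[K] ≤ 4 A for n ≥ 6, where
-- A = n⁴ p² (1 - p) + n³ p².

module Submission where

open import Defs
import Algebra.Apartness.Properties.HeytingCommutativeRing as HeytingProperties
open import Algebra.Bundles using (CommutativeRing; RawRing)
import Algebra.Properties.AbelianGroup as AbelianGroupProperties
import Algebra.Properties.Ring as RingProperties
import Algebra.Properties.Semiring.Mult as SemiringMult
import Algebra.Properties.Semiring.Sum as SemiringSum
import Algebra.Solver.Ring as RingSolver
open import Algebra.Solver.Ring.AlmostCommutativeRing using (AlmostCommutativeRing; fromCommutativeRing; _-Raw-AlmostCommutative⟶_)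
open import Data.Bool.Base using (Bool; true; false; not; _∧_; if_then_else_)
open import Data.Bool.ListAction using (all)
import Data.Bool.Properties as Bool
open import Data.Empty using (⊥; ⊥-elim)
open import Data.Fin using (Fin; zero; suc; #_)
import Data.Fin.Base as Fin
import Data.Fin.Properties as Fin
open import Data.Fin.Subset using (Subset; inside; outside)
open import Data.List.Base as List using (List; []; _∷_; _++_; map; allFin; cartesianProduct; filter; length)
open import Data.List.Membership.DecPropositional using () renaming (_∈?_ to ∈?)
open import Data.List.Membership.Propositional using (_∈_; _∉_)
open import Data.List.Membership.Propositional.Properties using (∈-allFin; ∈-cartesianProduct⁺; ∈-filter⁺; ∈-filter⁻; ∈-lookup; ∈-map⁺; ∈-map⁻; ∈-++⁺ˡ; ∈-++⁺ʳ; ∈-++⁻)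
open import Data.List.Properties using (length-tabulate)
open import Data.List.Relation.Unary.All as All using (All; []; _∷_)
open import Data.List.Relation.Unary.AllPairs using ([]; _∷_)
open import Data.List.Relation.Unary.Any as Any using (here; there)
open import Data.List.Relation.Unary.Any.Properties using (lookup-index)
open import Data.List.Relation.Unary.Unique.Propositional using (Unique)
import Data.List.Relation.Unary.Unique.Propositional.Properties as Unique
open import Data.Maybe.Base using (Maybe; just; nothing)
open import Data.Nat.Base as ℕ using (ℕ; zero; suc; z≤n; s≤s; _∸_) renaming (_*_ to _*ₙ_)
open import Data.Nat.Combinatorics using (_C_; nC1≡n; nCk+nC[k+1]≡[n+1]C[k+1])
import Data.Nat.Properties as ℕ
import Data.Nat.Solver as ℕSolver
open import Data.Product.Base using (Σ-syntax; ∃-syntax; _×_; _,_; proj₁; proj₂)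
open import Data.Product.Properties using (≡-dec)
open import Data.Sum.Base using (_⊎_; inj₁; inj₂; [_,_]′)
open import Data.Unit.Base using (tt)
open import Data.Vec.Base as Vec using (Vec; []; _∷_; _[_]≔_)
open import Data.Vec.Functional using (Vector) renaming ([] to []ᵛ; _∷_ to _∷ᵛ_)
open import Data.Vec.Properties using ([]=⇒lookup; lookup⇒[]=; lookup∘update′)
open import Data.Vec.Relation.Unary.All using () renaming ([] to []ᵃ; _∷_ to _∷ᵃ_)
import Data.Vec.Relation.Unary.All.Properties as Allᵛ
open import Data.Vec.Relation.Unary.AllPairs using () renaming ([] to []ᵖ; _∷_ to _∷ᵖ_)
open import Data.Vec.Relation.Unary.Unique.Propositional using () renaming (Unique to Uniqueᵛ)
open import Function.Base using (_∘_)
open import Function.Bundles using (_⇔_; mk⇔)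
open import Level using (Level; _⊔_)
open import Relation.Binary.Definitions using (tri<; tri≈; tri>)
open import Relation.Binary.PropositionalEquality as ≡ using (_≡_; _≢_)
import Relation.Binary.Reasoning.Base.Triple as TripleReasoning
import Relation.Binary.Reasoning.Setoid as SetoidReasoning
open import Relation.Binary.Structures using (IsPreorder; IsStrictPartialOrder)
open import Relation.Nullary.Decidable using (Dec; yes; no; does; ¬?; toWitness; _⊎-dec_)
open import Relation.Nullary.Negation using (¬_; contradiction)
open import Relation.Unary using (_≐_; _⊆_)

-- Neither equality nor order of these reals is assumed decidable, so a proof cannot test which
-- vertices lie on a given hyperplane. The graph is decidable, hence the Boolean criterion `isEdge`:
-- it is computed from adjacencies alone and can be both counted and averaged. From the criterion to
-- a face, the potentials take natural values, and a finite table decides which differences reach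
-- the height. From a face to the criterion, vertices must be produced: a weight of a convex
-- combination that is apart from 0 forces its vertex onto the hyperplane, and two points of the
-- face that are apart force a second vertex. Any failure of the criterion then gives a third vertex
-- on the face or makes the offset 0, and both are impossible. Independence of arcs is used in
-- pointwise form, as invariance of a function under changing one entry of the subset. Because each
-- edge is met twice among ordered pairs, the expectation is computed in doubled form, and 2 is
-- cancelled only at the end.

-- Ring identities and a ring solver with integer coefficients

module OrderedField {c ℓ₁ ℓ₂ : Level} (ℝ : Reals c ℓ₁ ℓ₂) where

  open Theory ℝ hiding (zero)

  open HeytingProperties heytingCommutativeRing public
    using (#-congʳ; x#0y#0→xy#0; 1#0; x-0≈x; invertibleˡ⇒#)
  open CommutativeRing commutativeRing public
    using (ring; semiring; +-abelianGroup)
  open RingProperties ring public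
    using (-‿distribˡ-*; -‿distribʳ-*; -‿involutive)
  open AbelianGroupProperties +-abelianGroup public
    using () renaming (⁻¹-∙-comm to -‿+-comm)
  open SemiringMult semiring public using (×-homo-+; ×1-homo-*)

  fromℤ : ℕ × ℕ → Carrier
  fromℤ (a , b) = fromℕ a - fromℕ b

  fromℕ-+ : ∀ m n → fromℕ (m ℕ.+ n) ≈ fromℕ m + fromℕ n
  fromℕ-+ = ×-homo-+ 1#

  fromℕ-* : ∀ m n → fromℕ (m *ₙ n) ≈ fromℕ m * fromℕ n
  fromℕ-* = ×1-homo-*

  module _ where
    open SetoidReasoning setoid

    +-interchange : ∀ a b c d → (a + b) + (c + d) ≈ (a + c) + (b + d)
    +-interchange a b c d = begin
      (a + b) + (c + d) ≈⟨ +-assoc a b (c + d) ⟩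
      a + (b + (c + d)) ≈⟨ +-congˡ (+-assoc b c d) ⟨
      a + ((b + c) + d) ≈⟨ +-congˡ (+-congʳ (+-comm b c)) ⟩
      a + ((c + b) + d) ≈⟨ +-congˡ (+-assoc c b d) ⟩
      a + (c + (b + d)) ≈⟨ +-assoc a c (b + d) ⟨
      (a + c) + (b + d) ∎

    +-minus : ∀ a b c d → (a + c) - (b + d) ≈ (a - b) + (c - d)
    +-minus a b c d = trans (+-congˡ (sym (-‿+-comm b d))) (+-interchange a c (- b) (- d))

    *-minus : ∀ a b c d → (a * c + b * d) - (a * d + b * c) ≈ (a - b) * (c - d)
    *-minus a b c d = sym (begin
      (a - b) * (c - d)
        ≈⟨ distribʳ (c - d) a (- b) ⟩
      a * (c - d) + - b * (c - d)
        ≈⟨ +-cong (distribˡ a c (- d)) (distribˡ (- b) c (- d)) ⟩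
      (a * c + a * - d) + (- b * c + - b * - d)
        ≈⟨ +-cong (+-congˡ (sym (-‿distribʳ-* a d)))
             (+-cong (sym (-‿distribˡ-* b c))
               (trans (sym (-‿distribˡ-* b (- d)))
                 (trans (-‿cong (sym (-‿distribʳ-* b d))) (-‿involutive (b * d))))) ⟩
      (a * c - a * d) + (- (b * c) + b * d)
        ≈⟨ +-congˡ (+-comm (- (b * c)) (b * d)) ⟩
      (a * c - a * d) + (b * d - b * c)
        ≈⟨ +-minus (a * c) (a * d) (b * d) (b * c) ⟨
      (a * c + b * d) - (a * d + b * c) ∎)

    minus-swap : ∀ a b → b - a ≈ - (a - b)
    minus-swap a b = begin
      b - a         ≈⟨ +-comm b (- a) ⟩
      - a + b       ≈⟨ +-congˡ (-‿involutive b) ⟨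
      - a + - (- b) ≈⟨ -‿+-comm a (- b) ⟩
      - (a - b)     ∎

    fromℤ-≡ : ∀ a b c d → a ℕ.+ d ≡ c ℕ.+ b → fromℤ (a , b) ≈ fromℤ (c , d)
    fromℤ-≡ a b c d eq = begin
      fromℕ a - fromℕ b
        ≈⟨ +-identityʳ _ ⟨
      (fromℕ a - fromℕ b) + 0#
        ≈⟨ +-congˡ (-‿inverseʳ (fromℕ d)) ⟨
      (fromℕ a - fromℕ b) + (fromℕ d - fromℕ d)
        ≈⟨ +-minus _ _ _ _ ⟨
      (fromℕ a + fromℕ d) - (fromℕ b + fromℕ d)
        ≈⟨ +-congʳ (fromℕ-+ a d) ⟨
      fromℕ (a ℕ.+ d) - (fromℕ b + fromℕ d)
        ≈⟨ +-cong (reflexive (≡.cong fromℕ eq)) (-‿cong (+-comm _ _)) ⟩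
      fromℕ (c ℕ.+ b) - (fromℕ d + fromℕ b)
        ≈⟨ +-congʳ (fromℕ-+ c b) ⟩
      (fromℕ c + fromℕ b) - (fromℕ d + fromℕ b)
        ≈⟨ +-minus _ _ _ _ ⟩
      (fromℕ c - fromℕ d) + (fromℕ b - fromℕ b)
        ≈⟨ +-congˡ (-‿inverseʳ (fromℕ b)) ⟩
      (fromℕ c - fromℕ d) + 0#
        ≈⟨ +-identityʳ _ ⟩
      fromℕ c - fromℕ d ∎

  almostCommutativeRing : AlmostCommutativeRing c ℓ₁
  almostCommutativeRing = fromCommutativeRing commutativeRing

  -- A coefficient (m , n) stands for the integer m - n.  The solver compares
  -- values of coefficients by refl, so these are kept reduced, with m or n zero.
  reduce : ℕ × ℕ → ℕ × ℕ
  reduce (a , b) = (a ∸ b , b ∸ a)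

  coefficients : RawRing _ _
  coefficients = record
    { Carrier = ℕ × ℕ
    ; _≈_     = _≡_
    ; _+_     = λ (a , b) (c , d) → reduce (a ℕ.+ c , b ℕ.+ d)
    ; _*_     = λ (a , b) (c , d) → reduce (a *ₙ c ℕ.+ b *ₙ d , a *ₙ d ℕ.+ b *ₙ c)
    ; -_      = λ (a , b) → (b , a)
    ; 0#      = (0 , 0)
    ; 1#      = (1 , 0)
    }

  fromℤ-reduce : ∀ a b → fromℤ (reduce (a , b)) ≈ fromℤ (a , b)
  fromℤ-reduce a b = fromℤ-≡ (a ∸ b) (b ∸ a) a b
    (balance a b)
    where
    balance : ∀ m n → m ∸ n ℕ.+ n ≡ m ℕ.+ (n ∸ m)
    balance zero    zero    = ≡.refl
    balance zero    (suc n) = ≡.refl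
    balance (suc m) zero    = ≡.refl
    balance (suc m) (suc n) = ≡.trans (ℕ.+-suc (m ∸ n) n) (≡.cong suc (balance m n))

  -- The coefficients 0 and 1 are sent to `0#` and `1#` themselves, so that `:0` and `:1` evaluate
  -- to the constants as they occur in goals.
  ⟦_⟧ᶜ : ℕ × ℕ → Carrier
  ⟦ 0     , 0     ⟧ᶜ = 0#
  ⟦ 1     , 0     ⟧ᶜ = 1#
  ⟦ a     , b     ⟧ᶜ = fromℤ (a , b)

  ⟦⟧ᶜ≈fromℤ : ∀ x → ⟦ x ⟧ᶜ ≈ fromℤ x
  ⟦⟧ᶜ≈fromℤ (0 , 0)           = sym (-‿inverseʳ 0#)
  ⟦⟧ᶜ≈fromℤ (1 , 0)           = sym (trans (x-0≈x (1# + 0#)) (+-identityʳ 1#))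
  ⟦⟧ᶜ≈fromℤ (0 , suc _)       = refl
  ⟦⟧ᶜ≈fromℤ (1 , suc _)       = refl
  ⟦⟧ᶜ≈fromℤ (suc (suc _) , _) = refl

  ⟦reduce⟧ᶜ : ∀ a b → ⟦ reduce (a , b) ⟧ᶜ ≈ fromℤ (a , b)
  ⟦reduce⟧ᶜ a b = trans (⟦⟧ᶜ≈fromℤ (reduce (a , b))) (fromℤ-reduce a b)

  coefficientMorphism : coefficients -Raw-AlmostCommutative⟶ almostCommutativeRing
  coefficientMorphism = record
    { ⟦_⟧    = ⟦_⟧ᶜ
    ; +-homo = λ { x@(a , b) y@(c , d) →
        trans (⟦reduce⟧ᶜ (a ℕ.+ c) (b ℕ.+ d))
          (trans (trans (+-cong (fromℕ-+ a c) (-‿cong (fromℕ-+ b d)))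
                   (+-minus (fromℕ a) (fromℕ b) (fromℕ c) (fromℕ d)))
            (sym (+-cong (⟦⟧ᶜ≈fromℤ x) (⟦⟧ᶜ≈fromℤ y)))) }
    ; *-homo = λ { x@(a , b) y@(c , d) →
        trans (⟦reduce⟧ᶜ (a *ₙ c ℕ.+ b *ₙ d) (a *ₙ d ℕ.+ b *ₙ c))
          (trans (trans (+-cong (product-+ a c b d) (-‿cong (product-+ a d b c)))
                   (*-minus (fromℕ a) (fromℕ b) (fromℕ c) (fromℕ d)))
            (sym (*-cong (⟦⟧ᶜ≈fromℤ x) (⟦⟧ᶜ≈fromℤ y)))) }
    ; -‿homo = λ { x@(a , b) →
        trans (⟦⟧ᶜ≈fromℤ (b , a))
          (trans (minus-swap (fromℕ a) (fromℕ b)) (-‿cong (sym (⟦⟧ᶜ≈fromℤ x)))) }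
    ; 0-homo = refl
    ; 1-homo = refl
    }
    where
    product-+ : ∀ a c b d →
                fromℕ (a *ₙ c ℕ.+ b *ₙ d) ≈ fromℕ a * fromℕ c + fromℕ b * fromℕ d
    product-+ a c b d =
      trans (fromℕ-+ (a *ₙ c) (b *ₙ d)) (+-cong (fromℕ-* a c) (fromℕ-* b d))

  coefficient≟ : (x y : ℕ × ℕ) → Maybe (⟦ x ⟧ᶜ ≈ ⟦ y ⟧ᶜ)
  coefficient≟ x@(a , b) y@(c , d) with a ℕ.+ d ℕ.≟ c ℕ.+ b
  ... | yes eq = just (trans (⟦⟧ᶜ≈fromℤ x) (trans (fromℤ-≡ a b c d eq) (sym (⟦⟧ᶜ≈fromℤ y))))
  ... | no  _  = nothing

  open RingSolver coefficients almostCommutativeRing coefficientMorphism coefficient≟ public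
    using (Polynomial; solve; _:=_; _:+_; _:*_; _:-_; :-_; _:^_; con)

  :0 :1 : ∀ {m} → Polynomial m
  :0 = con (0 , 0)
  :1 = con (1 , 0)

  -- Unfolds step by step as `fromℕ` does, so that the two agree by computation; a coefficient
  -- `(n , 0)` would in general stand for the difference `fromℕ n - fromℕ 0`.
  :fromℕ : ∀ {m} → ℕ → Polynomial m
  :fromℕ zero    = :0
  :fromℕ (suc n) = :1 :+ :fromℕ n

-- Constructive order arithmetic

module OrderProperties {c ℓ₁ ℓ₂ : Level} (ℝ : Reals c ℓ₁ ℓ₂) where

  open Theory ℝ hiding (zero)
  open OrderedField ℝ

  open IsStrictPartialOrder isStrictPartialOrder public
    using (<-respʳ-≈; <-respˡ-≈; <-resp-≈)
    renaming (trans to <-trans; asym to <-asym; irrefl to <-irrefl)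

  -- Takes the place of trichotomy. It comes from cotransitivity of `#`, each apartness being turned
  -- into a strict inequality; the unwanted directions are repaired by transitivity with `x < y`.
  <-cotrans : ∀ {x y} → x < y → ∀ z → x < z ⊎ z < y
  <-cotrans {x} {y} x<y z with #-cotrans (<⇒# x<y) z
  ... | inj₁ x#z with #⇒< x#z
  ...   | inj₁ x<z = inj₁ x<z
  ...   | inj₂ z<x = inj₂ (<-trans z<x x<y)
  <-cotrans {x} {y} x<y z | inj₂ z#y with #⇒< z#y
  ...   | inj₁ z<y = inj₂ z<y
  ...   | inj₂ y<z = inj₁ (<-trans x<y y<z)

  ≤-refl : ∀ {x} → x ≤ x
  ≤-refl = <-irrefl refl

  ≤-reflexive : ∀ {x y} → x ≈ y → x ≤ y
  ≤-reflexive x≈y = <-irrefl (sym x≈y)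

  ≤-trans : ∀ {x y z} → x ≤ y → y ≤ z → x ≤ z
  ≤-trans {y = y} x≤y y≤z z<x with <-cotrans z<x y
  ... | inj₁ z<y = y≤z z<y
  ... | inj₂ y<x = x≤y y<x

  <⇒≤ : ∀ {x y} → x < y → x ≤ y
  <⇒≤ = <-asym

  <-≤-trans : ∀ {x y z} → x < y → y ≤ z → x < z
  <-≤-trans {z = z} x<y y≤z with <-cotrans x<y z
  ... | inj₁ x<z = x<z
  ... | inj₂ z<y = contradiction z<y y≤z

  ≤-<-trans : ∀ {x y z} → x ≤ y → y < z → x < z
  ≤-<-trans {x = x} x≤y y<z with <-cotrans y<z x
  ... | inj₁ y<x = contradiction y<x x≤y
  ... | inj₂ x<z = x<z

  ¬#⇒≈ : ∀ {x y} → ¬ x # y → x ≈ y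
  ¬#⇒≈ = proj₁ (tight _ _)

  ≤-antisym : ∀ {x y} → x ≤ y → y ≤ x → x ≈ y
  ≤-antisym x≤y y≤x = ¬#⇒≈ λ x#y → [ y≤x , x≤y ]′ (#⇒< x#y)

  ≤-isPreorder : IsPreorder _≈_ _≤_
  ≤-isPreorder = record
    { isEquivalence = isEquivalence ; reflexive = ≤-reflexive ; trans = ≤-trans }

  module ≤-Reasoning = TripleReasoning ≤-isPreorder
    <-asym <-trans <-resp-≈ <⇒≤ <-≤-trans ≤-<-trans

  ≤∧#⇒< : ∀ {x y} → x ≤ y → x # y → x < y
  ≤∧#⇒< x≤y x#y with #⇒< x#y
  ... | inj₁ x<y = x<y
  ... | inj₂ y<x = contradiction y<x x≤y

  <-difference : ∀ {x y} → x < y → 0# < y - x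
  <-difference {x} {y} x<y = <-respˡ-≈ (-‿inverseˡ x)
    (<-respʳ-≈ (+-comm (- x) y) (+-monoʳ-< (- x) x<y))

  difference-< : ∀ {x y} → 0# < y - x → x < y
  difference-< {x} {y} 0<y-x = <-respˡ-≈ (+-identityʳ x)
    (<-respʳ-≈ (solve 2 (λ x y → x :+ (y :- x) := y) refl x y) (+-monoʳ-< x 0<y-x))

  ≤-difference : ∀ {x y} → x ≤ y → 0# ≤ y - x
  ≤-difference {x} {y} x≤y y-x<0 = x≤y
    (<-respˡ-≈ (solve 2 (λ x y → x :+ (y :- x) := y) refl x y)
      (<-respʳ-≈ (+-identityʳ x) (+-monoʳ-< x y-x<0)))

  difference-≤ : ∀ {x y} → 0# ≤ y - x → x ≤ y
  difference-≤ {x} {y} 0≤y-x y<x = 0≤y-x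
    (<-respˡ-≈ (+-comm (- x) y) (<-respʳ-≈ (-‿inverseˡ x) (+-monoʳ-< (- x) y<x)))

  x#y⇒x-y#0 : ∀ {x y} → x # y → x - y # 0#
  x#y⇒x-y#0 {x} {y} x#y with #⇒< x#y
  ... | inj₁ x<y = <⇒# (difference-< (<-respʳ-≈ (solve 2 (λ x y → y :- x := :0 :- (x :- y)) refl x y) (<-difference x<y)))
  ... | inj₂ y<x = #-sym (<⇒# (<-difference y<x))

  x-y#0⇒x#y : ∀ {x y} → x - y # 0# → x # y
  x-y#0⇒x#y {x} {y} x-y#0 with #⇒< x-y#0
  ... | inj₁ x-y<0 = <⇒# (difference-< (<-respʳ-≈ (solve 2 (λ x y → :0 :- (x :- y) := y :- x) refl x y) (<-difference x-y<0)))
  ... | inj₂ 0<x-y = #-sym (<⇒# (difference-< 0<x-y))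

  -- Cotransitivity splits the apartness of `x + y` and `0#` at `y`; if `x + y` is apart from `y`,
  -- subtracting `y` gives the first alternative.
  x+y#0⇒x#0⊎y#0 : ∀ {x y} → x + y # 0# → x # 0# ⊎ y # 0#
  x+y#0⇒x#0⊎y#0 {x} {y} x+y#0 with #-cotrans x+y#0 y
  ... | inj₁ x+y#y = inj₁ (#-congʳ (solve 2 (λ x y → x :+ y :- y := x) refl x y) (x#y⇒x-y#0 x+y#y))
  ... | inj₂ y#0   = inj₂ y#0

  -- If `z` inverts `x * y`, then `z * y` inverts `x`.
  x*y#0⇒x#0 : ∀ {x y} → x * y # 0# → x # 0#
  x*y#0⇒x#0 {x} {y} xy#0 with #⇒invertible xy#0
  ... | z , zxy≈1 , _ = invertibleˡ⇒# (z * y ,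
    trans (solve 3 (λ x y z → (z :* y) :* (x :- :0) := z :* (x :* y :- :0)) refl x y z) zxy≈1)

  x*y#0⇒y#0 : ∀ {x y} → x * y # 0# → y # 0#
  x*y#0⇒y#0 {x} {y} xy#0 = x*y#0⇒x#0 (#-congʳ (*-comm x y) xy#0)

  -- The conclusion is an equation, so by tightness it may be proved by contradiction. This serves
  -- factors known to be nonzero only in the negative sense, such as differences of positions on a
  -- line.
  x*y≈0∧y≉0⇒x≈0 : ∀ {x y} → x * y ≈ 0# → ¬ y ≈ 0# → x ≈ 0#
  x*y≈0∧y≉0⇒x≈0 {x} {y} xy≈0 y≉0 = ¬#⇒≈ λ x#0 →
    y≉0 (¬#⇒≈ λ y#0 → proj₂ (tight _ _) xy≈0 (x#0y#0→xy#0 x#0 y#0))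

  x*y≈0∧x#0⇒y≈0 : ∀ {x y} → x * y ≈ 0# → x # 0# → y ≈ 0#
  x*y≈0∧x#0⇒y≈0 xy≈0 x#0 = ¬#⇒≈ λ y#0 →
    proj₂ (tight _ _) xy≈0 (x#0y#0→xy#0 x#0 y#0)

  +-monoˡ-≤ : ∀ z {x y} → x ≤ y → x + z ≤ y + z
  +-monoˡ-≤ z {x} {y} x≤y = difference-≤ (≤-trans (≤-difference x≤y)
    (≤-reflexive (solve 3 (λ x y z → y :- x := y :+ z :- (x :+ z)) refl x y z)))

  +-monoʳ-≤ : ∀ z {x y} → x ≤ y → z + x ≤ z + y
  +-monoʳ-≤ z {x} {y} x≤y = difference-≤ (≤-trans (≤-difference x≤y)
    (≤-reflexive (solve 3 (λ x y z → y :- x := z :+ y :- (z :+ x)) refl x y z)))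

  +-mono-≤ : ∀ {x y u v} → x ≤ y → u ≤ v → x + u ≤ y + v
  +-mono-≤ {y = y} {u = u} x≤y u≤v = ≤-trans (+-monoˡ-≤ u x≤y) (+-monoʳ-≤ y u≤v)

  +-nonneg : ∀ {x y} → 0# ≤ x → 0# ≤ y → 0# ≤ x + y
  +-nonneg 0≤x 0≤y = ≤-trans (≤-reflexive (sym (+-identityʳ 0#))) (+-mono-≤ 0≤x 0≤y)

  -- Signs cannot be split into cases. If the product were negative, both factors would be apart
  -- from 0, hence positive, and then so would be the product.
  *-nonneg : ∀ {x y} → 0# ≤ x → 0# ≤ y → 0# ≤ x * y
  *-nonneg {x} {y} 0≤x 0≤y xy<0 = <-asym xy<0 (*-positive
    (≤∧#⇒< 0≤x (#-sym (x*y#0⇒x#0 (<⇒# xy<0)))) (≤∧#⇒< 0≤y (#-sym (x*y#0⇒y#0 (<⇒# xy<0)))))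

  *-monoˡ-≤ : ∀ {z} → 0# ≤ z → ∀ {x y} → x ≤ y → z * x ≤ z * y
  *-monoˡ-≤ {z} 0≤z {x} {y} x≤y = difference-≤ (≤-trans (*-nonneg 0≤z (≤-difference x≤y))
    (≤-reflexive (solve 3 (λ x y z → z :* (y :- x) := z :* y :- z :* x) refl x y z)))

  *-monoʳ-≤ : ∀ {z} → 0# ≤ z → ∀ {x y} → x ≤ y → x * z ≤ y * z
  *-monoʳ-≤ {z} 0≤z {x} {y} x≤y = difference-≤ (≤-trans (*-nonneg (≤-difference x≤y) 0≤z)
    (≤-reflexive (solve 3 (λ x y z → (y :- x) :* z := y :* z :- x :* z) refl x y z)))

  *-mono-≤ : ∀ {x y u v} → 0# ≤ x → 0# ≤ u → x ≤ y → u ≤ v → x * u ≤ y * v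
  *-mono-≤ 0≤x 0≤u x≤y u≤v =
    ≤-trans (*-monoʳ-≤ 0≤u x≤y) (*-monoˡ-≤ (≤-trans 0≤x x≤y) u≤v)

  *-monoʳ-< : ∀ {z} → 0# < z → ∀ {x y} → x < y → x * z < y * z
  *-monoʳ-< {z} 0<z {x} {y} x<y = difference-< (<-respʳ-≈
    (solve 3 (λ x y z → (y :- x) :* z := y :* z :- x :* z) refl x y z)
    (*-positive (<-difference x<y) 0<z))

  *-cancelʳ-≤ : ∀ {z} → 0# < z → ∀ {x y} → x * z ≤ y * z → x ≤ y
  *-cancelʳ-≤ 0<z xz≤yz y<x = xz≤yz (*-monoʳ-< 0<z y<x)

  ^-nonneg : ∀ {x} n → 0# ≤ x → 0# ≤ x ^ n
  ^-nonneg zero    0≤x = <⇒≤ 0<1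
  ^-nonneg (suc n) 0≤x = *-nonneg 0≤x (^-nonneg n 0≤x)

  ^-positive : ∀ {x} n → 0# < x → 0# < x ^ n
  ^-positive zero    0<x = 0<1
  ^-positive (suc n) 0<x = *-positive 0<x (^-positive n 0<x)

  ^-≤-1 : ∀ {x} n → 0# ≤ x → x ≤ 1# → x ^ n ≤ 1#
  ^-≤-1 zero    0≤x x≤1 = ≤-refl
  ^-≤-1 (suc n) 0≤x x≤1 = ≤-trans (*-mono-≤ 0≤x (^-nonneg n 0≤x) x≤1 (^-≤-1 n 0≤x x≤1))
    (≤-reflexive (*-identityˡ 1#))

  1≤x*y : ∀ {x y} → 1# ≤ x → 1# ≤ y → 1# ≤ x * y
  1≤x*y 1≤x 1≤y = ≤-trans (≤-reflexive (sym (*-identityˡ 1#)))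
    (*-mono-≤ (<⇒≤ 0<1) (<⇒≤ 0<1) 1≤x 1≤y)

  fromℕ-nonneg : ∀ n → 0# ≤ fromℕ n
  fromℕ-nonneg zero    = ≤-refl
  fromℕ-nonneg (suc n) = <⇒≤ (0<fromℕ-suc n)

  fromℕ-mono-≤ : ∀ {m n} → m ℕ.≤ n → fromℕ m ≤ fromℕ n
  fromℕ-mono-≤ {n = n} z≤n   = fromℕ-nonneg n
  fromℕ-mono-≤ (s≤s m≤n) = +-monoʳ-≤ 1# (fromℕ-mono-≤ m≤n)

  fromℕ-mono-< : ∀ {m n} → m ℕ.< n → fromℕ m < fromℕ n
  fromℕ-mono-< {zero}  {suc n} m<n       = 0<fromℕ-suc n
  fromℕ-mono-< {suc m} {suc n} (s≤s m<n) = +-monoʳ-< 1# (fromℕ-mono-< m<n)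

  x≤∣x∣ : ∀ x → x ≤ ∣ x ∣
  x≤∣x∣ x = proj₁ (supremum x (- x))

  0≤x⇒∣x∣≈x : ∀ {x} → 0# ≤ x → ∣ x ∣ ≈ x
  0≤x⇒∣x∣≈x {x} 0≤x = ≤-antisym
    (proj₂ (proj₂ (supremum x (- x))) x ≤-refl
      (difference-≤ (≤-trans (+-nonneg 0≤x 0≤x)
        (≤-reflexive (+-congˡ (sym (-‿involutive x)))))))
    (x≤∣x∣ x)

  divide-* : ∀ x y (y#0 : y # 0#) → divide x y y#0 * y ≈ x
  divide-* x y y#0 with #⇒invertible y#0
  ... | z , zy≈1 , _ = trans
    (solve 3 (λ x y z → x :* z :* y := x :* (z :* (y :- :0))) refl x y z)
    (trans (*-congˡ zy≈1) (*-identityʳ x))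

  divide-nonneg : ∀ {x y} (y#0 : y # 0#) → 0# ≤ x → 0# < y → 0# ≤ divide x y y#0
  divide-nonneg {x} {y} y#0 0≤x 0<y = *-cancelʳ-≤ 0<y
    (≤-trans (≤-reflexive (zeroˡ y)) (≤-trans 0≤x (≤-reflexive (sym (divide-* x y y#0)))))

  ∣divide∣*≈ : ∀ {x y} (y#0 : y # 0#) → 0# ≤ x → 0# < y → ∣ divide x y y#0 ∣ * y ≈ x
  ∣divide∣*≈ {x} {y} y#0 0≤x 0<y =
    trans (*-congʳ (0≤x⇒∣x∣≈x (divide-nonneg y#0 0≤x 0<y))) (divide-* x y y#0)

  x+x≈y+y⇒x≈y : ∀ {x y} → x + x ≈ y + y → x ≈ y
  x+x≈y+y⇒x≈y {x} {y} x+x≈y+y = trans (solve 2 (λ x y → x := (x :- y) :+ y) refl x y)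
    (trans (+-congʳ (x*y≈0∧x#0⇒y≈0 2[x-y]≈0 (#-sym (<⇒# (0<fromℕ-suc 1))))) (+-identityˡ y))
    where
    2[x-y]≈0 : fromℕ 2 * (x - y) ≈ 0#
    2[x-y]≈0 = trans (solve 2 (λ x y → :fromℕ 2 :* (x :- y) := x :+ x :- (y :+ y)) refl x y)
      (trans (+-congʳ x+x≈y+y) (-‿inverseʳ (y + y)))

-- Arcs, adjacency and orientations

module Adjacency where

  lookup-injective : ∀ {a} {A : Set a} {xs : List A} → Unique xs →
                     ∀ {i j} → List.lookup xs i ≡ List.lookup xs j → i ≡ j
  lookup-injective (x∉xs ∷ xs!) {zero}  {zero}  eq = ≡.refl
  lookup-injective (x∉xs ∷ xs!) {zero}  {suc j} eq = contradiction eq (All.lookup x∉xs (∈-lookup j))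
  lookup-injective (x∉xs ∷ xs!) {suc i} {zero}  eq =
    contradiction (≡.sym eq) (All.lookup x∉xs (∈-lookup i))
  lookup-injective (x∉xs ∷ xs!) {suc i} {suc j} eq = ≡.cong suc (lookup-injective xs! eq)

  private variable
    n : ℕ
    i j k l : Fin n

  ArcIndex : ℕ → Set
  ArcIndex n = Fin (length (completeArcs n))

  arc-injective : ∀ {a b : ArcIndex n} → arc n a ≡ arc n b → a ≡ b
  arc-injective {n} = lookup-injective
    (Unique.filter⁺ _ (Unique.cartesianProduct⁺ (Unique.allFin⁺ n) (Unique.allFin⁺ n)))

  arc-< : ∀ (a : ArcIndex n) → proj₁ (arc n a) Fin.< proj₂ (arc n a)
  arc-< {n} a = proj₂ (∈-filter⁻ (λ (i , j) → i Fin.<? j)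
    {xs = cartesianProduct (allFin n) (allFin n)} (∈-lookup a))

  SamePair : Fin n × Fin n → Fin n → Fin n → Set
  SamePair (a , b) i j = (a ≡ i × b ≡ j) ⊎ (a ≡ j × b ≡ i)

  -- The listed arcs are increasing pairs, so two of them matching {i , j} in opposite orders would
  -- give `<` in both directions.
  arc-unique : ∀ {a b : ArcIndex n} → SamePair (arc n a) i j → SamePair (arc n b) i j → a ≡ b
  arc-unique (inj₁ (≡.refl , ≡.refl)) (inj₁ (eq , eq′)) =
    ≡.sym (arc-injective (≡.cong₂ _,_ eq eq′))
  arc-unique (inj₂ (≡.refl , ≡.refl)) (inj₂ (eq , eq′)) =
    ≡.sym (arc-injective (≡.cong₂ _,_ eq eq′))
  arc-unique {a = a} {b} (inj₁ (≡.refl , ≡.refl)) (inj₂ (eq , eq′)) =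
    contradiction (≡.subst₂ Fin._<_ eq eq′ (arc-< b)) (ℕ.<-asym (arc-< a))
  arc-unique {a = a} {b} (inj₂ (≡.refl , ≡.refl)) (inj₁ (eq , eq′)) =
    contradiction (≡.subst₂ Fin._<_ eq eq′ (arc-< b)) (ℕ.<-asym (arc-< a))

  <-arcIndex : i Fin.< j → Σ[ a ∈ ArcIndex n ] arc n a ≡ (i , j)
  <-arcIndex {i = i} {j} i<j = Any.index i,j∈ , ≡.sym (lookup-index i,j∈)
    where
    i,j∈ : (i , j) ∈ completeArcs _
    i,j∈ = ∈-filter⁺ _ (∈-cartesianProduct⁺ (∈-allFin i) (∈-allFin j)) i<j

  arcIndexOf : i ≢ j → Σ[ a ∈ ArcIndex n ] SamePair (arc n a) i j
  arcIndexOf {i = i} {j} i≢j with Fin.<-cmp i j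
  ... | tri< i<j _ _ = let a , eq = <-arcIndex i<j in
                       a , inj₁ (≡.cong proj₁ eq , ≡.cong proj₂ eq)
  ... | tri≈ _ i≡j _ = contradiction i≡j i≢j
  ... | tri> _ _ j<i = let a , eq = <-arcIndex j<i in
                       a , inj₂ (≡.cong proj₁ eq , ≡.cong proj₂ eq)

  arcIndex : {i j : Fin n} → i ≢ j → ArcIndex n
  arcIndex i≢j = proj₁ (arcIndexOf i≢j)

  arc-arcIndex : (i≢j : i ≢ j) → SamePair (arc n (arcIndex i≢j)) i j
  arc-arcIndex i≢j = proj₂ (arcIndexOf i≢j)

  SamePair-swap : ∀ {p} → SamePair {n} p i j → SamePair p j i
  SamePair-swap (inj₁ eqs) = inj₂ eqs
  SamePair-swap (inj₂ eqs) = inj₁ eqs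

  arcIndex-injective : (i≢j : i ≢ j) (k≢l : k ≢ l) → arcIndex i≢j ≡ arcIndex k≢l →
                       SamePair (i , j) k l
  arcIndex-injective {n} {i} {j} {k} {l} i≢j k≢l eq =
    combine (arc-arcIndex i≢j) (≡.subst (λ a → SamePair (arc n a) k l) (≡.sym eq) (arc-arcIndex k≢l))
    where
    combine : ∀ {p} → SamePair p i j → SamePair p k l → SamePair (i , j) k l
    combine (inj₁ (≡.refl , ≡.refl)) same = same
    combine (inj₂ (≡.refl , ≡.refl)) (inj₁ (≡.refl , ≡.refl)) = inj₂ (≡.refl , ≡.refl)
    combine (inj₂ (≡.refl , ≡.refl)) (inj₂ (≡.refl , ≡.refl)) = inj₁ (≡.refl , ≡.refl)

  adjacent : Subset (length (completeArcs n)) → Fin n → Fin n → Bool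
  adjacent S i j with i Fin.≟ j
  ... | yes _  = false
  ... | no i≢j = Vec.lookup S (arcIndex i≢j)

  module _ {n} (S : Subset (length (completeArcs n))) where

    adjacent-irrefl : ∀ (i : Fin n) → adjacent S i i ≡ false
    adjacent-irrefl i with i Fin.≟ i
    ... | yes _  = ≡.refl
    ... | no i≢i = contradiction ≡.refl i≢i

    adjacent-lookup : ∀ {i j : Fin n} {a} → SamePair (arc n a) i j → adjacent S i j ≡ Vec.lookup S a
    adjacent-lookup {i = i} {j} {a} same with i Fin.≟ j
    adjacent-lookup {i = i} {j} {a} (inj₁ (eq , eq′)) | yes ≡.refl =
      contradiction (arc-< a) (ℕ.<-irrefl (≡.cong Fin.toℕ (≡.trans eq (≡.sym eq′))))
    adjacent-lookup {i = i} {j} {a} (inj₂ (eq , eq′)) | yes ≡.refl =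
      contradiction (arc-< a) (ℕ.<-irrefl (≡.cong Fin.toℕ (≡.trans eq (≡.sym eq′))))
    adjacent-lookup {i = i} {j} {a} same | no i≢j =
      ≡.cong (Vec.lookup S) (arc-unique (arc-arcIndex i≢j) same)

    adjacent-arcIndex : ∀ {i j : Fin n} (i≢j : i ≢ j) → adjacent S i j ≡ Vec.lookup S (arcIndex i≢j)
    adjacent-arcIndex i≢j = adjacent-lookup {a = arcIndex i≢j} (arc-arcIndex i≢j)

    adjacent-sym : ∀ (i j : Fin n) → adjacent S i j ≡ adjacent S j i
    adjacent-sym i j with i Fin.≟ j
    ... | yes ≡.refl = ≡.sym (adjacent-irrefl i)
    ... | no i≢j = ≡.sym (adjacent-lookup {a = arcIndex i≢j} (SamePair-swap (arc-arcIndex i≢j)))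

  -- Different pairs of nodes have different arc indices. Every use of independence below rests on
  -- this.
  adjacent-update : ∀ {i j k l : Fin n} (S : Subset (length (completeArcs n)))
                    (i≢j : i ≢ j) (b : Bool) →
                    ¬ SamePair (k , l) i j →
                    adjacent (S [ arcIndex i≢j ]≔ b) k l ≡ adjacent S k l
  adjacent-update {k = k} {l} S i≢j b kl≠ij with k Fin.≟ l
  ... | yes _  = ≡.refl
  ... | no k≢l = lookup∘update′ (λ eq → kl≠ij (arcIndex-injective k≢l i≢j eq)) S b

  -- An arc {i , j} has the two orientations (i , j) and (j , i).
  Orientation : ℕ → Set
  Orientation n = Fin n × Fin n

  infix 4 _≟ᵒ_
  _≟ᵒ_ : (o o′ : Orientation n) → Dec (o ≡ o′)
  _≟ᵒ_ = ≡-dec Fin._≟_ Fin._≟_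

  Loopless : Orientation n → Set
  Loopless (i , j) = i ≢ j

  reverse : Orientation n → Orientation n
  reverse (i , j) = (j , i)

  module Oriented {n} (S : Subset (length (completeArcs n))) where

    Present : Orientation n → Set
    Present (i , j) = adjacent S i j ≡ true

    present-loopless : ∀ {o} → Present o → Loopless o
    present-loopless {i , _} present ≡.refl =
      contradiction (≡.trans (≡.sym (adjacent-irrefl S i)) present) λ ()

    present-reverse : ∀ {o} → Present o → Present (reverse o)
    present-reverse {i , j} present = ≡.trans (adjacent-sym S j i) present

-- Expectations over random subsets and independence of arcs

module Expectation {c ℓ₁ ℓ₂ : Level} (ℝ : Reals c ℓ₁ ℓ₂) where

  open Theory ℝ hiding (zero)
  open OrderedField ℝ
  open Adjacency
  open SetoidReasoning setoid

  private variable
    a : Level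
    A : Set a
    m : ℕ

  ∑ : List A → (A → Carrier) → Carrier
  ∑ []       f = 0#
  ∑ (x ∷ xs) f = f x + ∑ xs f

  ∏ : List A → (A → Carrier) → Carrier
  ∏ []       f = 1#
  ∏ (x ∷ xs) f = f x * ∏ xs f

  𝟙 : Bool → Carrier
  𝟙 true  = 1#
  𝟙 false = 0#

  𝟙-∧ : ∀ b b′ → 𝟙 (b ∧ b′) ≈ 𝟙 b * 𝟙 b′
  𝟙-∧ true  b′ = sym (*-identityˡ (𝟙 b′))
  𝟙-∧ false b′ = sym (zeroˡ (𝟙 b′))

  𝟙-not : ∀ b → 𝟙 (not b) ≈ 1# - 𝟙 b
  𝟙-not true  = sym (-‿inverseʳ 1#)
  𝟙-not false = solve 0 (:1 := :1 :- :0) refl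

  sumSubsets-cong : {f g : Subset m → Carrier} → (∀ S → f S ≈ g S) →
                    sumSubsets f ≈ sumSubsets g
  sumSubsets-cong {zero}  f≈g = f≈g []
  sumSubsets-cong {suc m} f≈g =
    +-cong (sumSubsets-cong (λ S → f≈g (inside ∷ S))) (sumSubsets-cong (λ S → f≈g (outside ∷ S)))

  sumSubsets-+ : (f g : Subset m → Carrier) →
                 sumSubsets (λ S → f S + g S) ≈ sumSubsets f + sumSubsets g
  sumSubsets-+ {zero}  f g = refl
  sumSubsets-+ {suc m} f g =
    trans (+-cong (sumSubsets-+ (λ S → f (inside ∷ S)) (λ S → g (inside ∷ S)))
                  (sumSubsets-+ (λ S → f (outside ∷ S)) (λ S → g (outside ∷ S))))
      (+-interchange _ _ _ _)

  sumSubsets-*ˡ : ∀ x (f : Subset m → Carrier) →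
                  sumSubsets (λ S → x * f S) ≈ x * sumSubsets f
  sumSubsets-*ˡ {zero}  x f = refl
  sumSubsets-*ˡ {suc m} x f =
    trans (+-cong (sumSubsets-*ˡ x (λ S → f (inside ∷ S))) (sumSubsets-*ˡ x (λ S → f (outside ∷ S))))
      (sym (distribˡ x _ _))

  module _ (p : Carrier) where

    weight : Subset m → Carrier
    weight S = product (λ k → if Vec.lookup S k then p else 1# - p)

    -- The theorem's `𝔼 p X` unfolds to this, applied to the function sending `S` to
    -- `fromℕ (X (graph S))`.
    expectation : (Subset m → Carrier) → Carrier
    expectation f = sumSubsets (λ S → weight S * f S)

    expectation-cong : {f g : Subset m → Carrier} → (∀ S → f S ≈ g S) →
                       expectation f ≈ expectation g
    expectation-cong f≈g = sumSubsets-cong (λ S → *-congˡ (f≈g S))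

    -- Conditioning on the first arc, the step of the inductions on the number of arcs.
    expectation-∷ : (f : Subset (suc m) → Carrier) →
      expectation f ≈ p * expectation (λ S → f (inside ∷ S))
                      + (1# - p) * expectation (λ S → f (outside ∷ S))
    expectation-∷ f = +-cong
      (trans (sumSubsets-cong (λ S → *-assoc p (weight S) (f (inside ∷ S))))
        (sumSubsets-*ˡ p (λ S → weight S * f (inside ∷ S))))
      (trans (sumSubsets-cong (λ S → *-assoc (1# - p) (weight S) (f (outside ∷ S))))
        (sumSubsets-*ˡ (1# - p) (λ S → weight S * f (outside ∷ S))))

    expectation-+ : (f g : Subset m → Carrier) →
                    expectation (λ S → f S + g S) ≈ expectation f + expectation g
    expectation-+ f g = trans (sumSubsets-cong (λ S → distribˡ (weight S) (f S) (g S)))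
      (sumSubsets-+ (λ S → weight S * f S) (λ S → weight S * g S))

    expectation-*ˡ : ∀ x (f : Subset m → Carrier) →
                     expectation (λ S → x * f S) ≈ x * expectation f
    expectation-*ˡ x f = trans
      (sumSubsets-cong (λ S → solve 3 (λ w x y → w :* (x :* y) := x :* (w :* y)) refl (weight S) x (f S)))
      (sumSubsets-*ˡ x (λ S → weight S * f S))

    expectation-minus : (f g : Subset m → Carrier) →
                        expectation (λ S → f S - g S) ≈ expectation f - expectation g
    expectation-minus f g = begin
      expectation (λ S → f S - g S)
        ≈⟨ expectation-cong (λ S → solve 2 (λ x y → x :- y := x :+ (:- :1) :* y) refl (f S) (g S)) ⟩
      expectation (λ S → f S + - 1# * g S)
        ≈⟨ expectation-+ f (λ S → - 1# * g S) ⟩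
      expectation f + expectation (λ S → - 1# * g S)
        ≈⟨ +-congˡ (expectation-*ˡ (- 1#) g) ⟩
      expectation f + - 1# * expectation g
        ≈⟨ solve 2 (λ x y → x :+ (:- :1) :* y := x :- y) refl (expectation f) (expectation g) ⟩
      expectation f - expectation g ∎

    expectation-1 : ∀ m → expectation {m} (λ _ → 1#) ≈ 1#
    expectation-1 zero    = *-identityʳ 1#
    expectation-1 (suc m) = begin
      expectation {suc m} (λ _ → 1#)
        ≈⟨ expectation-∷ {m} (λ _ → 1#) ⟩
      p * expectation {m} (λ _ → 1#) + (1# - p) * expectation {m} (λ _ → 1#)
        ≈⟨ +-cong (*-congˡ (expectation-1 m)) (*-congˡ (expectation-1 m)) ⟩
      p * 1# + (1# - p) * 1#
        ≈⟨ solve 1 (λ p → p :* :1 :+ (:1 :- p) :* :1 := :1) refl p ⟩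
      1# ∎

    expectation-0 : ∀ m → expectation {m} (λ _ → 0#) ≈ 0#
    expectation-0 m = begin
      expectation {m} (λ _ → 0#)           ≈⟨ expectation-cong {m} {λ _ → 0# * 1#} {λ _ → 0#} (λ _ → zeroˡ 1#) ⟨
      expectation {m} (λ _ → 0# * 1#)      ≈⟨ expectation-*ˡ {m} 0# (λ _ → 1#) ⟩
      0# * expectation {m} (λ _ → 1#)      ≈⟨ zeroˡ _ ⟩
      0#                                   ∎

    expectation-∑ : (xs : List A) (f : A → Subset m → Carrier) →
                    expectation (λ S → ∑ xs (λ x → f x S)) ≈ ∑ xs (λ x → expectation (f x))
    expectation-∑ {m = m} []       f = expectation-0 m
    expectation-∑ (x ∷ xs) f =
      trans (expectation-+ (f x) (λ S → ∑ xs (λ y → f y S))) (+-congˡ (expectation-∑ xs f))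

    -- Stands in for independence: a function that ignores entry `k` is independent of the retention
    -- of arc `k`. The pointwise form passes to products and complements.
    Invariant : Fin m → (Subset m → Carrier) → Set ℓ₁
    Invariant k f = ∀ S b → f (S [ k ]≔ b) ≈ f S

    Invariant-* : ∀ {k : Fin m} {f g} → Invariant k f → Invariant k g →
                  Invariant k (λ S → f S * g S)
    Invariant-* f-inv g-inv S b = *-cong (f-inv S b) (g-inv S b)

    Invariant-1- : ∀ {k : Fin m} {f} → Invariant k f → Invariant k (λ S → 1# - f S)
    Invariant-1- f-inv S b = +-congˡ (-‿cong (f-inv S b))

    Invariant-∏ : ∀ {k : Fin m} (xs : List A) {f : A → Subset m → Carrier} →
                  (∀ {x} → x ∈ xs → Invariant k (f x)) → Invariant k (λ S → ∏ xs (λ x → f x S))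
    Invariant-∏ []       f-inv S b = refl
    Invariant-∏ (x ∷ xs) f-inv S b =
      *-cong (f-inv (here ≡.refl) S b) (Invariant-∏ xs (λ x∈xs → f-inv (there x∈xs)) S b)

    -- Induction on the position of `k`. At the head, the branch without the arc contributes nothing
    -- and invariance equates the two branches of `f`; further on, each branch is covered by the
    -- induction hypothesis.
    expectation-lookup : (k : Fin m) {f : Subset m → Carrier} → Invariant k f →
                         expectation (λ S → 𝟙 (Vec.lookup S k) * f S) ≈ p * expectation f
    expectation-lookup {suc m} zero {f} f-inv = begin
      expectation (λ S → 𝟙 (Vec.lookup S zero) * f S)
        ≈⟨ expectation-∷ (λ S → 𝟙 (Vec.lookup S zero) * f S) ⟩
      p * expectation {m} (λ S → 1# * f (inside ∷ S))
        + (1# - p) * expectation {m} (λ S → 0# * f (outside ∷ S))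
        ≈⟨ +-cong (*-congˡ (expectation-*ˡ 1# f₁)) (*-congˡ (expectation-*ˡ 0# f₀)) ⟩
      p * (1# * expectation f₁) + (1# - p) * (0# * expectation f₀)
        -- Writes `x` as `p x + (1 - p) x`, so that invariance can restore the second branch of `f`.
        ≈⟨ solve 3 (λ p x y → p :* (:1 :* x) :+ (:1 :- p) :* (:0 :* y)
             := p :* (p :* x :+ (:1 :- p) :* x)) refl p (expectation f₁) (expectation f₀) ⟩
      p * (p * expectation f₁ + (1# - p) * expectation f₁)
        ≈⟨ *-congˡ (+-congˡ (*-congˡ (expectation-cong {f = f₁} {f₀} (λ S → f-inv (outside ∷ S) inside)))) ⟩
      p * (p * expectation f₁ + (1# - p) * expectation f₀)
        ≈⟨ *-congˡ (expectation-∷ f) ⟨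
      p * expectation f ∎
      where
      f₁ f₀ : Subset m → Carrier
      f₁ S = f (inside ∷ S)
      f₀ S = f (outside ∷ S)
    expectation-lookup {suc m} (suc k) {f} f-inv = begin
      expectation (λ S → 𝟙 (Vec.lookup S (suc k)) * f S)
        ≈⟨ expectation-∷ (λ S → 𝟙 (Vec.lookup S (suc k)) * f S) ⟩
      p * expectation (λ S → 𝟙 (Vec.lookup S k) * f₁ S)
        + (1# - p) * expectation (λ S → 𝟙 (Vec.lookup S k) * f₀ S)
        ≈⟨ +-cong (*-congˡ (expectation-lookup k (λ S → f-inv (inside ∷ S))))
                  (*-congˡ (expectation-lookup k (λ S → f-inv (outside ∷ S)))) ⟩
      p * (p * expectation f₁) + (1# - p) * (p * expectation f₀)
        ≈⟨ solve 3 (λ p x y → p :* (p :* x) :+ (:1 :- p) :* (p :* y)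
             := p :* (p :* x :+ (:1 :- p) :* y)) refl p (expectation f₁) (expectation f₀) ⟩
      p * (p * expectation f₁ + (1# - p) * expectation f₀)
        ≈⟨ *-congˡ (expectation-∷ f) ⟨
      p * expectation f ∎
      where
      f₁ f₀ : Subset m → Carrier
      f₁ S = f (inside ∷ S)
      f₀ S = f (outside ∷ S)

    module _ {n : ℕ} where

      present : Fin n → Fin n → Subset (length (completeArcs n)) → Carrier
      present i j S = 𝟙 (adjacent S i j)

      Invariant-present : ∀ {i j k l : Fin n} (i≢j : i ≢ j) → ¬ SamePair (k , l) i j →
                          Invariant (arcIndex i≢j) (present k l)
      Invariant-present i≢j kl≠ij S b = reflexive (≡.cong 𝟙 (adjacent-update S i≢j b kl≠ij))

      expectation-present : ∀ {i j : Fin n} (i≢j : i ≢ j) {f} → Invariant (arcIndex i≢j) f →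
                            expectation (λ S → present i j S * f S) ≈ p * expectation f
      expectation-present i≢j {f} f-inv = trans
        (expectation-cong (λ S → *-congʳ (reflexive (≡.cong 𝟙 (adjacent-arcIndex S i≢j)))))
        (expectation-lookup (arcIndex i≢j) f-inv)

      expectation-absent : ∀ {i j : Fin n} (i≢j : i ≢ j) {f} → Invariant (arcIndex i≢j) f →
                           expectation (λ S → (1# - present i j S) * f S) ≈ (1# - p) * expectation f
      expectation-absent {i} {j} i≢j {f} f-inv = begin
        expectation (λ S → (1# - present i j S) * f S)
          ≈⟨ expectation-cong (λ S → solve 2 (λ x y → (:1 :- x) :* y := y :- x :* y) refl (present i j S) (f S)) ⟩
        expectation (λ S → f S - present i j S * f S)
          ≈⟨ expectation-minus f (λ S → present i j S * f S) ⟩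
        expectation f - expectation (λ S → present i j S * f S)
          ≈⟨ +-congˡ (-‿cong (expectation-present i≢j f-inv)) ⟩
        expectation f - p * expectation f
          ≈⟨ solve 2 (λ p x → x :- p :* x := (:1 :- p) :* x) refl p (expectation f) ⟩
        (1# - p) * expectation f ∎

      -- Multiplied out, the factor only involves the event that both arcs are present; these are
      -- different arcs, so that event splits off as `p` twice.
      expectation-notBoth : ∀ {i j k l : Fin n} (i≢j : i ≢ j) (k≢l : k ≢ l) →
        ¬ SamePair (k , l) i j → ∀ {f} →
        Invariant (arcIndex i≢j) f → Invariant (arcIndex k≢l) f →
        expectation (λ S → (1# - present i j S * present k l S) * f S)
          ≈ (1# - p ^ 2) * expectation f
      expectation-notBoth {i} {j} {k} {l} i≢j k≢l kl≠ij {f} f-inv f-inv′ = begin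
        expectation (λ S → (1# - present i j S * present k l S) * f S)
          ≈⟨ expectation-cong (λ S → solve 3 (λ x y z → (:1 :- x :* y) :* z := z :- x :* (y :* z))
               refl (present i j S) (present k l S) (f S)) ⟩
        expectation (λ S → f S - present i j S * (present k l S * f S))
          ≈⟨ expectation-minus f (λ S → present i j S * (present k l S * f S)) ⟩
        expectation f - expectation (λ S → present i j S * (present k l S * f S))
          ≈⟨ +-congˡ (-‿cong (expectation-present i≢j
               (Invariant-* (Invariant-present i≢j kl≠ij) f-inv))) ⟩
        expectation f - p * expectation (λ S → present k l S * f S)
          ≈⟨ +-congˡ (-‿cong (*-congˡ (expectation-present k≢l f-inv′))) ⟩
        expectation f - p * (p * expectation f)
          ≈⟨ solve 2 (λ p x → x :- p :* (p :* x) := (:1 :- p :^ 2) :* x) refl p (expectation f) ⟩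
        (1# - p ^ 2) * expectation f ∎

      -- Each `u` contributes the arcs {u , k} and {u , j}. As no `u` is `k` or `j`, different `u`
      -- have no arc in common, and one factor can be split off at a time.
      expectation-noCommonNeighbour : ∀ {k j : Fin n} → k ≢ j → (us : List (Fin n)) →
        Unique us → All (λ u → u ≢ k × u ≢ j) us →
        expectation (λ S → ∏ us (λ u → 1# - present u k S * present u j S))
          ≈ (1# - p ^ 2) ^ length us
      expectation-noCommonNeighbour k≢j [] [] [] = expectation-1 (length (completeArcs n))
      expectation-noCommonNeighbour {k} {j} k≢j (u ∷ us) (u∉us ∷ us!) ((u≢k , u≢j) ∷ us≢) =
        trans
          (expectation-notBoth u≢k u≢j
            (λ { (inj₁ (_ , j≡k)) → k≢j (≡.sym j≡k) ; (inj₂ (u≡k , _)) → u≢k u≡k })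
            (Invariant-∏ us λ v∈us → Invariant-1- (Invariant-*
              (Invariant-present u≢k (disjoint v∈us (proj₁ (All.lookup us≢ v∈us))))
              (Invariant-present u≢k (disjoint v∈us (proj₁ (All.lookup us≢ v∈us))))))
            (Invariant-∏ us λ v∈us → Invariant-1- (Invariant-*
              (Invariant-present u≢j (disjoint v∈us (proj₂ (All.lookup us≢ v∈us))))
              (Invariant-present u≢j (disjoint v∈us (proj₂ (All.lookup us≢ v∈us)))))))
          (*-congˡ (expectation-noCommonNeighbour k≢j us us! us≢))
        where
        disjoint : ∀ {v l m} → v ∈ us → v ≢ m → ¬ SamePair (v , l) u m
        disjoint v∈us v≢m (inj₁ (v≡u , _)) = All.lookup u∉us v∈us (≡.sym v≡u)
        disjoint v∈us v≢m (inj₂ (v≡m , _)) = v≢m v≡m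

-- Inner products of the vectors of oriented arcs

module Geometry {c ℓ₁ ℓ₂ : Level} (ℝ : Reals c ℓ₁ ℓ₂) where

  open Theory ℝ hiding (zero)
  open OrderedField ℝ
  open OrderProperties ℝ
  open Adjacency
  open SemiringSum semiring using (sum-cong-≋; *-distribˡ-sum; *-distribʳ-sum; ∑-comm)

  private variable
    m n : ℕ

  sum-nonneg : {f : Vector Carrier m} → (∀ k → 0# ≤ f k) → 0# ≤ sum f
  sum-nonneg {zero}  0≤f = ≤-refl
  sum-nonneg {suc m} 0≤f = +-nonneg (0≤f zero) (sum-nonneg (λ k → 0≤f (suc k)))

  sum≈0⇒≈0 : {f : Vector Carrier m} → (∀ k → 0# ≤ f k) → sum f ≈ 0# → ∀ k → f k ≈ 0#
  sum≈0⇒≈0 {f = f} 0≤f Σf≈0 zero = ≤-antisym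
    (≤-trans (≤-trans (≤-reflexive (sym (+-identityʳ (f zero))))
      (+-monoʳ-≤ (f zero) (sum-nonneg (λ k → 0≤f (suc k))))) (≤-reflexive Σf≈0))
    (0≤f zero)
  sum≈0⇒≈0 {f = f} 0≤f Σf≈0 (suc k) = sum≈0⇒≈0 (λ k → 0≤f (suc k))
    (trans (sym (trans (+-congʳ (sum≈0⇒≈0 0≤f Σf≈0 zero)) (+-identityˡ _))) Σf≈0) k

  -- This is how vertices are extracted from convex combinations: a sum apart from 0 names one of
  -- its terms.
  sum#0⇒#0 : {f : Vector Carrier m} → sum f # 0# → ∃[ k ] f k # 0#
  sum#0⇒#0 {zero}  0#0  = contradiction 0#0 (proj₂ (tight 0# 0#) refl)
  sum#0⇒#0 {suc m} Σ#0 with x+y#0⇒x#0⊎y#0 Σ#0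
  ... | inj₁ f₀#0 = zero , f₀#0
  ... | inj₂ Σ′#0 = let k , fk#0 = sum#0⇒#0 Σ′#0 in suc k , fk#0

  sum-minus : (f g : Vector Carrier m) → sum (λ k → f k - g k) ≈ sum f - sum g
  sum-minus {zero}  f g = sym (-‿inverseʳ 0#)
  sum-minus {suc m} f g =
    trans (+-congˡ (sum-minus (λ k → f (suc k)) (λ k → g (suc k)))) (sym (+-minus _ _ _ _))

  ⟨⟩-congʳ : ∀ (a : Point n) {x y : Point n} → x ≋ y → ⟨ a , x ⟩ ≈ ⟨ a , y ⟩
  ⟨⟩-congʳ a x≋y = sum-cong-≋ (λ i → *-congˡ (x≋y i))

  ⟨⟩-comm : (x y : Point n) → ⟨ x , y ⟩ ≈ ⟨ y , x ⟩
  ⟨⟩-comm x y = sum-cong-≋ (λ i → *-comm (x i) (y i))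

  ⟨⟩-combination : (a : Point n) (w : Vector Carrier m) (v : Vector (Point n) m) →
                   ⟨ a , combination w v ⟩ ≈ sum (λ k → w k * ⟨ a , v k ⟩)
  ⟨⟩-combination a w v = begin
    sum (λ i → a i * sum (λ k → w k * v k i))
      ≈⟨ sum-cong-≋ (λ i → *-distribˡ-sum (a i) (λ k → w k * v k i)) ⟩
    sum (λ i → sum (λ k → a i * (w k * v k i)))
      ≈⟨ ∑-comm (λ i k → a i * (w k * v k i)) ⟩
    sum (λ k → sum (λ i → a i * (w k * v k i)))
      ≈⟨ sum-cong-≋ (λ k → sum-cong-≋ (λ i →
           solve 3 (λ a w v → a :* (w :* v) := w :* (a :* v)) refl (a i) (w k) (v k i))) ⟩
    sum (λ k → sum (λ i → w k * (a i * v k i)))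
      ≈⟨ sum-cong-≋ (λ k → *-distribˡ-sum (w k) (λ i → a i * v k i)) ⟨
    sum (λ k → w k * ⟨ a , v k ⟩) ∎
    where open SetoidReasoning setoid

  𝐞-refl : (i : Fin n) → 𝐞 i i ≈ 1#
  𝐞-refl i with i Fin.≟ i
  ... | yes _  = refl
  ... | no i≢i = contradiction ≡.refl i≢i

  𝐞-≢ : {i j : Fin n} → i ≢ j → 𝐞 i j ≈ 0#
  𝐞-≢ {i = i} {j} i≢j with i Fin.≟ j
  ... | yes i≡j = contradiction i≡j i≢j
  ... | no _    = refl

  0≤𝐞 : (i j : Fin n) → 0# ≤ 𝐞 i j
  0≤𝐞 i j with i Fin.≟ j
  ... | yes _ = <⇒≤ 0<1
  ... | no _  = ≤-refl

  𝐞≤1 : (i j : Fin n) → 𝐞 i j ≤ 1#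
  𝐞≤1 i j with i Fin.≟ j
  ... | yes _ = ≤-refl
  ... | no _  = <⇒≤ 0<1

  ⟨⟩-𝐞 : (a : Point n) (i : Fin n) → ⟨ a , 𝐞 i ⟩ ≈ a i
  ⟨⟩-𝐞 {suc n} a zero = begin
    a zero * 1# + sum (λ l → a (suc l) * 0#)   ≈⟨ +-congˡ (*-distribʳ-sum 0# (λ l → a (suc l))) ⟨
    a zero * 1# + sum (λ l → a (suc l)) * 0#   ≈⟨ +-cong (*-identityʳ _) (zeroʳ _) ⟩
    a zero + 0#                                ≈⟨ +-identityʳ _ ⟩
    a zero                                     ∎
    where open SetoidReasoning setoid
  ⟨⟩-𝐞 {suc n} a (suc i) =
    trans (+-cong (zeroʳ (a zero)) (⟨⟩-𝐞 (λ l → a (suc l)) i)) (+-identityˡ (a (suc i)))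

  vec : Orientation n → Point n
  vec (i , j) l = 𝐞 i l - 𝐞 j l

  -- The value at `vec o` of the functional with normal `a`; faces are handled through these
  -- differences of potentials.
  rise : Point n → Orientation n → Carrier
  rise a (i , j) = a i - a j

  ⟨⟩-vec : (a : Point n) (o : Orientation n) → ⟨ a , vec o ⟩ ≈ rise a o
  ⟨⟩-vec a (i , j) = begin
    sum (λ l → a l * (𝐞 i l - 𝐞 j l))
      ≈⟨ sum-cong-≋ (λ l → solve 3 (λ a x y → a :* (x :- y) := a :* x :- a :* y) refl (a l) (𝐞 i l) (𝐞 j l)) ⟩
    sum (λ l → a l * 𝐞 i l - a l * 𝐞 j l)
      ≈⟨ sum-minus (λ l → a l * 𝐞 i l) (λ l → a l * 𝐞 j l) ⟩
    ⟨ a , 𝐞 i ⟩ - ⟨ a , 𝐞 j ⟩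
      ≈⟨ +-cong (⟨⟩-𝐞 a i) (-‿cong (⟨⟩-𝐞 a j)) ⟩
    a i - a j ∎
    where open SetoidReasoning setoid

  ∣vec∣²≈2 : {o : Orientation n} → Loopless o → ⟨ vec o , vec o ⟩ ≈ 1# + 1#
  ∣vec∣²≈2 {o = o@(i , j)} i≢j = trans (⟨⟩-vec (vec o) o) (trans
    (+-cong (+-cong (𝐞-refl i) (-‿cong (𝐞-≢ (i≢j ∘ ≡.sym))))
      (-‿cong (+-cong (𝐞-≢ i≢j) (-‿cong (𝐞-refl j)))))
    (solve 0 ((:1 :- :0) :- (:0 :- :1) := :1 :+ :1) refl))

  -- In the expansion the subtracted terms are nonnegative, and the two remaining terms are both 1
  -- only if sources and targets agree.
  ⟨vec,vec⟩≤1 : {o o′ : Orientation n} → o ≢ o′ → ⟨ vec o , vec o′ ⟩ ≤ 1#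
  ⟨vec,vec⟩≤1 {o = o@(i , j)} {o′@(k , l)} o≢o′ = begin
    ⟨ vec o , vec o′ ⟩
      ≈⟨ ⟨⟩-vec (vec o) o′ ⟩
    (𝐞 i k - 𝐞 j k) - (𝐞 i l - 𝐞 j l)
      ≈⟨ solve 4 (λ a b c d → (a :- b) :- (c :- d) := a :+ d :- (b :+ c)) refl
           (𝐞 i k) (𝐞 j k) (𝐞 i l) (𝐞 j l) ⟩
    𝐞 i k + 𝐞 j l - (𝐞 j k + 𝐞 i l)
      ≤⟨ difference-≤ (≤-trans (+-nonneg (0≤𝐞 j k) (0≤𝐞 i l)) (≤-reflexive
           (solve 2 (λ x y → y := x :- (x :- y)) refl (𝐞 i k + 𝐞 j l) (𝐞 j k + 𝐞 i l)))) ⟩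
    𝐞 i k + 𝐞 j l
      ≤⟨ bound ⟩
    1# ∎
    where
    open ≤-Reasoning
    bound : 𝐞 i k + 𝐞 j l ≤ 1#
    bound with i Fin.≟ k
    ... | no _ = ≤-trans (≤-reflexive (+-identityˡ (𝐞 j l))) (𝐞≤1 j l)
    ... | yes ≡.refl =
      ≤-reflexive (trans (+-congˡ (𝐞-≢ {i = j} {l} (λ { ≡.refl → o≢o′ ≡.refl }))) (+-identityʳ 1#))

  -- Pairing `vec o` with the difference of the two vectors gives at least 2 - 1, and a sum apart
  -- from 0 has a term apart from 0.
  vec-apart : {o o′ : Orientation n} → Loopless o → o ≢ o′ → ∃[ i ] vec o i # vec o′ i
  vec-apart {o = o} {o′} o-loopless o≢o′ =
    let i , fi#0 = sum#0⇒#0 {f = λ i → vec o i * (vec o i - vec o′ i)}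
                     (#-sym (<⇒# 0<⟨o,o-o′⟩))
    in i , x-y#0⇒x#y (x*y#0⇒y#0 fi#0)
    where
    open ≤-Reasoning
    0<⟨o,o-o′⟩ : 0# < ⟨ vec o , (λ i → vec o i - vec o′ i) ⟩
    0<⟨o,o-o′⟩ = begin-strict
      0#
        <⟨ 0<1 ⟩
      1#
        ≈⟨ solve 0 (:1 := :1 :+ :1 :- :1) refl ⟩
      (1# + 1#) - 1#
        ≤⟨ difference-≤ (≤-trans (≤-difference (⟨vec,vec⟩≤1 o≢o′)) (≤-reflexive
             (solve 2 (λ y x → y :- x := (:1 :+ :1 :- x) :- (:1 :+ :1 :- y)) refl
               1# ⟨ vec o , vec o′ ⟩))) ⟩
      (1# + 1#) - ⟨ vec o , vec o′ ⟩
        ≈⟨ +-congʳ (∣vec∣²≈2 o-loopless) ⟨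
      ⟨ vec o , vec o ⟩ - ⟨ vec o , vec o′ ⟩
        ≈⟨ sum-minus (λ i → vec o i * vec o i) (λ i → vec o i * vec o′ i) ⟨
      sum (λ i → vec o i * vec o i - vec o i * vec o′ i)
        ≈⟨ sum-cong-≋ (λ i → solve 2 (λ x y → x :* x :- x :* y := x :* (x :- y)) refl (vec o i) (vec o′ i)) ⟩
      ⟨ vec o , (λ i → vec o i - vec o′ i) ⟩ ∎

-- Faces, tight orientations, and the two vertices of an edge

module Faces {c ℓ₁ ℓ₂ : Level} (ℝ : Reals c ℓ₁ ℓ₂) {n : ℕ} (G : Graph n) where

  open Theory ℝ hiding (zero)
  open OrderedField ℝ
  open OrderProperties ℝ
  open Adjacency
  open Oriented {n} (arcs G)
  open Geometry ℝ
  open SemiringSum semiring using (sum-cong-≋; *-distribˡ-sum; *-distribʳ-sum; ∑-distrib-+)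

  P : Point n → Set (c ⊔ ℓ₁ ⊔ ℓ₂)
  P = symmetricEdgePolytope G

  -- The sign of a generator is absorbed by reversing the arc.
  generator⇒vec : ∀ {x} → generator G x → Σ[ o ∈ Orientation n ] Present o × x ≋ vec o
  generator⇒vec {x} (a , a∈G , sign) = orient sign
    where
    i j : Fin n
    i = proj₁ (arc n a)
    j = proj₂ (arc n a)
    i-j-present : Present (i , j)
    i-j-present = ≡.trans (adjacent-lookup {n} (arcs G) {i} {j} {a} (inj₁ (≡.refl , ≡.refl))) ([]=⇒lookup a∈G)
    orient : x ≋ vec (i , j) ⊎ x ≋ (λ l → - vec (i , j) l) →
             Σ[ o ∈ Orientation n ] Present o × x ≋ vec o
    orient (inj₁ x≋) = (i , j) , i-j-present , x≋
    orient (inj₂ x≋) = (j , i) , present-reverse {i , j} i-j-present ,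
                       λ l → trans (x≋ l) (sym (minus-swap (𝐞 i l) (𝐞 j l)))

  vec-generator : ∀ {o} → Present o → generator G (vec o)
  vec-generator {o@(i , j)} present = a , lookup⇒[]= a (arcs G) a-present , sign (arc-arcIndex i≢j)
    where
    i≢j : i ≢ j
    i≢j = present-loopless {o} present
    a : ArcIndex n
    a = arcIndex i≢j
    a-present : Vec.lookup (arcs G) a ≡ true
    a-present = ≡.trans (≡.sym (adjacent-arcIndex (arcs G) i≢j)) present
    sign : SamePair (arc n a) i j →
           vec o ≋ vec (arc n a) ⊎ vec o ≋ (λ l → - vec (arc n a) l)
    sign (inj₁ (eq , eq′)) = inj₁ λ l → reflexive (≡.cong (λ p → vec p l) (≡.sym (≡.cong₂ _,_ eq eq′)))
    sign (inj₂ (eq , eq′)) = inj₂ λ l → trans (minus-swap (𝐞 j l) (𝐞 i l))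
      (-‿cong (reflexive (≡.cong (λ p → vec p l) (≡.sym (≡.cong₂ _,_ eq eq′)))))

  -- Convex combinations are indexed by orientations instead of points: equality of orientations is
  -- decidable, so weights can be sorted by their vertices.
  record Representation (x : Point n) : Set (c ⊔ ℓ₁ ⊔ ℓ₂) where
    field
      {size}      : ℕ
      weights     : Vector Carrier size
      ends        : Vector (Orientation n) size
      nonneg      : ∀ k → 0# ≤ weights k
      total       : sum weights ≈ 1#
      present     : ∀ k → Present (ends k)
      combination≋ : x ≋ combination weights (λ k → vec (ends k))

    pairing : ∀ a → ⟨ a , x ⟩ ≈ sum (λ k → weights k * rise a (ends k))
    pairing a = trans (⟨⟩-congʳ a combination≋)
      (trans (⟨⟩-combination a weights (λ k → vec (ends k)))
        (sum-cong-≋ (λ k → *-congˡ (⟨⟩-vec a (ends k)))))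

    weighted : ∀ b → sum (λ k → weights k * b) ≈ b
    weighted b = trans (sym (*-distribʳ-sum b weights)) (trans (*-congʳ total) (*-identityˡ b))

  represent : ∀ {x} → P x → Representation x
  represent (m , w , v , 0≤w , Σw≈1 , v∈ , x≋) = record
    { weights = w
    ; ends    = λ k → proj₁ (generator⇒vec (v∈ k))
    ; nonneg  = 0≤w
    ; total   = Σw≈1
    ; present = λ k → proj₁ (proj₂ (generator⇒vec (v∈ k)))
    ; combination≋ = λ i → trans (x≋ i)
        (sum-cong-≋ (λ k → *-congˡ (proj₂ (proj₂ (generator⇒vec (v∈ k))) i)))
    }

  vec∈P : ∀ {o} → Present o → P (vec o)
  vec∈P {o} present = 1 , (λ _ → 1#) , (λ _ → vec o) , (λ _ → <⇒≤ 0<1) , +-identityʳ 1# ,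
    (λ _ → vec-generator {o} present) , (λ i → solve 1 (λ x → x := :1 :* x :+ :0) refl (vec o i))

  module OnFace (F : Face P) where
    open Face F

    Tight : Orientation n → Set ℓ₁
    Tight o = rise normal o ≈ offset

    rise≤offset : ∀ {o} → Present o → rise normal o ≤ offset
    rise≤offset {o} present =
      ≤-trans (≤-reflexive (sym (⟨⟩-vec normal o))) (halfspace (vec o) (vec∈P {o} present))

    vec∈points : ∀ {o} → Present o → Tight o → points (vec o)
    vec∈points {o} present tight-o = vec∈P {o} present , trans (⟨⟩-vec normal o) tight-o

    points⇒tight : ∀ {o} → points (vec o) → Tight o
    points⇒tight {o} (_ , on) = trans (sym (⟨⟩-vec normal o)) on

    -- If the offset were 0, an orientation and its reverse would both rise by at most 0, hence by
    -- exactly 0. The functional would vanish on all of `P`, against `proper`.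
    offset≉0 : ¬ offset ≈ 0#
    offset≉0 offset≈0 = proper (proj₁ , λ {x} x∈P → x∈P , on (represent x∈P))
      where
      rise≈0 : ∀ o → Present o → rise normal o ≈ 0#
      rise≈0 o@(i , j) present = ≤-antisym (≤-trans (rise≤offset present) (≤-reflexive offset≈0))
        (difference-≤ (≤-trans (≤-difference (≤-trans (rise≤offset (present-reverse {o} present)) (≤-reflexive offset≈0)))
          (≤-reflexive (solve 2 (λ x y → :0 :- (y :- x) := x :- y :- :0) refl (normal i) (normal j)))))
      on : ∀ {x} → Representation x → ⟨ normal , x ⟩ ≈ offset
      on {x} r = begin
        ⟨ normal , x ⟩                                 ≈⟨ pairing normal ⟩
        sum (λ k → weights k * rise normal (ends k))   ≈⟨ sum-cong-≋ (λ k → *-congˡ (rise≈0 (ends k) (present k))) ⟩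
        sum (λ k → weights k * 0#)                     ≈⟨ weighted 0# ⟩
        0#                                             ≈⟨ offset≈0 ⟨
        offset                                         ∎
        where
        open Representation r
        open SetoidReasoning setoid

    -- Otherwise the reverse orientation would rise by a positive amount, exceeding a negative
    -- offset.
    offset-nonneg : ∀ {o} → Present o → Tight o → 0# ≤ offset
    offset-nonneg {o@(i , j)} present tight-o offset<0 =
      rise≤offset (present-reverse {o} present) (<-trans offset<0
        (<-respʳ-≈ (trans (solve 3 (λ b x y → :0 :- (x :- y) := y :- x) refl offset (normal i) (normal j)) refl)
          (<-difference (<-respˡ-≈ (sym tight-o) offset<0))))

    -- Complementary slackness: the nonnegative products of weight and `offset - rise` sum to 0, so
    -- each is 0, and a weight apart from 0 leaves no slack.
    weight#0⇒tight : ∀ {x} (r : Representation x) → ⟨ normal , x ⟩ ≈ offset →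
                     ∀ k → Representation.weights r k # 0# → Tight (Representation.ends r k)
    weight#0⇒tight {x} r on k wk#0 = sym (trans
      (solve 2 (λ x y → x := x :- y :+ y) refl offset (rise normal (ends k)))
      (trans (+-congʳ (x*y≈0∧x#0⇒y≈0 (sum≈0⇒≈0 slack-nonneg Σslack≈0 k) wk#0)) (+-identityˡ _)))
      where
      open Representation r
      slack-nonneg : ∀ k → 0# ≤ weights k * (offset - rise normal (ends k))
      slack-nonneg k = *-nonneg (nonneg k) (≤-difference (rise≤offset (present k)))
      Σslack≈0 : sum (λ k → weights k * (offset - rise normal (ends k))) ≈ 0#
      Σslack≈0 = begin
        sum (λ k → weights k * (offset - rise normal (ends k)))
          ≈⟨ sum-cong-≋ (λ k → solve 3 (λ w b r → w :* (b :- r) := w :* b :- w :* r) refl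
               (weights k) offset (rise normal (ends k))) ⟩
        sum (λ k → weights k * offset - weights k * rise normal (ends k))
          ≈⟨ sum-minus (λ k → weights k * offset) (λ k → weights k * rise normal (ends k)) ⟩
        sum (λ k → weights k * offset) - sum (λ k → weights k * rise normal (ends k))
          ≈⟨ +-cong (weighted offset) (-‿cong (trans (sym (pairing normal)) on)) ⟩
        offset - offset
          ≈⟨ -‿inverseʳ offset ⟩
        0# ∎
        where open SetoidReasoning setoid

  module _ (F : Face P) where
    open OnFace F

    Spanned : Orientation n → Orientation n → Set ℓ₁
    Spanned g h = ∀ {o} → Present o → Tight o → o ≡ g ⊎ o ≡ h

    spanned-weight : ∀ {g h} → Spanned g h → ∀ {x} (r : Representation x) →
                     ⟨ Face.normal F , x ⟩ ≈ Face.offset F → ∀ k →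
                     Representation.ends r k ≢ g → Representation.ends r k ≢ h →
                     Representation.weights r k ≈ 0#
    spanned-weight spanned r on k ≢g ≢h = ¬#⇒≈ λ wk#0 →
      [ ≢g , ≢h ]′ (spanned (Representation.present r k) (weight#0⇒tight r on k wk#0))

  -- A point of `F` puts no weight outside `g` and `h`, so on it the functional of `F′` takes the
  -- value it has at these two vertices. Used in both directions, this identifies faces cut out by
  -- different hyperplanes.
  points-⊆ : ∀ (F F′ : Face P) {g h} → Spanned F g h →
             OnFace.Tight F′ g → OnFace.Tight F′ h → Face.points F ⊆ Face.points F′
  points-⊆ F F′ {g} {h} spanned g-tight h-tight {x} (x∈P , on) = x∈P , (begin
    ⟨ normal , x ⟩                                 ≈⟨ pairing normal ⟩
    sum (λ k → weights k * rise normal (ends k))   ≈⟨ sum-cong-≋ term ⟩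
    sum (λ k → weights k * offset)                 ≈⟨ weighted offset ⟩
    offset                                         ∎)
    where
    open Face F′
    open Representation (represent x∈P)
    open SetoidReasoning setoid
    term : ∀ k → weights k * rise normal (ends k) ≈ weights k * offset
    term k with ends k ≟ᵒ g | ends k ≟ᵒ h
    ... | yes eq | _ = *-congˡ (trans (reflexive (≡.cong (rise normal) eq)) g-tight)
    ... | no _ | yes eq = *-congˡ (trans (reflexive (≡.cong (rise normal) eq)) h-tight)
    ... | no ≢g | no ≢h = trans (*-congʳ w≈0) (trans (zeroˡ _) (sym (trans (*-congʳ w≈0) (zeroˡ _))))
      where
      w≈0 : weights k ≈ 0#
      w≈0 = spanned-weight F {g} {h} spanned (represent x∈P) on k ≢g ≢h

  module OnEdge (F : Face P) (dim : HasDimension (Face.points F) 1) where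
    open Face F
    open OnFace F

    v₀ v₁ : Point n
    v₀ = proj₁ dim zero
    v₁ = proj₁ dim (suc zero)

    r₀ : Representation v₀
    r₀ = represent (proj₁ (proj₁ (proj₂ dim) zero))

    r₁ : Representation v₁
    r₁ = represent (proj₁ (proj₁ (proj₂ dim) (suc zero)))

    on₀ : ⟨ normal , v₀ ⟩ ≈ offset
    on₀ = proj₂ (proj₁ (proj₂ dim) zero)

    on₁ : ⟨ normal , v₁ ⟩ ≈ offset
    on₁ = proj₂ (proj₁ (proj₂ dim) (suc zero))

    abstract
      -- The weights 1 and -1 sum to 0, so affine independence makes the difference of the two
      -- points apart from 0 in some coordinate.
      spread : ∃[ i ] v₀ i # v₁ i
      spread = let i , #0 = proj₁ (proj₂ (proj₂ dim)) w Σw≈0 (zero , 1#0)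
               in i , x-y#0⇒x#y (#-congʳ
                    (solve 2 (λ x y → :1 :* x :+ ((:- :1) :* y :+ :0) := x :- y) refl (v₀ i) (v₁ i)) #0)
        where
        w : Vector Carrier 2
        w = 1# ∷ᵛ - 1# ∷ᵛ []ᵛ
        Σw≈0 : sum w ≈ 0#
        Σw≈0 = solve 0 (:1 :+ ((:- :1) :+ :0) := :0) refl

    TightArc : Set ℓ₁
    TightArc = Σ[ o ∈ Orientation n ] Present o × Tight o

    some-tight : ∀ {x} → Representation x → ⟨ normal , x ⟩ ≈ offset → TightArc
    some-tight r on =
      let k , wk#0 = sum#0⇒#0 {f = weights} (#-congʳ (sym total) 1#0)
      in ends k , present k , weight#0⇒tight r on k wk#0
      where open Representation r

    -- The sum is `x i - vec o i`, by `difference`. A term of it apart from 0 has a weight apart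
    -- from 0, hence a tight end, and this end differs from `o`.
    tight-summand : ∀ {x} (r : Representation x) → ⟨ normal , x ⟩ ≈ offset → ∀ o {i} →
      let open Representation r in
      sum (λ k → weights k * (vec (ends k) i - vec o i)) # 0# →
      Σ[ o′ ∈ Orientation n ] Present o′ × Tight o′ × o′ ≢ o
    tight-summand r on o {i} Σ#0 = select (sum#0⇒#0 Σ#0)
      where
      open Representation r
      select : ∃[ k ] weights k * (vec (ends k) i - vec o i) # 0# →
               Σ[ o′ ∈ Orientation n ] Present o′ × Tight o′ × o′ ≢ o
      select (k , #0) = ends k , present k , weight#0⇒tight r on k (x*y#0⇒x#0 #0) ,
        λ eq → proj₂ (tight _ _) (-‿inverseʳ (vec o i))
          (≡.subst (λ o′ → vec o′ i - vec o i # 0#) eq (x*y#0⇒y#0 #0))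

    abstract
      difference : ∀ {x} (r : Representation x) o i → let open Representation r in
                   x i - vec o i ≈ sum (λ k → weights k * (vec (ends k) i - vec o i))
      difference {x} r o i = begin
        x i - vec o i
          ≈⟨ +-cong (combination≋ i) (-‿cong (sym (weighted (vec o i)))) ⟩
        sum (λ k → weights k * vec (ends k) i) - sum (λ k → weights k * vec o i)
          ≈⟨ sum-minus (λ k → weights k * vec (ends k) i) (λ k → weights k * vec o i) ⟨
        sum (λ k → weights k * vec (ends k) i - weights k * vec o i)
          ≈⟨ sum-cong-≋ (λ k → solve 3 (λ w x y → w :* x :- w :* y := w :* (x :- y)) refl
               (weights k) (vec (ends k) i) (vec o i)) ⟩
        sum (λ k → weights k * (vec (ends k) i - vec o i)) ∎
        where
        open Representation r
        open SetoidReasoning setoid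

      difference#0 : ∀ {x} (r : Representation x) o {i} → let open Representation r in
                     x i # vec o i → sum (λ k → weights k * (vec (ends k) i - vec o i)) # 0#
      difference#0 r o {i} x#o = #-congʳ (difference r o i) (x#y⇒x-y#0 x#o)

    another-tight : ∀ {x} → Representation x → ⟨ normal , x ⟩ ≈ offset → ∀ o {i} → x i # vec o i →
                    Σ[ o′ ∈ Orientation n ] Present o′ × Tight o′ × o′ ≢ o
    another-tight r on o {i} x#o = tight-summand r on o {i} (difference#0 r o x#o)

    -- One tight orientation `s` comes from any point of the face. Since `v₀` and `v₁` are apart,
    -- cotransitivity makes one of them apart from the vertex of `s`, so its representation contains
    -- another tight vertex.
    two-tight : Σ[ s ∈ TightArc ] Σ[ t ∈ TightArc ] proj₁ t ≢ proj₁ s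
    two-tight = s , from-end (#-cotrans (proj₂ spread) (vec (proj₁ s) (proj₁ spread)))
      where
      s : TightArc
      s = some-tight r₀ on₀
      Other : Set ℓ₁
      Other = Σ[ t ∈ TightArc ] proj₁ t ≢ proj₁ s
      other : Σ[ o ∈ Orientation n ] Present o × Tight o × o ≢ proj₁ s → Other
      other (o , present , tight-o , o≢) = (o , present , tight-o) , o≢
      from-end : ∀ {i} → v₀ i # vec (proj₁ s) i ⊎ vec (proj₁ s) i # v₁ i → Other
      from-end (inj₁ v₀#s) = other (another-tight r₀ on₀ (proj₁ s) v₀#s)
      from-end (inj₂ s#v₁) = other (another-tight r₁ on₁ (proj₁ s) (#-sym s#v₁))

    -- The affine coordinate of a tight vertex on the line through `v₀` and `v₁`: its weight at
    -- `v₁`.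
    position : TightArc → Carrier
    position (o , present , tight-o) =
      proj₁ (proj₂ (proj₂ (proj₂ dim)) (vec o) (vec∈points present tight-o)) (suc zero)

    vec-position : (t : TightArc) →
                   ∀ l → vec (proj₁ t) l ≈ v₀ l + position t * (v₁ l - v₀ l)
    vec-position (o , present , tight-o) l =
      let w , Σw≈1 , o≋ = proj₂ (proj₂ (proj₂ dim)) (vec o) (vec∈points present tight-o) in begin
      vec o l
        ≈⟨ o≋ l ⟩
      w zero * v₀ l + (w (suc zero) * v₁ l + 0#)
        ≈⟨ solve 4 (λ w w′ x y → w :* x :+ (w′ :* y :+ :0)
             := (w :+ (w′ :+ :0)) :* x :+ w′ :* (y :- x)) refl (w zero) (w (suc zero)) (v₀ l) (v₁ l) ⟩
      sum w * v₀ l + w (suc zero) * (v₁ l - v₀ l)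
        ≈⟨ +-congʳ (trans (*-congʳ Σw≈1) (*-identityˡ (v₀ l))) ⟩
      v₀ l + w (suc zero) * (v₁ l - v₀ l) ∎
      where open SetoidReasoning setoid

    gram : TightArc → TightArc → Carrier
    gram (o , _) (o′ , _) = ⟨ vec o , vec o′ ⟩

    slope : TightArc → Carrier
    slope (o , _) = ⟨ vec o , (λ l → v₁ l - v₀ l) ⟩

    gram-affine : ∀ s t → gram s t ≈ ⟨ vec (proj₁ s) , v₀ ⟩ + position t * slope s
    gram-affine s@(o , _) t = begin
      sum (λ l → x l * vec (proj₁ t) l)
        ≈⟨ sum-cong-≋ (λ l → *-congˡ (vec-position t l)) ⟩
      sum (λ l → x l * (v₀ l + position t * d l))
        ≈⟨ sum-cong-≋ (λ l → solve 4 (λ x v t d → x :* (v :+ t :* d) := x :* v :+ t :* (x :* d)) refl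
             (x l) (v₀ l) (position t) (d l)) ⟩
      sum (λ l → x l * v₀ l + position t * (x l * d l))
        ≈⟨ ∑-distrib-+ (λ l → x l * v₀ l) (λ l → position t * (x l * d l)) ⟩
      ⟨ x , v₀ ⟩ + sum (λ l → position t * (x l * d l))
        ≈⟨ +-congˡ (*-distribˡ-sum (position t) (λ l → x l * d l)) ⟨
      ⟨ x , v₀ ⟩ + position t * ⟨ x , d ⟩ ∎
      where
      x d : Point n
      x = vec o
      d l = v₁ l - v₀ l
      open SetoidReasoning setoid

    gram-step : ∀ x s t → gram x s - gram x t ≈ (position s - position t) * slope x
    gram-step x s t = trans (+-cong (gram-affine x s) (-‿cong (gram-affine x t)))
      (solve 4 (λ a b s t → (a :+ s :* b) :- (a :+ t :* b) := (s :- t) :* b) refl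
        ⟨ vec (proj₁ x) , v₀ ⟩ (slope x) (position s) (position t))

    gram-diagonal : (t : TightArc) → gram t t ≈ 1# + 1#
    gram-diagonal (o , present , _) = ∣vec∣²≈2 (present-loopless {o} present)

    -- The Gram entries are 2 on the diagonal and at most 1 elsewhere. It follows that different
    -- tight vertices have different positions.
    gram-≉ : ∀ s t → proj₁ s ≢ proj₁ t → ¬ gram s s - gram s t ≈ 0#
    gram-≉ s t s≢t eq = ⟨vec,vec⟩≤1 s≢t (<-respʳ-≈ 2≈ 1<2)
      where
      1<2 : 1# < 1# + 1#
      1<2 = <-respˡ-≈ (+-identityʳ 1#) (+-monoʳ-< 1# 0<1)
      2≈ : 1# + 1# ≈ gram s t
      2≈ = trans (sym (gram-diagonal s))
        (trans (solve 2 (λ x y → x := x :- y :+ y) refl (gram s s) (gram s t))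
          (trans (+-congʳ eq) (+-identityˡ (gram s t))))

    position-≉ : ∀ s t → proj₁ s ≢ proj₁ t → ¬ position s - position t ≈ 0#
    position-≉ s t s≢t eq =
      gram-≉ s t s≢t (trans (gram-step s s t) (trans (*-congʳ eq) (zeroˡ (slope s))))

    -- Multiplied by the difference of the positions, the sum of the slopes becomes the difference
    -- of the squared lengths, which is 0.
    slopes-cancel : ∀ s t → proj₁ s ≢ proj₁ t → slope s + slope t ≈ 0#
    slopes-cancel s t s≢t = x*y≈0∧y≉0⇒x≈0 (begin
      (slope s + slope t) * (position s - position t)
        ≈⟨ solve 3 (λ x y z → (x :+ y) :* z := z :* x :+ z :* y) refl
             (slope s) (slope t) (position s - position t) ⟩
      (position s - position t) * slope s + (position s - position t) * slope t
        ≈⟨ +-cong (gram-step s s t) (gram-step t s t) ⟨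
      (gram s s - gram s t) + (gram t s - gram t t)
        ≈⟨ +-cong (+-cong (gram-diagonal s) (-‿cong (⟨⟩-comm (vec (proj₁ s)) (vec (proj₁ t)))))
             (+-congˡ (-‿cong (gram-diagonal t))) ⟩
      (1# + 1# - gram t s) + (gram t s - (1# + 1#))
        ≈⟨ solve 1 (λ x → (:1 :+ :1 :- x) :+ (x :- (:1 :+ :1)) := :0) refl (gram t s) ⟩
      0# ∎) (position-≉ s t s≢t)
      where open SetoidReasoning setoid

    -- Vectors of the same length have opposite slopes along the line through
    -- them; three pairwise opposite slopes vanish.
    no-three-tight : (s t u : TightArc) →
                     proj₁ s ≢ proj₁ t → proj₁ s ≢ proj₁ u → proj₁ t ≢ proj₁ u → ⊥
    no-three-tight s t u s≢t s≢u t≢u =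
      gram-≉ s t s≢t (trans (gram-step s s t) (trans (*-congˡ slope≈0) (zeroʳ _)))
      where
      open SetoidReasoning setoid
      slope≈0 : slope s ≈ 0#
      slope≈0 = x+x≈y+y⇒x≈y (begin
        slope s + slope s
          ≈⟨ solve 3 (λ x y z → x :+ x := (x :+ y) :+ (x :+ z) :- (y :+ z)) refl
               (slope s) (slope t) (slope u) ⟩
        (slope s + slope t) + (slope s + slope u) - (slope t + slope u)
          ≈⟨ +-cong (+-cong (slopes-cancel s t s≢t) (slopes-cancel s u s≢u))
               (-‿cong (slopes-cancel t u t≢u)) ⟩
        0# + 0# - 0#
          ≈⟨ x-0≈x (0# + 0#) ⟩
        0# + 0# ∎)

    -- Decidable equality of orientations turns the mere impossibility of a third tight one into a
    -- choice between `g` and `h`.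
    spanned : ∀ {g h} → Present g → Tight g → Present h → Tight h → g ≢ h → Spanned F g h
    spanned {g} {h} g-present g-tight h-present h-tight g≢h {o} o-present o-tight
      with o ≟ᵒ g | o ≟ᵒ h
    ... | yes o≡g | _       = inj₁ o≡g
    ... | no _    | yes o≡h = inj₂ o≡h
    ... | no o≢g  | no o≢h  = ⊥-elim (no-three-tight (o , o-present , o-tight)
      (g , g-present , g-tight) (h , h-present , h-tight) o≢g o≢h g≢h)

-- Potentials and the Boolean edge criterion

module EdgeCriterion where

  open Adjacency

  module _ {a} {A : Set a} (_≟_ : (x y : A) → Dec (x ≡ y)) where

    remove : A → List A → List A
    remove x = filter (λ y → ¬? (y ≟ x))

    remove-∉ : ∀ {x xs} → All (x ≢_) xs → remove x xs ≡ xs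
    remove-∉ [] = ≡.refl
    remove-∉ {x} {y ∷ ys} (x≢y ∷ x∉ys) with y ≟ x
    ... | yes y≡x = contradiction (≡.sym y≡x) x≢y
    ... | no _    = ≡.cong (y ∷_) (remove-∉ x∉ys)

  private variable
    m n : ℕ

  -- Nodes outside the list are labelled with its length.
  label : Vec (Fin n) m → Fin n → Fin (suc m)
  label []       u = zero
  label (x ∷ xs) u with u Fin.≟ x
  ... | yes _ = zero
  ... | no _  = suc (label xs u)

  label-lookup : ∀ {xs : Vec (Fin n) m} → Uniqueᵛ xs →
                 ∀ a → label xs (Vec.lookup xs a) ≡ Fin.inject₁ a
  label-lookup {xs = x ∷ xs} (x∉xs ∷ᵖ xs!) zero with x Fin.≟ x
  ... | yes _  = ≡.refl
  ... | no x≢x = contradiction ≡.refl x≢x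
  label-lookup {xs = x ∷ xs} (x∉xs ∷ᵖ xs!) (suc a) with Vec.lookup xs a Fin.≟ x
  ... | yes eq = contradiction (≡.sym eq) (Allᵛ.lookup⁺ x∉xs a)
  ... | no _   = ≡.cong suc (label-lookup xs! a)

  -- `Fin.inject₁ a` is never the last label, which marks the nodes outside the list, so this label
  -- determines the node.
  label-inject₁ : ∀ (xs : Vec (Fin n) m) {u} a → label xs u ≡ Fin.inject₁ a → u ≡ Vec.lookup xs a
  label-inject₁ (x ∷ xs) {u} a       eq with u Fin.≟ x
  label-inject₁ (x ∷ xs) {u} zero    eq | yes u≡x = u≡x
  label-inject₁ (x ∷ xs) {u} (suc a) eq | no _    = label-inject₁ xs a (Fin.suc-injective eq)

  all⇒∈ : ∀ {a} {A : Set a} {p : A → Bool} xs → all p xs ≡ true → ∀ {x} → x ∈ xs → p x ≡ true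
  all⇒∈ {p = p} (x ∷ xs) eq (here ≡.refl) = Bool.∧-conicalˡ (p x) _ eq
  all⇒∈ {p = p} (x ∷ xs) eq (there x∈xs)  = all⇒∈ xs (Bool.∧-conicalʳ (p x) _ eq) x∈xs

  ∈⇒all : ∀ {a} {A : Set a} {p : A → Bool} xs → (∀ {x} → x ∈ xs → p x ≡ true) → all p xs ≡ true
  ∈⇒all []       p-true = ≡.refl
  ∈⇒all (x ∷ xs) p-true = ≡.cong₂ _∧_ (p-true (here ≡.refl)) (∈⇒all xs (λ x∈xs → p-true (there x∈xs)))

  not-true : ∀ {b} → not b ≡ true → b ≢ true
  not-true eq ≡.refl = contradiction eq λ ()

  true-not : ∀ {b} → b ≢ true → not b ≡ true
  true-not {true}  b≢true = contradiction ≡.refl b≢true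
  true-not {false} b≢true = ≡.refl

  others : ∀ {n} → Fin n → Fin n → Fin n → List (Fin n)
  others {n} i j k = remove Fin._≟_ k (remove Fin._≟_ j (remove Fin._≟_ i (allFin n)))

  ∈-others⁺ : ∀ {n} {i j k u : Fin n} → u ≢ i → u ≢ j → u ≢ k → u ∈ others i j k
  ∈-others⁺ {u = u} u≢i u≢j u≢k =
    ∈-filter⁺ _ (∈-filter⁺ _ (∈-filter⁺ _ (∈-allFin u) u≢i) u≢j) u≢k

  ∈-others⁻ : ∀ {n} {i j k u : Fin n} → u ∈ others i j k → u ≢ i × u ≢ j × u ≢ k
  ∈-others⁻ {n} {i} {j} {k} u∈ =
    let u∈₂ , u≢k = ∈-filter⁻ (λ y → ¬? (y Fin.≟ k)) {xs = remove Fin._≟_ j (remove Fin._≟_ i (allFin n))} u∈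
        u∈₁ , u≢j = ∈-filter⁻ (λ y → ¬? (y Fin.≟ j)) {xs = remove Fin._≟_ i (allFin n)} u∈₂
        u∈₀ , u≢i = ∈-filter⁻ (λ y → ¬? (y Fin.≟ i)) {xs = allFin n} u∈₁
    in u≢i , u≢j , u≢k

  module _ (S : Subset (length (completeArcs n))) where

    open Oriented {n} S

    -- Along the potential, g and h rise by height and every other present
    -- orientation rises less, so that {x : ⟨ potential , x ⟩ = height} cuts out
    -- the segment from e_i - e_j to e_k - e_l, for g = (i , j) and h = (k , l).
    record Supporting (g h : Orientation n) : Set where
      field
        potential : Fin n → ℕ
        height    : ℕ
        height>0  : 0 ℕ.< height
        g-present : Present g
        h-present : Present h
        g≢h       : g ≢ h
        g-rise    : potential (proj₁ g) ≡ height ℕ.+ potential (proj₂ g)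
        h-rise    : potential (proj₁ h) ≡ height ℕ.+ potential (proj₂ h)
        strict    : ∀ {u v} → Present (u , v) → (u , v) ≢ g → (u , v) ≢ h →
                    potential u ℕ.< height ℕ.+ potential v

    Supporting-swap : ∀ {g h} → Supporting g h → Supporting h g
    Supporting-swap s = record
      { potential = potential ; height = height ; height>0 = height>0
      ; g-present = h-present ; h-present = g-present ; g≢h = g≢h ∘ ≡.sym
      ; g-rise = h-rise ; h-rise = g-rise
      ; strict = λ present ≢h ≢g → strict present ≢g ≢h
      }
      where open Supporting s

    private
      -- A finite condition on the table of values alone: for a concrete table it is verified by
      -- evaluating `rises?`.
      Rises : ∀ {r} → Vec ℕ r → ℕ → List (Fin r × Fin r) → Set
      Rises value height full = ∀ a b →
        Vec.lookup value a ℕ.< height ℕ.+ Vec.lookup value b ⊎ (a , b) ∈ full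

      rises? : ∀ {r} (value : Vec ℕ r) height full → Dec (Rises value height full)
      rises? value height full = Fin.all? λ a → Fin.all? λ b →
        (Vec.lookup value a ℕ.<? height ℕ.+ Vec.lookup value b) ⊎-dec
        (∈? (≡-dec Fin._≟_ Fin._≟_) (a , b) full)

    -- The potential is constant on the classes of a partition of the nodes, so
    -- only the pairs of classes in full have to be excluded by hand.
    supporting-by-classes : ∀ {r} (class : Fin n → Fin r) (value : Vec ℕ r) height full →
      Rises value height full → 0 ℕ.< height → ∀ {i j k l} →
      Present (i , j) → Present (k , l) → (i , j) ≢ (k , l) →
      Vec.lookup value (class i) ≡ height ℕ.+ Vec.lookup value (class j) →
      Vec.lookup value (class k) ≡ height ℕ.+ Vec.lookup value (class l) →
      (∀ {u v} → Present (u , v) → (u , v) ≢ (i , j) → (u , v) ≢ (k , l) →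
         (class u , class v) ∉ full) →
      Supporting (i , j) (k , l)
    supporting-by-classes class value height full rises height>0 ij kl g≢h g-rise h-rise excluded = record
      { potential = λ u → Vec.lookup value (class u)
      ; height = height
      ; height>0 = height>0
      ; g-present = ij
      ; h-present = kl
      ; g≢h = g≢h
      ; g-rise = g-rise
      ; h-rise = h-rise
      ; strict = λ {u} {v} uv ≢g ≢h →
          [ (λ lt → lt) , (λ full → contradiction full (excluded uv ≢g ≢h)) ]′
            (rises (class u) (class v))
      }

    module _ {m} {nodes : Vec (Fin n) m} (nodes! : Uniqueᵛ nodes) (value : Vec ℕ (suc m)) where

      value-label : ∀ a → Vec.lookup value (label nodes (Vec.lookup nodes a)) ≡
                          Vec.lookup value (Fin.inject₁ a)
      value-label a = ≡.cong (Vec.lookup value) (label-lookup nodes! a)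

      rise-label : ∀ a b {height} →
        Vec.lookup value (Fin.inject₁ a) ≡ height ℕ.+ Vec.lookup value (Fin.inject₁ b) →
        Vec.lookup value (label nodes (Vec.lookup nodes a)) ≡
          height ℕ.+ Vec.lookup value (label nodes (Vec.lookup nodes b))
      rise-label a b {height} eq =
        ≡.trans (value-label a) (≡.trans eq (≡.cong (height ℕ.+_) (≡.sym (value-label b))))

    label-pair : ∀ {m} (nodes : Vec (Fin n) m) {u v} a b →
      (label nodes u , label nodes v) ≡ (Fin.inject₁ a , Fin.inject₁ b) →
      (u , v) ≡ (Vec.lookup nodes a , Vec.lookup nodes b)
    label-pair nodes a b eq = ≡.cong₂ _,_
      (label-inject₁ nodes a (≡.cong proj₁ eq)) (label-inject₁ nodes b (≡.cong proj₂ eq))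

    source-supporting : ∀ {i j l} → Present (i , j) → Present (i , l) → j ≢ l →
                        Supporting (i , j) (i , l)
    source-supporting {i} {j} {l} ij il j≢l = supporting-by-classes (label nodes) value 2 full
      (toWitness {a? = rises? value 2 full} tt) (s≤s z≤n) ij il (j≢l ∘ ≡.cong proj₂)
      (rise-label nodes! value (# 0) (# 1) ≡.refl) (rise-label nodes! value (# 0) (# 2) ≡.refl)
      λ { _ ≢g ≢h (here eq)         → ≢g (label-pair nodes (# 0) (# 1) eq)
        ; _ ≢g ≢h (there (here eq)) → ≢h (label-pair nodes (# 0) (# 2) eq) }
      where
      nodes : Vec (Fin n) 3
      nodes = i ∷ j ∷ l ∷ []
      nodes! : Uniqueᵛ nodes
      nodes! = (present-loopless {i , j} ij ∷ᵃ present-loopless {i , l} il ∷ᵃ []ᵃ) ∷ᵖ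
               (j≢l ∷ᵃ []ᵃ) ∷ᵖ []ᵃ ∷ᵖ []ᵖ
      -- The source lies at 2, both targets at 0 and all other nodes halfway, at 1; a rise of 2
      -- occurs only from the source to a target.
      value : Vec ℕ 4
      value = 2 ∷ 0 ∷ 0 ∷ 1 ∷ []
      full : List (Fin 4 × Fin 4)
      full = (# 0 , # 1) ∷ (# 0 , # 2) ∷ []

    target-supporting : ∀ {i j k} → Present (i , j) → Present (k , j) → i ≢ k →
                        Supporting (i , j) (k , j)
    target-supporting {i} {j} {k} ij kj i≢k = supporting-by-classes (label nodes) value 2 full
      (toWitness {a? = rises? value 2 full} tt) (s≤s z≤n) ij kj (i≢k ∘ ≡.cong proj₁)
      (rise-label nodes! value (# 0) (# 2) ≡.refl) (rise-label nodes! value (# 1) (# 2) ≡.refl)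
      λ { _ ≢g ≢h (here eq)         → ≢g (label-pair nodes (# 0) (# 2) eq)
        ; _ ≢g ≢h (there (here eq)) → ≢h (label-pair nodes (# 1) (# 2) eq) }
      where
      nodes : Vec (Fin n) 3
      nodes = i ∷ k ∷ j ∷ []
      nodes! : Uniqueᵛ nodes
      nodes! = (i≢k ∷ᵃ present-loopless {i , j} ij ∷ᵃ []ᵃ) ∷ᵖ
               (present-loopless {k , j} kj ∷ᵃ []ᵃ) ∷ᵖ []ᵃ ∷ᵖ []ᵖ
      -- Now two sources lie at 2 and the common target at 0.
      value : Vec ℕ 4
      value = 2 ∷ 2 ∷ 0 ∷ 1 ∷ []
      full : List (Fin 4 × Fin 4)
      full = (# 0 , # 2) ∷ (# 1 , # 2) ∷ []

    disjoint-supporting : ∀ {i j k l} → Present (i , j) → Present (k , l) →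
      i ≢ k → j ≢ l → i ≢ l → j ≢ k → ¬ Present (i , l) → Supporting (i , j) (k , l)
    disjoint-supporting {i} {j} {k} {l} ij kl i≢k j≢l i≢l j≢k ¬il =
      supporting-by-classes (label nodes) value 4 full
        (toWitness {a? = rises? value 4 full} tt) (s≤s z≤n) ij kl (i≢k ∘ ≡.cong proj₁)
        (rise-label nodes! value (# 0) (# 1) ≡.refl) (rise-label nodes! value (# 2) (# 3) ≡.refl)
        λ { _  ≢g ≢h (here eq)                 → ≢g (label-pair nodes (# 0) (# 1) eq)
          ; _  ≢g ≢h (there (here eq))         → ≢h (label-pair nodes (# 2) (# 3) eq)
          ; uv ≢g ≢h (there (there (here eq))) →
              ¬il (≡.subst Present (label-pair nodes (# 0) (# 3) eq) uv) }
      where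
      nodes : Vec (Fin n) 4
      nodes = i ∷ j ∷ k ∷ l ∷ []
      nodes! : Uniqueᵛ nodes
      nodes! = (present-loopless {i , j} ij ∷ᵃ i≢k ∷ᵃ i≢l ∷ᵃ []ᵃ) ∷ᵖ (j≢k ∷ᵃ j≢l ∷ᵃ []ᵃ) ∷ᵖ
               (present-loopless {k , l} kl ∷ᵃ []ᵃ) ∷ᵖ []ᵃ ∷ᵖ []ᵖ
      -- Both arcs drop by 4, from 6 to 2 and from 4 to 0, and the other nodes at 3 are within 3 of
      -- every end. The chord from `i` to `l` drops by 6 and must be absent; the one from `k` to `j`
      -- drops only by 2 and may be present.
      value : Vec ℕ 5
      value = 6 ∷ 2 ∷ 4 ∷ 0 ∷ 3 ∷ []
      full : List (Fin 5 × Fin 5)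
      full = (# 0 , # 1) ∷ (# 2 , # 3) ∷ (# 0 , # 3) ∷ []

    path-supporting : ∀ {k i j} → Present (k , i) → Present (i , j) → k ≢ j →
      ¬ Present (k , j) →
      (∀ u → u ≢ k → u ≢ i → u ≢ j → Present (u , k) → ¬ Present (u , j)) →
      Supporting (k , i) (i , j)
    path-supporting {k} {i} {j} ki ij k≢j ¬kj no-common =
      supporting-by-classes class value 3 full
        (toWitness {a? = rises? value 3 full} tt) (s≤s z≤n) ki ij (k≢i ∘ ≡.cong proj₁)
        (rise (# 0) (# 1) ≡.refl) (rise (# 1) (# 2) ≡.refl)
        excluded
      where
      k≢i : k ≢ i
      k≢i = present-loopless {k , i} ki
      nodes : Vec (Fin n) 3
      nodes = k ∷ i ∷ j ∷ []
      nodes! : Uniqueᵛ nodes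
      nodes! = (k≢i ∷ᵃ k≢j ∷ᵃ []ᵃ) ∷ᵖ (present-loopless {i , j} ij ∷ᵃ []ᵃ) ∷ᵖ []ᵃ ∷ᵖ []ᵖ
      -- The remaining nodes form two classes, the neighbours of k coming last.
      refine : Fin 4 → Bool → Fin 5
      refine (suc (suc (suc zero))) true = # 4
      refine a                      _    = Fin.inject₁ a
      class : Fin n → Fin 5
      class u = refine (label nodes u) (adjacent S u k)
      refine-inject₁ : ∀ (a : Fin 3) b → refine (Fin.inject₁ a) b ≡ Fin.inject₁ (Fin.inject₁ a)
      refine-inject₁ zero             b = ≡.refl
      refine-inject₁ (suc zero)       b = ≡.refl
      refine-inject₁ (suc (suc zero)) b = ≡.refl
      refine-node : ∀ a b (c : Fin 3) → refine a b ≡ Fin.inject₁ (Fin.inject₁ c) → a ≡ Fin.inject₁ c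
      refine-node zero                   b     c eq = Fin.inject₁-injective eq
      refine-node (suc zero)             b     c eq = Fin.inject₁-injective eq
      refine-node (suc (suc zero))       b     c eq = Fin.inject₁-injective eq
      refine-node (suc (suc (suc zero))) false c eq = Fin.inject₁-injective eq
      refine-node (suc (suc (suc zero))) true (suc (suc zero)) ()
      refine-neighbour : ∀ a b → refine a b ≡ # 4 → a ≡ # 3 × b ≡ true
      refine-neighbour (suc (suc (suc zero))) true  eq = ≡.refl , ≡.refl
      refine-neighbour (suc (suc (suc zero))) false ()
      refine-neighbour (suc (suc zero))       _     ()
      refine-other : ∀ a b → refine a b ≡ # 3 → b ≡ false
      refine-other (suc (suc (suc zero))) false eq = ≡.refl
      refine-other (suc (suc zero))       _     ()
      -- The path descends 6, 3, 0. A node outside it must stay less than 3 below `k` if it is a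
      -- neighbour of `k`, and less than 3 above `j` if it is a neighbour of `j`. Neighbours of `k`
      -- go to 4, too high only for an arc to `j`; the others go to 2, too low only for an arc from
      -- `k`.
      value : Vec ℕ 5
      value = 6 ∷ 3 ∷ 0 ∷ 2 ∷ 4 ∷ []
      full : List (Fin 5 × Fin 5)
      full = (# 0 , # 1) ∷ (# 1 , # 2) ∷ (# 0 , # 2) ∷ (# 0 , # 3) ∷ (# 4 , # 2) ∷ []
      class-node : ∀ a → class (Vec.lookup nodes a) ≡ Fin.inject₁ (Fin.inject₁ a)
      class-node a = ≡.trans
        (≡.cong (λ b → refine b (adjacent S (Vec.lookup nodes a) k)) (label-lookup nodes! a))
        (refine-inject₁ a _)
      node-class : ∀ {u} a → class u ≡ Fin.inject₁ (Fin.inject₁ a) → u ≡ Vec.lookup nodes a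
      node-class {u} a eq = label-inject₁ nodes a (refine-node (label nodes u) (adjacent S u k) a eq)
      rise : ∀ a b → Vec.lookup value (Fin.inject₁ (Fin.inject₁ a)) ≡
                     3 ℕ.+ Vec.lookup value (Fin.inject₁ (Fin.inject₁ b)) →
             Vec.lookup value (class (Vec.lookup nodes a)) ≡
             3 ℕ.+ Vec.lookup value (class (Vec.lookup nodes b))
      rise a b eq = ≡.trans (≡.cong (Vec.lookup value) (class-node a))
        (≡.trans eq (≡.cong (λ c → 3 ℕ.+ Vec.lookup value c) (≡.sym (class-node b))))
      pair : ∀ {u v} a b → (class u , class v) ≡ (Fin.inject₁ (Fin.inject₁ a) , Fin.inject₁ (Fin.inject₁ b)) →
             (u , v) ≡ (Vec.lookup nodes a , Vec.lookup nodes b)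
      pair {u} {v} a b eq =
        ≡.cong₂ _,_ (node-class {u} a (≡.cong proj₁ eq)) (node-class {v} b (≡.cong proj₂ eq))
      excluded : ∀ {u v} → Present (u , v) → (u , v) ≢ (k , i) → (u , v) ≢ (i , j) →
                 (class u , class v) ∉ full
      excluded {u} {v} uv ≢g ≢h (here eq) = ≢g (pair {u} {v} (# 0) (# 1) eq)
      excluded {u} {v} uv ≢g ≢h (there (here eq)) = ≢h (pair {u} {v} (# 1) (# 2) eq)
      excluded {u} {v} uv ≢g ≢h (there (there (here eq))) =
        ¬kj (≡.subst Present (pair {u} {v} (# 0) (# 2) eq) uv)
      excluded {u} {v} uv ≢g ≢h (there (there (there (here eq)))) =
        contradiction (≡.trans (≡.sym v-k) (refine-other (label nodes v) (adjacent S v k) (≡.cong proj₂ eq))) λ ()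
        where
        v-k : Present (v , k)
        v-k = present-reverse {k , v}
          (≡.subst (λ w → Present (w , v)) (node-class {u} (# 0) (≡.cong proj₁ eq)) uv)
      excluded {u} {v} uv ≢g ≢h (there (there (there (there (here eq))))) =
        no-common u (not-node (# 0)) (not-node (# 1)) (not-node (# 2)) (proj₂ neighbour)
          (≡.subst (λ w → Present (u , w)) (node-class {v} (# 2) (≡.cong proj₂ eq)) uv)
        where
        neighbour : label nodes u ≡ # 3 × adjacent S u k ≡ true
        neighbour = refine-neighbour (label nodes u) (adjacent S u k) (≡.cong proj₁ eq)
        not-node : ∀ a → u ≢ Vec.lookup nodes a
        not-node a ≡.refl = Fin.fromℕ≢inject₁ (≡.trans (≡.sym (proj₁ neighbour)) (label-lookup nodes! a))

    sharedEnd : Orientation n → Orientation n → Bool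
    sharedEnd (i , j) (k , l) = adjacent S i j ∧ adjacent S k l

    notCommonNeighbour : Fin n → Fin n → Fin n → Bool
    notCommonNeighbour k j u = not (adjacent S u k ∧ adjacent S u j)

    pathEdge : Fin n → Fin n → Fin n → Bool
    pathEdge k i j = adjacent S k i ∧ (adjacent S i j ∧ (not (adjacent S k j) ∧
      all (notCommonNeighbour k j) (others k i j)))

    disjointEdge : Fin n → Fin n → Fin n → Fin n → Bool
    disjointEdge i j k l =
      adjacent S i j ∧ (adjacent S k l ∧ not (adjacent S i l ∧ adjacent S k j))

    -- The four decisions are arguments so that the value for each configuration can be found by
    -- cases on them. The first and the fourth clause exclude equal and opposite orientations.
    isEdgeBy : ∀ i j k l → Dec (i ≡ k) → Dec (j ≡ l) → Dec (i ≡ l) → Dec (j ≡ k) → Bool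
    isEdgeBy i j k l (yes _) (yes _) _       _       = false
    isEdgeBy i j k l (yes _) (no  _) _       _       = sharedEnd (i , j) (k , l)
    isEdgeBy i j k l (no  _) (yes _) _       _       = sharedEnd (i , j) (k , l)
    isEdgeBy i j k l (no  _) (no  _) (yes _) (yes _) = false
    isEdgeBy i j k l (no  _) (no  _) (yes _) (no  _) = pathEdge k i j
    isEdgeBy i j k l (no  _) (no  _) (no  _) (yes _) = pathEdge i j l
    isEdgeBy i j k l (no  _) (no  _) (no  _) (no  _) = disjointEdge i j k l

    isEdge : Orientation n → Orientation n → Bool
    isEdge (i , j) (k , l) = isEdgeBy i j k l (i Fin.≟ k) (j Fin.≟ l) (i Fin.≟ l) (j Fin.≟ k)

    pathEdge⇒supporting : ∀ {k i j} → k ≢ j → pathEdge k i j ≡ true → Supporting (k , i) (i , j)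
    pathEdge⇒supporting {k} {i} {j} k≢j eq =
      path-supporting (Bool.∧-conicalˡ (adjacent S k i) _ eq) (Bool.∧-conicalˡ (adjacent S i j) _ eq₁) k≢j
        (not-true (Bool.∧-conicalˡ (not (adjacent S k j)) _ eq₂))
        (λ u u≢k u≢i u≢j uk uj → not-true
          (all⇒∈ (others k i j) (Bool.∧-conicalʳ (not (adjacent S k j)) _ eq₂) (∈-others⁺ u≢k u≢i u≢j))
          (≡.cong₂ _∧_ uk uj))
      where
      eq₁ : adjacent S i j ∧ (not (adjacent S k j) ∧ all (notCommonNeighbour k j) (others k i j)) ≡ true
      eq₁ = Bool.∧-conicalʳ (adjacent S k i) _ eq
      eq₂ : not (adjacent S k j) ∧ all (notCommonNeighbour k j) (others k i j) ≡ true
      eq₂ = Bool.∧-conicalʳ (adjacent S i j) _ eq₁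

    isEdge⇒supporting : ∀ g h → isEdge g h ≡ true → Supporting g h
    isEdge⇒supporting (i , j) (k , l) eq with i Fin.≟ k | j Fin.≟ l | i Fin.≟ l | j Fin.≟ k
    ... | yes ≡.refl | no j≢l | _ | _ = source-supporting
      (Bool.∧-conicalˡ (adjacent S i j) _ eq) (Bool.∧-conicalʳ (adjacent S i j) _ eq) j≢l
    ... | no i≢k | yes ≡.refl | _ | _ = target-supporting
      (Bool.∧-conicalˡ (adjacent S i j) _ eq) (Bool.∧-conicalʳ (adjacent S i j) _ eq) i≢k
    ... | no _ | no _ | yes ≡.refl | no j≢k =
      Supporting-swap (pathEdge⇒supporting (j≢k ∘ ≡.sym) eq)
    ... | no _ | no _ | no i≢l | yes ≡.refl = pathEdge⇒supporting i≢l eq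
    ... | no i≢k | no j≢l | no i≢l | no j≢k = by-chord (adjacent S i l) ≡.refl
      where
      eq₁ : adjacent S k l ∧ not (adjacent S i l ∧ adjacent S k j) ≡ true
      eq₁ = Bool.∧-conicalʳ (adjacent S i j) _ eq
      ij : Present (i , j)
      ij = Bool.∧-conicalˡ (adjacent S i j) _ eq
      kl : Present (k , l)
      kl = Bool.∧-conicalˡ (adjacent S k l) _ eq₁
      ¬both : adjacent S i l ∧ adjacent S k j ≢ true
      ¬both = not-true (Bool.∧-conicalʳ (adjacent S k l) _ eq₁)
      -- `disjoint-supporting` wants {i , l} absent. If it is present, {k , j} is absent and takes
      -- its place once the two orientations are exchanged.
      by-chord : ∀ b → adjacent S i l ≡ b → Supporting (i , j) (k , l)
      by-chord false il = disjoint-supporting ij kl i≢k j≢l i≢l j≢k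
        (λ il′ → contradiction (≡.trans (≡.sym il) il′) λ ())
      by-chord true il = Supporting-swap (disjoint-supporting kl ij (i≢k ∘ ≡.sym) (j≢l ∘ ≡.sym)
        (j≢k ∘ ≡.sym) (i≢l ∘ ≡.sym) (λ kj → ¬both (≡.cong₂ _∧_ il kj)))

-- Listing unordered pairs

module UnorderedPairs where

  private variable
    a : Level
    A : Set a

  -- An edge does not order its two ends, so for a list without repetitions each pair of different
  -- entries appears in one order only.
  pairs : List A → List (A × A)
  pairs []       = []
  pairs (x ∷ xs) = map (x ,_) xs ++ pairs xs

  ∈-pairs⁻ : ∀ {x y : A} xs → (x , y) ∈ pairs xs → x ∈ xs × y ∈ xs
  ∈-pairs⁻ (z ∷ zs) xy∈ with ∈-++⁻ (map (z ,_) zs) xy∈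
  ... | inj₂ xy∈′ = let x∈ , y∈ = ∈-pairs⁻ zs xy∈′ in there x∈ , there y∈
  ... | inj₁ xy∈′ with ∈-map⁻ (z ,_) xy∈′
  ...   | _ , y∈zs , ≡.refl = here ≡.refl , there y∈zs

  ∈-pairs⁺ : ∀ {x y : A} {xs} → x ∈ xs → y ∈ xs → x ≢ y → (x , y) ∈ pairs xs ⊎ (y , x) ∈ pairs xs
  ∈-pairs⁺ (here ≡.refl) (here ≡.refl) x≢y = contradiction ≡.refl x≢y
  ∈-pairs⁺ (here ≡.refl) (there y∈)    x≢y = inj₁ (∈-++⁺ˡ (∈-map⁺ _ y∈))
  ∈-pairs⁺ (there x∈)    (here ≡.refl) x≢y = inj₂ (∈-++⁺ˡ (∈-map⁺ _ x∈))
  ∈-pairs⁺ {xs = z ∷ zs} (there x∈) (there y∈) x≢y with ∈-pairs⁺ x∈ y∈ x≢y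
  ... | inj₁ xy∈ = inj₁ (∈-++⁺ʳ (map (z ,_) zs) xy∈)
  ... | inj₂ yx∈ = inj₂ (∈-++⁺ʳ (map (z ,_) zs) yx∈)

  pairs-asym : ∀ {x y : A} {xs} → Unique xs → (x , y) ∈ pairs xs → (y , x) ∉ pairs xs
  pairs-asym {xs = z ∷ zs} (z∉zs ∷ zs!) xy∈ yx∈
    with ∈-++⁻ (map (z ,_) zs) xy∈ | ∈-++⁻ (map (z ,_) zs) yx∈
  ... | inj₂ xy∈′ | inj₂ yx∈′ = pairs-asym zs! xy∈′ yx∈′
  ... | inj₁ xy∈′ | inj₂ yx∈′ with ∈-map⁻ (z ,_) xy∈′
  ...   | _ , y∈zs , ≡.refl = All.lookup z∉zs (proj₂ (∈-pairs⁻ zs yx∈′)) ≡.refl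
  pairs-asym {xs = z ∷ zs} (z∉zs ∷ zs!) xy∈ yx∈ | inj₂ xy∈′ | inj₁ yx∈′ with ∈-map⁻ (z ,_) yx∈′
  ... | _ , x∈zs , ≡.refl = All.lookup z∉zs (proj₂ (∈-pairs⁻ zs xy∈′)) ≡.refl
  pairs-asym {xs = z ∷ zs} (z∉zs ∷ zs!) xy∈ yx∈ | inj₁ xy∈′ | inj₁ yx∈′
    with ∈-map⁻ (z ,_) xy∈′ | ∈-map⁻ (z ,_) yx∈′
  ... | _ , y∈zs , ≡.refl | _ , x∈zs , ≡.refl = All.lookup z∉zs x∈zs ≡.refl

  pairs-unique : ∀ {xs : List A} → Unique xs → Unique (pairs xs)
  pairs-unique []                     = []
  pairs-unique {xs = z ∷ zs} (z∉zs ∷ zs!) =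
    Unique.++⁺ (Unique.map⁺ (≡.cong proj₂) zs!) (pairs-unique zs!) disjoint
    where
    disjoint : ∀ {p} → ¬ (p ∈ map (z ,_) zs × p ∈ pairs zs)
    disjoint (p∈ , p∈′) with ∈-map⁻ (z ,_) p∈
    ... | _ , _ , ≡.refl = All.lookup z∉zs (proj₁ (∈-pairs⁻ zs p∈′)) ≡.refl

-- Bijection between the pairs passing the criterion and the edges

module EdgeCount {c ℓ₁ ℓ₂ : Level} (ℝ : Reals c ℓ₁ ℓ₂) {n : ℕ} (G : Graph n) where

  open Theory ℝ hiding (zero)
  open OrderedField ℝ
  open OrderProperties ℝ
  open Adjacency
  open Oriented {n} (arcs G)
  open Geometry ℝ
  open Faces ℝ G
  open EdgeCriterion
  open UnorderedPairs
  open SemiringSum semiring using (sum-cong-≋; *-distribʳ-sum; ∑-distrib-+)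

  sum-mono-≤ : ∀ {m} {f g : Vector Carrier m} → (∀ k → f k ≤ g k) → sum f ≤ sum g
  sum-mono-≤ {zero}  f≤g = ≤-refl
  sum-mono-≤ {suc m} f≤g = +-mono-≤ (f≤g zero) (sum-mono-≤ (λ k → f≤g (suc k)))

  rise-reverse : ∀ (a : Point n) o → rise a o + rise a (reverse o) ≈ 0#
  rise-reverse a (i , j) = solve 2 (λ x y → (x :- y) :+ (y :- x) := :0) refl (a i) (a j)

  module _ {g h : Orientation n} (supporting : Supporting (arcs G) g h) where

    open Supporting supporting

    ψ : Point n
    ψ u = fromℕ (potential u)

    b : Carrier
    b = fromℕ height

    abstract
      rise≈b : ∀ o → potential (proj₁ o) ≡ height ℕ.+ potential (proj₂ o) → rise ψ o ≈ b
      rise≈b (u , v) eq = trans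
        (+-congʳ (trans (reflexive (≡.cong fromℕ eq)) (fromℕ-+ height (potential v))))
        (solve 2 (λ x y → x :+ y :- y := x) refl b (ψ v))

      rise<b : ∀ {o} → Present o → o ≢ g → o ≢ h → rise ψ o < b
      rise<b {u , v} present ≢g ≢h = difference-< (<-respʳ-≈
        (trans (+-congʳ (fromℕ-+ height (potential v)))
          (solve 3 (λ b x y → b :+ y :- x := b :- (x :- y)) refl b (ψ u) (ψ v)))
        (<-difference (fromℕ-mono-< (strict present ≢g ≢h))))

      rise≤b : ∀ {o} → Present o → rise ψ o ≤ b
      rise≤b {o} present with o ≟ᵒ g | o ≟ᵒ h
      ... | yes ≡.refl | _          = ≤-reflexive (rise≈b o g-rise)
      ... | no _       | yes ≡.refl = ≤-reflexive (rise≈b o h-rise)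
      ... | no ≢g      | no ≢h      = <⇒≤ (rise<b present ≢g ≢h)

      0<b : 0# < b
      0<b = fromℕ-mono-< height>0

      below : ∀ {x} → Representation x → ⟨ ψ , x ⟩ ≤ b
      below {x} r = begin
        ⟨ ψ , x ⟩                                ≈⟨ pairing ψ ⟩
        sum (λ k → weights k * rise ψ (ends k))  ≤⟨ sum-mono-≤ (λ k → *-monoˡ-≤ (nonneg k) (rise≤b (present k))) ⟩
        sum (λ k → weights k * b)                ≈⟨ weighted b ⟩
        b                                        ∎
        where
        open Representation r
        open ≤-Reasoning

      ψ#0 : ψ (proj₁ g) # 0#
      ψ#0 = #-sym (<⇒# (<-≤-trans 0<b (≤-trans (fromℕ-mono-≤ (ℕ.m≤m+n height _))
        (≤-reflexive (reflexive (≡.cong fromℕ (≡.sym g-rise)))))))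

      -- The opposite vertex has value `- b`, and this differs from the positive `b`. A vertex off
      -- the hyperplane makes the face proper.
      reverse-below : ¬ ⟨ ψ , vec (reverse g) ⟩ ≈ b
      reverse-below eq = proj₂ (tight _ _) b≈0 (#-sym (<⇒# 0<b))
        where
        b≈0 : b ≈ 0#
        b≈0 = x+x≈y+y⇒x≈y (trans
          (sym (+-cong (rise≈b g g-rise) (trans (sym (⟨⟩-vec ψ (reverse g))) eq)))
          (trans (rise-reverse ψ g) (sym (+-identityʳ 0#))))

      g-on : ⟨ ψ , vec g ⟩ ≈ b
      g-on = trans (⟨⟩-vec ψ g) (rise≈b g g-rise)

      h-on : ⟨ ψ , vec h ⟩ ≈ b
      h-on = trans (⟨⟩-vec ψ h) (rise≈b h h-rise)

    supportingFace : Face P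
    supportingFace = record
      { normal    = ψ
      ; offset    = b
      ; normal#0  = proj₁ g , ψ#0
      ; halfspace = λ x x∈P → below (represent x∈P)
      ; touches   = vec g , vec∈P {g} g-present , g-on
      ; proper    = λ (_ , P⊆) →
          reverse-below (proj₂ (P⊆ (vec∈P {reverse g} (present-reverse {g} g-present))))
      }

    abstract
      supportingFace-spanned : Spanned supportingFace g h
      supportingFace-spanned {o} present tight-o with o ≟ᵒ g | o ≟ᵒ h
      ... | yes o≡g | _       = inj₁ o≡g
      ... | no _    | yes o≡h = inj₂ o≡h
      ... | no ≢g   | no ≢h   = contradiction (rise<b present ≢g ≢h) (<-irrefl tight-o)

      -- Two weights with sum 0 are opposite, so the combination is `w₀` times the difference of the
      -- two vectors, which is apart from 0 by `vec-apart`.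
      ends-independent : AffinelyIndependent (vec g ∷ᵛ vec h ∷ᵛ []ᵛ)
      ends-independent w Σw≈0 (k , wk#0) =
        let i , gi#hi = vec-apart (present-loopless {g} g-present) g≢h
        in i , #-congʳ (combination≈ i) (x#0y#0→xy#0 (w₀#0 k wk#0) (x#y⇒x-y#0 gi#hi))
        where
        w₀ w₁ : Carrier
        w₀ = w zero
        w₁ = w (suc zero)
        w₁≈-w₀ : w₁ ≈ - w₀
        w₁≈-w₀ = trans (solve 2 (λ x y → y := (x :+ (y :+ :0)) :- x) refl w₀ w₁)
          (trans (+-congʳ Σw≈0) (+-identityˡ (- w₀)))
        w₀#0 : ∀ k → w k # 0# → w₀ # 0#
        w₀#0 zero       #0 = #0
        w₀#0 (suc zero) #0 = x*y#0⇒y#0 {x = - 1#} (#-congʳ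
          (trans w₁≈-w₀ (solve 1 (λ x → :- x := (:- :1) :* x) refl w₀)) #0)
        combination≈ : ∀ i → w₀ * (vec g i - vec h i) ≈ combination w (vec g ∷ᵛ vec h ∷ᵛ []ᵛ) i
        combination≈ i = trans
          (solve 3 (λ w x y → w :* (x :- y) := w :* x :+ (:- w :* y :+ :0)) refl w₀ (vec g i) (vec h i))
          (+-congˡ (+-congʳ (*-congʳ (sym w₁≈-w₀))))

    -- All weight not at `g` is credited to `h` by `offG`, so the two parts always add up to the
    -- whole; an orientation other than `g` and `h` has weight 0 on this face and does no harm.
    onG : Orientation n → Carrier → Carrier
    onG o w = if does (o ≟ᵒ g) then w else 0#

    offG : Orientation n → Carrier → Carrier
    offG o w = if does (o ≟ᵒ g) then 0# else w

    abstract
      ends-span : ∀ {x} → Representation x → ⟨ ψ , x ⟩ ≈ b →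
                  ∃[ w ] sum w ≈ 1# × x ≋ combination w (vec g ∷ᵛ vec h ∷ᵛ []ᵛ)
      ends-span {x} r on = w , total′ , λ i → begin
        x i
          ≈⟨ combination≋ i ⟩
        sum (λ k → weights k * vec (ends k) i)
          ≈⟨ sum-cong-≋ (term i) ⟩
        sum (λ k → onG (ends k) (weights k) * vec g i + offG (ends k) (weights k) * vec h i)
          ≈⟨ ∑-distrib-+ (λ k → onG (ends k) (weights k) * vec g i) (λ k → offG (ends k) (weights k) * vec h i) ⟩
        sum (λ k → onG (ends k) (weights k) * vec g i) + sum (λ k → offG (ends k) (weights k) * vec h i)
          ≈⟨ +-cong (*-distribʳ-sum (vec g i) (λ k → onG (ends k) (weights k)))
               (*-distribʳ-sum (vec h i) (λ k → offG (ends k) (weights k))) ⟨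
        W * vec g i + W′ * vec h i
          ≈⟨ +-congˡ (+-identityʳ _) ⟨
        combination w (vec g ∷ᵛ vec h ∷ᵛ []ᵛ) i ∎
        where
        open Representation r
        open SetoidReasoning setoid
        W W′ : Carrier
        W  = sum (λ k → onG (ends k) (weights k))
        W′ = sum (λ k → offG (ends k) (weights k))
        w : Vector Carrier 2
        w = W ∷ᵛ W′ ∷ᵛ []ᵛ
        split : ∀ o y → y ≈ onG o y + offG o y
        split o y with o ≟ᵒ g
        ... | yes _ = sym (+-identityʳ y)
        ... | no _  = sym (+-identityˡ y)
        total′ : sum w ≈ 1#
        total′ = begin
          W + (W′ + 0#)  ≈⟨ +-congˡ (+-identityʳ W′) ⟩
          W + W′         ≈⟨ ∑-distrib-+ (λ k → onG (ends k) (weights k)) (λ k → offG (ends k) (weights k)) ⟨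
          sum (λ k → onG (ends k) (weights k) + offG (ends k) (weights k))
                         ≈⟨ sum-cong-≋ (λ k → split (ends k) (weights k)) ⟨
          sum weights    ≈⟨ total ⟩
          1#             ∎
        term : ∀ i k → weights k * vec (ends k) i ≈
                       onG (ends k) (weights k) * vec g i + offG (ends k) (weights k) * vec h i
        term i k = by-end (ends k) (spanned-weight supportingFace supportingFace-spanned r on k)
          where
          by-end : ∀ o → (o ≢ g → o ≢ h → weights k ≈ 0#) →
                   weights k * vec o i ≈ onG o (weights k) * vec g i + offG o (weights k) * vec h i
          by-end o w≈0 with o ≟ᵒ g
          ... | yes ≡.refl = solve 3 (λ w x y → w :* x := w :* x :+ :0 :* y) refl (weights k) (vec o i) (vec h i)
          ... | no ≢g with o ≟ᵒ h
          ...   | yes ≡.refl = solve 3 (λ w x y → w :* y := :0 :* x :+ w :* y) refl (weights k) (vec g i) (vec o i)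
          ...   | no ≢h = trans (*-congʳ (w≈0 ≢g ≢h))
            (trans (solve 3 (λ x y z → :0 :* z := :0 :* x :+ :0 :* y) refl (vec g i) (vec h i) (vec o i))
              (+-congˡ (*-congʳ (sym (w≈0 ≢g ≢h)))))

    supportingEdge : Edge P
    supportingEdge = supportingFace , vec g ∷ᵛ vec h ∷ᵛ []ᵛ ,
      (λ { zero       → vec∈P {g} g-present , g-on
         ; (suc zero) → vec∈P {h} h-present , h-on }) ,
      ends-independent , λ x (x∈P , on) → ends-span (represent x∈P) on

  -- Used for two arcs that replace a tight pair with the same total rise: neither can exceed `b`,
  -- so a total of `b + b` leaves no slack.
  sum-tight : ∀ {x y b} → x ≤ b → y ≤ b → x + y ≈ b + b → x ≈ b
  sum-tight {x} {y} {b} x≤b y≤b x+y≈b+b = ≤-antisym x≤b (difference-≤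
    (≤-trans (≤-difference y≤b) (≤-reflexive (begin
      b - y              ≈⟨ solve 2 (λ b y → b :- y := (b :+ b) :- y :- b) refl b y ⟩
      (b + b) - y - b    ≈⟨ +-congʳ (+-congʳ x+y≈b+b) ⟨
      (x + y) - y - b    ≈⟨ solve 3 (λ x y b → (x :+ y) :- y :- b := x :- b) refl x y b ⟩
      x - b              ∎))))
    where open SetoidReasoning setoid

  module _ (F : Face P) (dim : HasDimension (Face.points F) 1) where

    open Face F
    open OnFace F
    open OnEdge F dim

    no-reverse : ∀ {o} → Tight o → ¬ Tight (reverse o)
    no-reverse {o} tight-o tight-rev = offset≉0 (x+x≈y+y⇒x≈y
      (trans (sym (+-cong tight-o tight-rev)) (trans (rise-reverse normal o) (sym (+-identityʳ 0#)))))

    chords-tight : ∀ {i j k l} → Tight (i , j) → Tight (k , l) →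
                   Present (i , l) → Present (k , j) → Tight (i , l)
    chords-tight {i} {j} {k} {l} ij kl il kj =
      sum-tight (rise≤offset {i , l} il) (rise≤offset {k , j} kj) (trans
        (solve 4 (λ i j k l → (i :- l) :+ (k :- j) := (i :- j) :+ (k :- l)) refl
          (normal i) (normal j) (normal k) (normal l))
        (+-cong ij kl))

    path-rise : ∀ {k i j} → Tight (k , i) → Tight (i , j) → ∀ u →
                rise normal (k , u) + rise normal (u , j) ≈ offset + offset
    path-rise {k} {i} {j} ki ij u = trans
      (solve 4 (λ i j k u → (k :- u) :+ (u :- j) := (k :- i) :+ (i :- j)) refl
        (normal i) (normal j) (normal k) (normal u))
      (+-cong ki ij)

    -- The chord would rise by twice the offset, while its rise is at most the offset; with
    -- nonnegativity the offset would be 0.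
    no-chord : ∀ {k i j} → Present (k , i) → Tight (k , i) → Tight (i , j) → ¬ Present (k , j)
    no-chord {k} {i} {j} k-i ki ij kj = offset≉0 (≤-antisym
      (difference-≤ (≤-trans (≤-difference (rise≤offset {k , j} kj)) (≤-reflexive (begin
        offset - rise normal (k , j)
          -- Inserts the loop `(k , k)` of rise 0, so that `path-rise` applies with `u` equal to
          -- `k`.
          ≈⟨ solve 3 (λ b x y → b :- (x :- y) := b :- ((x :- x) :+ (x :- y))) refl offset (normal k) (normal j) ⟩
        offset - (rise normal (k , k) + rise normal (k , j))
          ≈⟨ +-congˡ (-‿cong (path-rise {k} {i} {j} ki ij k)) ⟩
        offset - (offset + offset)
          ≈⟨ solve 1 (λ b → b :- (b :+ b) := :0 :- b) refl offset ⟩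
        0# - offset ∎))))
      (offset-nonneg {k , i} k-i ki))
      where open SetoidReasoning setoid

    pathEdge-complete : ∀ {k i j} → Present (k , i) → Tight (k , i) → Present (i , j) → Tight (i , j) →
                        pathEdge (arcs G) k i j ≡ true
    pathEdge-complete {k} {i} {j} k-i ki i-j ij =
      ≡.cong₂ _∧_ k-i (≡.cong₂ _∧_ i-j (≡.cong₂ _∧_
        (true-not (no-chord {k} {i} {j} k-i ki ij))
        (∈⇒all (others k i j) λ u∈ → true-not (no-common u∈))))
      where
      no-common : ∀ {u} → u ∈ others k i j →
                  adjacent (arcs G) u k ∧ adjacent (arcs G) u j ≢ true
      no-common {u} u∈ both = no-three-tight
        ((k , i) , k-i , ki) ((i , j) , i-j , ij) ((k , u) , k-u , ku)
        (present-loopless {k , i} k-i ∘ ≡.cong proj₁)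
        (u≢i ∘ ≡.sym ∘ ≡.cong proj₂) (present-loopless {k , i} k-i ∘ ≡.sym ∘ ≡.cong proj₁)
        where
        u≢i : u ≢ i
        u≢i = proj₁ (proj₂ (∈-others⁻ {n} {k} {i} {j} u∈))
        k-u : Present (k , u)
        k-u = present-reverse {u , k} (Bool.∧-conicalˡ (adjacent (arcs G) u k) _ both)
        ku : Tight (k , u)
        ku = sum-tight (rise≤offset {k , u} k-u)
          (rise≤offset {u , j} (Bool.∧-conicalʳ (adjacent (arcs G) u k) _ both))
          (path-rise {k} {i} {j} ki ij u)

    isEdge-complete : ∀ g h → Present g → Tight g → Present h → Tight h → g ≢ h →
                      isEdge (arcs G) g h ≡ true
    isEdge-complete (i , j) (k , l) i-j ij k-l kl g≢h
      with i Fin.≟ k | j Fin.≟ l | i Fin.≟ l | j Fin.≟ k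
    ... | yes ≡.refl | yes ≡.refl | _ | _ = contradiction ≡.refl g≢h
    ... | yes _ | no _  | _ | _ = ≡.cong₂ _∧_ i-j k-l
    ... | no _  | yes _ | _ | _ = ≡.cong₂ _∧_ i-j k-l
    ... | no _ | no _ | yes ≡.refl | yes ≡.refl = contradiction kl (no-reverse {i , j} ij)
    ... | no _ | no _ | yes ≡.refl | no _ = pathEdge-complete {k} {i} {j} k-l kl i-j ij
    ... | no _ | no _ | no _ | yes ≡.refl = pathEdge-complete {i} {j} {l} i-j ij k-l kl
    ... | no i≢k | no j≢l | no _ | no _ =
      ≡.cong₂ _∧_ i-j (≡.cong₂ _∧_ k-l (true-not no-chords))
      where
      no-chords : adjacent (arcs G) i l ∧ adjacent (arcs G) k j ≢ true
      no-chords both = no-three-tight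
        ((i , j) , i-j , ij) ((k , l) , k-l , kl) ((i , l) , i-l , chords-tight {i} {j} {k} {l} ij kl i-l k-j)
        g≢h (j≢l ∘ ≡.cong proj₂) (i≢k ∘ ≡.sym ∘ ≡.cong proj₁)
        where
        i-l : Present (i , l)
        i-l = Bool.∧-conicalˡ (adjacent (arcs G) i l) _ both
        k-j : Present (k , j)
        k-j = Bool.∧-conicalʳ (adjacent (arcs G) i l) _ both

  -- The symmetry is taken from the geometry: the face built for a pair does not order its ends, so
  -- completeness can be applied to it with `h` first.
  isEdge-swap : ∀ g h → isEdge (arcs G) g h ≡ true → isEdge (arcs G) h g ≡ true
  isEdge-swap g h eq = isEdge-complete (supportingFace s) (proj₂ (supportingEdge s)) h g
    h-present (rise≈b s h h-rise) g-present (rise≈b s g g-rise) (g≢h ∘ ≡.sym)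
    where
    s : Supporting (arcs G) g h
    s = isEdge⇒supporting (arcs G) g h eq
    open Supporting s

  orientations : List (Orientation n)
  orientations = cartesianProduct (allFin n) (allFin n)

  orientations! : Unique orientations
  orientations! = Unique.cartesianProduct⁺ (Unique.allFin⁺ n) (Unique.allFin⁺ n)

  ∈-orientations : ∀ o → o ∈ orientations
  ∈-orientations (i , j) = ∈-cartesianProduct⁺ (∈-allFin i) (∈-allFin j)

  isEdge? : (p : Orientation n × Orientation n) → Dec (isEdge (arcs G) (proj₁ p) (proj₂ p) ≡ true)
  isEdge? (g , h) = isEdge (arcs G) g h Bool.≟ true

  edgePairs : List (Orientation n × Orientation n)
  edgePairs = filter isEdge? (pairs orientations)

  edgePairs! : Unique edgePairs
  edgePairs! = Unique.filter⁺ isEdge? (pairs-unique orientations!)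

  module _ (e : Fin (length edgePairs)) where

    edgePair-∈ : List.lookup edgePairs e ∈ pairs orientations
    edgePair-∈ = proj₁ (∈-filter⁻ isEdge? {xs = pairs orientations} (∈-lookup e))

    edgePair-supporting : let g , h = List.lookup edgePairs e in Supporting (arcs G) g h
    edgePair-supporting = isEdge⇒supporting (arcs G) _ _
      (proj₂ (∈-filter⁻ isEdge? {xs = pairs orientations} (∈-lookup e)))

    toEdge : Edge P
    toEdge = supportingEdge edgePair-supporting

  supporting-tight : ∀ {g h} (s : Supporting (arcs G) g h) →
    OnFace.Tight (supportingFace s) g × OnFace.Tight (supportingFace s) h
  supporting-tight {g} {h} s = rise≈b s g (Supporting.g-rise s) , rise≈b s h (Supporting.h-rise s)

  same-ends : ∀ {g h g′ h′} (s : Supporting (arcs G) g h) (s′ : Supporting (arcs G) g′ h′) →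
              Face.points (supportingFace s) ≐ Face.points (supportingFace s′) →
              (g , h) ≡ (g′ , h′) ⊎ (g , h) ≡ (h′ , g′)
  same-ends {g} {h} {g′} {h′} s s′ (⊆′ , _) = combine (end g g-present (proj₁ (supporting-tight s)))
                                     (end h h-present (proj₂ (supporting-tight s)))
    where
    open Supporting s using (g-present; h-present; g≢h)
    end : ∀ o → Present o → OnFace.Tight (supportingFace s) o → o ≡ g′ ⊎ o ≡ h′
    end o present tight-o = supportingFace-spanned s′ present
      (OnFace.points⇒tight (supportingFace s′) {o}
        (⊆′ (OnFace.vec∈points (supportingFace s) {o} present tight-o)))
    combine : g ≡ g′ ⊎ g ≡ h′ → h ≡ g′ ⊎ h ≡ h′ → (g , h) ≡ (g′ , h′) ⊎ (g , h) ≡ (h′ , g′)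
    combine (inj₁ g≡g′) (inj₁ h≡g′) = contradiction (≡.trans g≡g′ (≡.sym h≡g′)) g≢h
    combine (inj₁ g≡g′) (inj₂ h≡h′) = inj₁ (≡.cong₂ _,_ g≡g′ h≡h′)
    combine (inj₂ g≡h′) (inj₁ h≡g′) = inj₂ (≡.cong₂ _,_ g≡h′ h≡g′)
    combine (inj₂ g≡h′) (inj₂ h≡h′) = contradiction (≡.trans g≡h′ (≡.sym h≡h′)) g≢h

  -- Equal faces have the same two ends, and a listed pair is never listed in the opposite order as
  -- well.
  toEdge-injective : ∀ {e e′} → Face.points (proj₁ (toEdge e)) ≐ Face.points (proj₁ (toEdge e′)) → e ≡ e′
  toEdge-injective {e} {e′} same =
    [ lookup-injective edgePairs!
    , (λ eq → contradiction (edgePair-∈ e′)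
        (pairs-asym orientations! (≡.subst (_∈ pairs orientations) eq (edgePair-∈ e)))) ]′
    (same-ends (edgePair-supporting e) (edgePair-supporting e′) same)

  -- Completeness puts the pair into `edgePairs`. The hyperplane built there may differ from the
  -- given one, but both faces are spanned by the same two vertices.
  toEdge-onto : ∀ (E : Edge P) {g h} → Present g → OnFace.Tight (proj₁ E) g →
    Present h → OnFace.Tight (proj₁ E) h → g ≢ h → (g , h) ∈ pairs orientations →
    ∃[ e ] Face.points (proj₁ (toEdge e)) ≐ Face.points (proj₁ E)
  toEdge-onto (F , dim) {g} {h} g-present g-tight h-present h-tight g≢h gh∈ =
    e , points-⊆ (supportingFace s) F {g′} {h′} (supportingFace-spanned s)
          (≡.subst (OnFace.Tight F ∘ proj₁) lookup≡ g-tight) (≡.subst (OnFace.Tight F ∘ proj₂) lookup≡ h-tight) ,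
        points-⊆ F (supportingFace s) {g} {h}
          (OnEdge.spanned F dim {g} {h} g-present g-tight h-present h-tight g≢h)
          (≡.subst (OnFace.Tight (supportingFace s)) (≡.cong proj₁ (≡.sym lookup≡)) (proj₁ (supporting-tight s)))
          (≡.subst (OnFace.Tight (supportingFace s)) (≡.cong proj₂ (≡.sym lookup≡)) (proj₂ (supporting-tight s)))
    where
    gh∈′ : (g , h) ∈ edgePairs
    gh∈′ = ∈-filter⁺ isEdge? gh∈
      (isEdge-complete F dim g h g-present g-tight h-present h-tight g≢h)
    e : Fin (length edgePairs)
    e = Any.index gh∈′
    lookup≡ : (g , h) ≡ List.lookup edgePairs e
    lookup≡ = lookup-index gh∈′
    g′ h′ : Orientation n
    g′ = proj₁ (List.lookup edgePairs e)
    h′ = proj₂ (List.lookup edgePairs e)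
    s : Supporting (arcs G) g′ h′
    s = edgePair-supporting e

  toEdge-surjective : ∀ (E : Edge P) → ∃[ e ] Face.points (proj₁ (toEdge e)) ≐ Face.points (proj₁ E)
  toEdge-surjective E@(F , dim) = by-order (OnEdge.two-tight F dim)
    where
    open OnEdge F dim
    by-order : Σ[ s ∈ TightArc ] Σ[ t ∈ TightArc ] proj₁ t ≢ proj₁ s →
               ∃[ e ] Face.points (proj₁ (toEdge e)) ≐ Face.points (proj₁ E)
    by-order ((g , g-present , g-tight) , (h , h-present , h-tight) , h≢g) =
      [ toEdge-onto E g-present g-tight h-present h-tight (h≢g ∘ ≡.sym)
      , toEdge-onto E h-present h-tight g-present g-tight h≢g ]′
      (∈-pairs⁺ (∈-orientations g) (∈-orientations h) (h≢g ∘ ≡.sym))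

  edgeCount : ℕ
  edgeCount = length edgePairs

  hasEdgeCount : P HasEdgeCount edgeCount
  hasEdgeCount = record
    { to        = toEdge
    ; cong      = λ { ≡.refl → (λ x∈ → x∈) , (λ x∈ → x∈) }
    ; bijective = toEdge-injective ,
        λ E → let e , same = toEdge-surjective E in e , λ { ≡.refl → same }
    }

-- Edge probabilities and their sum over ordered pairs

module EdgeExpectation {c ℓ₁ ℓ₂ : Level} (ℝ : Reals c ℓ₁ ℓ₂) where

  open Theory ℝ hiding (zero)
  open OrderedField ℝ
  open Adjacency
  open Expectation ℝ
  open EdgeCriterion
  open UnorderedPairs
  open SetoidReasoning setoid

  private variable
    a b : Level
    A : Set a
    B : Set b

  ∑-cong : (xs : List A) {f g : A → Carrier} → (∀ {x} → x ∈ xs → f x ≈ g x) → ∑ xs f ≈ ∑ xs g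
  ∑-cong []       f≈g = refl
  ∑-cong (x ∷ xs) f≈g = +-cong (f≈g (here ≡.refl)) (∑-cong xs (λ x∈ → f≈g (there x∈)))

  ∑-const : (xs : List A) {f : A → Carrier} {y : Carrier} → (∀ {x} → x ∈ xs → f x ≈ y) →
            ∑ xs f ≈ fromℕ (length xs) * y
  ∑-const []       {y = y} f≈y = sym (zeroˡ y)
  ∑-const (x ∷ xs) {y = y} f≈y = begin
    _ + ∑ xs _                     ≈⟨ +-cong (f≈y (here ≡.refl)) (∑-const xs (λ x∈ → f≈y (there x∈))) ⟩
    y + fromℕ (length xs) * y      ≈⟨ solve 2 (λ y l → y :+ l :* y := (:1 :+ l) :* y) refl y (fromℕ (length xs)) ⟩
    (1# + fromℕ (length xs)) * y   ∎

  ∑-+ : (xs : List A) (f g : A → Carrier) → ∑ xs (λ x → f x + g x) ≈ ∑ xs f + ∑ xs g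
  ∑-+ []       f g = sym (+-identityʳ 0#)
  ∑-+ (x ∷ xs) f g = trans (+-congˡ (∑-+ xs f g)) (+-interchange _ _ _ _)

  ∑-++ : (xs ys : List A) (f : A → Carrier) → ∑ (xs ++ ys) f ≈ ∑ xs f + ∑ ys f
  ∑-++ []       ys f = sym (+-identityˡ _)
  ∑-++ (x ∷ xs) ys f = trans (+-congˡ (∑-++ xs ys f)) (sym (+-assoc _ _ _))

  ∑-map : (h : A → B) (xs : List A) (f : B → Carrier) → ∑ (map h xs) f ≈ ∑ xs (f ∘ h)
  ∑-map h []       f = refl
  ∑-map h (x ∷ xs) f = +-congˡ (∑-map h xs f)

  ∑-cartesianProduct : (xs : List A) (ys : List B) (f : A × B → Carrier) →
    ∑ (cartesianProduct xs ys) f ≈ ∑ xs (λ x → ∑ ys (λ y → f (x , y)))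
  ∑-cartesianProduct []       ys f = refl
  ∑-cartesianProduct (x ∷ xs) ys f = trans (∑-++ (map (x ,_) ys) (cartesianProduct xs ys) f)
    (+-cong (∑-map (x ,_) ys f) (∑-cartesianProduct xs ys f))

  -- Each unordered pair occurs in two orders and the diagonal contributes 0; doubling the left side
  -- avoids a division by 2.
  ∑-pairs : (xs : List A) (q : A → A → Carrier) → (∀ x y → q x y ≈ q y x) → (∀ x → q x x ≈ 0#) →
    ∑ (pairs xs) (λ (x , y) → q x y) + ∑ (pairs xs) (λ (x , y) → q x y) ≈ ∑ xs (λ x → ∑ xs (q x))
  ∑-pairs []       q q-sym q-diag = +-identityʳ 0#
  ∑-pairs (x ∷ xs) q q-sym q-diag = begin
    ∑ (pairs (x ∷ xs)) q′ + ∑ (pairs (x ∷ xs)) q′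
      ≈⟨ +-cong split split ⟩
    (R + S) + (R + S)
      -- The added `0#` becomes the diagonal term, and symmetry turns one copy of `R` into the
      -- column of `x`.
      ≈⟨ solve 2 (λ R S → (R :+ S) :+ (R :+ S) := (:0 :+ R) :+ (R :+ (S :+ S))) refl R S ⟩
    (0# + R) + (R + (S + S))
      ≈⟨ +-cong (+-congʳ (sym (q-diag x)))
           (+-cong (∑-cong xs (λ {y} _ → q-sym x y)) (∑-pairs xs q q-sym q-diag)) ⟩
    (q x x + R) + (∑ xs (λ y → q y x) + ∑ xs (λ y → ∑ xs (q y)))
      ≈⟨ +-congˡ (∑-+ xs (λ y → q y x) (λ y → ∑ xs (q y))) ⟨
    ∑ (x ∷ xs) (λ y → ∑ (x ∷ xs) (q y)) ∎
    where
    q′ : _ → Carrier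
    q′ (x , y) = q x y
    R S : Carrier
    R = ∑ xs (q x)
    S = ∑ (pairs xs) q′
    split : ∑ (pairs (x ∷ xs)) q′ ≈ R + S
    split = trans (∑-++ (map (x ,_) xs) (pairs xs) q′) (+-congʳ (∑-map (x ,_) xs q′))

  module _ (_≟_ : (x y : A) → Dec (x ≡ y)) where

    ∑-remove : ∀ {x xs} → Unique xs → x ∈ xs → (f : A → Carrier) →
               ∑ xs f ≈ f x + ∑ (remove _≟_ x xs) f
    ∑-remove {x} {y ∷ ys} (y∉ys ∷ ys!) x∈ f with y ≟ x
    ∑-remove {x} {y ∷ ys} (y∉ys ∷ ys!) x∈ f | yes ≡.refl =
      +-congˡ (reflexive (≡.cong (λ zs → ∑ zs f) (≡.sym (remove-∉ _≟_ y∉ys))))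
    ∑-remove {x} {y ∷ ys} (y∉ys ∷ ys!) (here x≡y)  f | no y≢x = contradiction (≡.sym x≡y) y≢x
    ∑-remove {x} {y ∷ ys} (y∉ys ∷ ys!) (there x∈)  f | no y≢x = trans (+-congˡ (∑-remove ys! x∈ f))
      (solve 3 (λ a b c → a :+ (b :+ c) := b :+ (a :+ c)) refl (f y) (f x) (∑ (remove _≟_ x ys) f))

    length-remove : ∀ {x xs} → Unique xs → x ∈ xs → suc (length (remove _≟_ x xs)) ≡ length xs
    length-remove {x} {y ∷ ys} (y∉ys ∷ ys!) x∈ with y ≟ x
    length-remove {x} {y ∷ ys} (y∉ys ∷ ys!) x∈ | yes ≡.refl =
      ≡.cong (suc ∘ length) (remove-∉ _≟_ y∉ys)
    length-remove {x} {y ∷ ys} (y∉ys ∷ ys!) (here x≡y) | no y≢x = contradiction (≡.sym x≡y) y≢x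
    length-remove {x} {y ∷ ys} (y∉ys ∷ ys!) (there x∈) | no y≢x = ≡.cong suc (length-remove ys! x∈)

  fromℕ-length-filter : (f : A → Bool) (xs : List A) →
    fromℕ (length (filter (λ x → f x Bool.≟ true) xs)) ≈ ∑ xs (𝟙 ∘ f)
  fromℕ-length-filter f [] = refl
  fromℕ-length-filter f (x ∷ xs) with f x
  ... | true  = +-congˡ (fromℕ-length-filter f xs)
  ... | false = trans (fromℕ-length-filter f xs) (sym (+-identityˡ _))

  𝟙-all : (f : A → Bool) (xs : List A) → 𝟙 (all f xs) ≈ ∏ xs (𝟙 ∘ f)
  𝟙-all f []       = refl
  𝟙-all f (x ∷ xs) = trans (𝟙-∧ (f x) (all f xs)) (*-congˡ (𝟙-all f xs))

  ∏-cong : (xs : List A) {f g : A → Carrier} → (∀ x → f x ≈ g x) → ∏ xs f ≈ ∏ xs g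
  ∏-cong []       f≈g = refl
  ∏-cong (x ∷ xs) f≈g = *-cong (f≈g x) (∏-cong xs f≈g)

  module _ (p : Carrier) {n : ℕ} where

    edgeProbability : Orientation n → Orientation n → Carrier
    edgeProbability g h = expectation p (λ S → 𝟙 (isEdge S g h))

    -- Bracketed in the order in which the arcs are split off; an explicit final `1#` is the
    -- expectation of the constant left over. In `path`, `n ∸ 3` counts the candidates for a common
    -- neighbour.
    shared crossing path : Carrier
    shared   = p * (p * 1#)
    crossing = p * (p * ((1# - p ^ 2) * 1#))
    path     = p * (p * ((1# - p) * (1# - p ^ 2) ^ (n ∸ 3)))

    without₁ : Fin n → List (Fin n)
    without₁ i = remove Fin._≟_ i (allFin n)

    without₂ : Fin n → Fin n → List (Fin n)
    without₂ i j = remove Fin._≟_ j (without₁ i)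

    without₁! : ∀ i → Unique (without₁ i)
    without₁! i = Unique.filter⁺ (λ y → ¬? (y Fin.≟ i)) (Unique.allFin⁺ n)

    without₂! : ∀ i j → Unique (without₂ i j)
    without₂! i j = Unique.filter⁺ (λ y → ¬? (y Fin.≟ j)) (without₁! i)

    others! : ∀ i j k → Unique (others i j k)
    others! i j k = Unique.filter⁺ (λ y → ¬? (y Fin.≟ k)) (without₂! i j)

    ∈-without₁ : ∀ {i j} → i ≢ j → j ∈ without₁ i
    ∈-without₁ {j = j} i≢j = ∈-filter⁺ _ (∈-allFin j) (i≢j ∘ ≡.sym)

    ∈-without₂ : ∀ {i j k} → i ≢ k → j ≢ k → k ∈ without₂ i j
    ∈-without₂ i≢k j≢k = ∈-filter⁺ _ (∈-without₁ i≢k) (j≢k ∘ ≡.sym)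

    ∈-without₁⁻ : ∀ {i u} → u ∈ without₁ i → u ≢ i
    ∈-without₁⁻ {i} u∈ = proj₂ (∈-filter⁻ (λ y → ¬? (y Fin.≟ i)) {xs = allFin n} u∈)

    ∈-without₂⁻ : ∀ {i j u} → u ∈ without₂ i j → u ≢ i × u ≢ j
    ∈-without₂⁻ {i} {j} u∈ =
      let u∈₁ , u≢j = ∈-filter⁻ (λ y → ¬? (y Fin.≟ j)) {xs = without₁ i} u∈ in ∈-without₁⁻ u∈₁ , u≢j

    length-without₁ : ∀ i → suc (length (without₁ i)) ≡ n
    length-without₁ i = ≡.trans (length-remove Fin._≟_ (Unique.allFin⁺ n) (∈-allFin i))
      (length-tabulate {n = n} (λ i → i))

    length-without₂ : ∀ {i j} → i ≢ j → suc (suc (length (without₂ i j))) ≡ n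
    length-without₂ {i} {j} i≢j = ≡.trans
      (≡.cong suc (length-remove Fin._≟_ (without₁! i) (∈-without₁ i≢j))) (length-without₁ i)

    length-others : ∀ {i j k} → i ≢ j → i ≢ k → j ≢ k → suc (suc (suc (length (others i j k)))) ≡ n
    length-others {i} {j} {k} i≢j i≢k j≢k = ≡.trans
      (≡.cong (λ m → suc (suc m)) (length-remove Fin._≟_ (without₂! i j) (∈-without₂ i≢k j≢k)))
      (length-without₂ i≢j)

    sharedEnd-probability : ∀ {i j k l : Fin n} → i ≢ j → k ≢ l → ¬ SamePair (k , l) i j →
      expectation p (λ S → 𝟙 (sharedEnd S (i , j) (k , l))) ≈ shared
    sharedEnd-probability {i} {j} {k} {l} i≢j k≢l kl≠ij = begin
      expectation p (λ S → 𝟙 (adjacent S i j ∧ adjacent S k l))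
        ≈⟨ expectation-cong p (λ S → trans (𝟙-∧ (adjacent S i j) (adjacent S k l))
             (*-congˡ (sym (*-identityʳ (𝟙 (adjacent S k l)))))) ⟩
      expectation p (λ S → present p i j S * (present p k l S * 1#))
        ≈⟨ expectation-present p i≢j (Invariant-* p (Invariant-present p i≢j kl≠ij) (λ _ _ → refl)) ⟩
      p * expectation p (λ S → present p k l S * 1#)
        ≈⟨ *-congˡ (expectation-present p k≢l (λ _ _ → refl)) ⟩
      p * (p * expectation p {length (completeArcs n)} (λ _ → 1#))
        ≈⟨ *-congˡ (*-congˡ (expectation-1 p (length (completeArcs n)))) ⟩
      shared ∎

    disjointEdge-probability : ∀ {i j k l : Fin n} →
      i ≢ j → k ≢ l → i ≢ k → j ≢ l → i ≢ l → j ≢ k →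
      expectation p (λ S → 𝟙 (disjointEdge S i j k l)) ≈ crossing
    disjointEdge-probability {i} {j} {k} {l} i≢j k≢l i≢k j≢l i≢l j≢k = begin
      expectation p (λ S → 𝟙 (disjointEdge S i j k l))
        ≈⟨ expectation-cong p indicator ⟩
      expectation p (λ S → present p i j S * (present p k l S * ((1# - present p i l S * present p k j S) * 1#)))
        ≈⟨ expectation-present p i≢j (Invariant-* p (Invariant-present p i≢j kl≠ij)
             (Invariant-* p (Invariant-1- p (Invariant-* p
               (Invariant-present p i≢j (λ { (inj₁ (_ , l≡j)) → j≢l (≡.sym l≡j) ; (inj₂ (i≡j , _)) → i≢j i≡j }))
               (Invariant-present p i≢j (λ { (inj₁ (k≡i , _)) → i≢k (≡.sym k≡i) ; (inj₂ (k≡j , _)) → j≢k (≡.sym k≡j) }))))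
               (λ _ _ → refl))) ⟩
      p * expectation p (λ S → present p k l S * ((1# - present p i l S * present p k j S) * 1#))
        ≈⟨ *-congˡ (expectation-present p k≢l
             (Invariant-* p (Invariant-1- p (Invariant-* p
               (Invariant-present p k≢l (λ { (inj₁ (i≡k , _)) → i≢k i≡k ; (inj₂ (i≡l , _)) → i≢l i≡l }))
               (Invariant-present p k≢l (λ { (inj₁ (_ , j≡l)) → j≢l j≡l ; (inj₂ (k≡l , _)) → k≢l k≡l }))))
               (λ _ _ → refl))) ⟩
      p * (p * expectation p (λ S → (1# - present p i l S * present p k j S) * 1#))
        ≈⟨ *-congˡ (*-congˡ (expectation-notBoth p i≢l (j≢k ∘ ≡.sym)
             (λ { (inj₁ (k≡i , _)) → i≢k (≡.sym k≡i) ; (inj₂ (k≡l , _)) → k≢l k≡l })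
             (λ _ _ → refl) (λ _ _ → refl))) ⟩
      p * (p * ((1# - p ^ 2) * expectation p {length (completeArcs n)} (λ _ → 1#)))
        ≈⟨ *-congˡ (*-congˡ (*-congˡ (expectation-1 p (length (completeArcs n))))) ⟩
      crossing ∎
      where
      kl≠ij : ¬ SamePair (k , l) i j
      kl≠ij (inj₁ (k≡i , _)) = i≢k (≡.sym k≡i)
      kl≠ij (inj₂ (k≡j , _)) = j≢k (≡.sym k≡j)
      indicator : ∀ S → 𝟙 (disjointEdge S i j k l) ≈
        present p i j S * (present p k l S * ((1# - present p i l S * present p k j S) * 1#))
      indicator S = trans (𝟙-∧ (adjacent S i j) _) (*-congˡ (trans (𝟙-∧ (adjacent S k l) _)
        (*-congˡ (trans (𝟙-not (adjacent S i l ∧ adjacent S k j))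
          (trans (+-congˡ (-‿cong (𝟙-∧ (adjacent S i l) (adjacent S k j)))) (sym (*-identityʳ _)))))))

    -- Every arc of this event lies within {k , i , j} or joins another node to `k` or `j`. These
    -- arcs are pairwise different, so the factors split off in turn.
    pathEdge-probability : ∀ {k i j : Fin n} → k ≢ i → i ≢ j → k ≢ j →
      expectation p (λ S → 𝟙 (pathEdge S k i j)) ≈ path
    pathEdge-probability {k} {i} {j} k≢i i≢j k≢j = begin
      expectation p (λ S → 𝟙 (pathEdge S k i j))
        ≈⟨ expectation-cong p indicator ⟩
      expectation p (λ S → present p k i S * (present p i j S * ((1# - present p k j S) * none S)))
        ≈⟨ expectation-present p k≢i (Invariant-* p (Invariant-present p k≢i ij≠ki)
             (Invariant-* p (Invariant-1- p (Invariant-present p k≢i kj≠ki)) (none-invariant k≢i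
               (λ { u∈ (inj₁ (u≡k , _)) → ≢₁ u∈ u≡k ; u∈ (inj₂ (u≡i , _)) → ≢₂ u∈ u≡i })
               (λ { u∈ (inj₁ (u≡k , _)) → ≢₁ u∈ u≡k ; u∈ (inj₂ (u≡i , _)) → ≢₂ u∈ u≡i })))) ⟩
      p * expectation p (λ S → present p i j S * ((1# - present p k j S) * none S))
        ≈⟨ *-congˡ (expectation-present p i≢j
             (Invariant-* p (Invariant-1- p (Invariant-present p i≢j kj≠ij)) (none-invariant i≢j
               (λ { u∈ (inj₁ (u≡i , _)) → ≢₂ u∈ u≡i ; u∈ (inj₂ (u≡j , _)) → ≢₃ u∈ u≡j })
               (λ { u∈ (inj₁ (u≡i , _)) → ≢₂ u∈ u≡i ; u∈ (inj₂ (u≡j , _)) → ≢₃ u∈ u≡j })))) ⟩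
      p * (p * expectation p (λ S → (1# - present p k j S) * none S))
        ≈⟨ *-congˡ (*-congˡ (expectation-absent p k≢j (none-invariant k≢j
             (λ { u∈ (inj₁ (u≡k , _)) → ≢₁ u∈ u≡k ; u∈ (inj₂ (u≡j , _)) → ≢₃ u∈ u≡j })
             (λ { u∈ (inj₁ (u≡k , _)) → ≢₁ u∈ u≡k ; u∈ (inj₂ (u≡j , _)) → ≢₃ u∈ u≡j })))) ⟩
      p * (p * ((1# - p) * expectation p none))
        ≈⟨ *-congˡ (*-congˡ (*-congˡ (expectation-noCommonNeighbour p k≢j (others k i j) (others! k i j)
             (All.tabulate λ u∈ → ≢₁ u∈ , ≢₃ u∈)))) ⟩
      p * (p * ((1# - p) * (1# - p ^ 2) ^ length (others k i j)))
        -- `length-others` writes `n` as three successors of this length, on which `∸ 3` computes.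
        ≈⟨ *-congˡ (*-congˡ (*-congˡ (reflexive (≡.cong (λ m → (1# - p ^ 2) ^ (m ∸ 3)) (length-others k≢i k≢j i≢j))))) ⟩
      path ∎
      where
      none : Subset (length (completeArcs n)) → Carrier
      none S = ∏ (others k i j) (λ u → 1# - present p u k S * present p u j S)
      ≢₁ : ∀ {u} → u ∈ others k i j → u ≢ k
      ≢₁ u∈ = proj₁ (∈-others⁻ {n} {k} {i} {j} u∈)
      ≢₂ : ∀ {u} → u ∈ others k i j → u ≢ i
      ≢₂ u∈ = proj₁ (proj₂ (∈-others⁻ {n} {k} {i} {j} u∈))
      ≢₃ : ∀ {u} → u ∈ others k i j → u ≢ j
      ≢₃ u∈ = proj₂ (proj₂ (∈-others⁻ {n} {k} {i} {j} u∈))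
      none-invariant : ∀ {v w} (v≢w : v ≢ w) →
        (∀ {u} → u ∈ others k i j → ¬ SamePair (u , k) v w) →
        (∀ {u} → u ∈ others k i j → ¬ SamePair (u , j) v w) →
        Invariant p (arcIndex v≢w) none
      none-invariant v≢w uk≠ uj≠ = Invariant-∏ p (others k i j) λ u∈ → Invariant-1- p
        (Invariant-* p (Invariant-present p v≢w (uk≠ u∈)) (Invariant-present p v≢w (uj≠ u∈)))
      ij≠ki : ¬ SamePair (i , j) k i
      ij≠ki (inj₁ (i≡k , _)) = k≢i (≡.sym i≡k)
      ij≠ki (inj₂ (_ , j≡k)) = k≢j (≡.sym j≡k)
      kj≠ki : ¬ SamePair (k , j) k i
      kj≠ki (inj₁ (_ , j≡i)) = i≢j (≡.sym j≡i)
      kj≠ki (inj₂ (k≡i , _)) = k≢i k≡i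
      kj≠ij : ¬ SamePair (k , j) i j
      kj≠ij (inj₁ (k≡i , _)) = k≢i k≡i
      kj≠ij (inj₂ (k≡j , _)) = k≢j k≡j
      indicator : ∀ S → 𝟙 (pathEdge S k i j) ≈
        present p k i S * (present p i j S * ((1# - present p k j S) * none S))
      indicator S = trans (𝟙-∧ (adjacent S k i) _) (*-congˡ (trans (𝟙-∧ (adjacent S i j) _)
        (*-congˡ (trans (𝟙-∧ (not (adjacent S k j)) _) (*-cong (𝟙-not (adjacent S k j))
          (trans (𝟙-all (notCommonNeighbour S k j) (others k i j))
            (∏-cong (others k i j) λ u → trans (𝟙-not (adjacent S u k ∧ adjacent S u j))
              (+-congˡ (-‿cong (𝟙-∧ (adjacent S u k) (adjacent S u j)))))))))))

    -- Disposes of the degenerate pairs, namely loops and equal or opposite orientations, so that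
    -- all sums may run over the whole of `allFin n`.
    edgeProbability-0 : ∀ {g h} → (∀ S → isEdge S g h ≢ true) → edgeProbability g h ≈ 0#
    edgeProbability-0 {g} {h} ≢true =
      trans (expectation-cong p (λ S → indicator (isEdge S g h) (≢true S)))
        (expectation-0 p (length (completeArcs n)))
      where
      indicator : ∀ b → b ≢ true → 𝟙 b ≈ 0#
      indicator true  b≢true = contradiction ≡.refl b≢true
      indicator false b≢true = refl

    edgeProbability-loopˡ : ∀ {i h} → edgeProbability (i , i) h ≈ 0#
    edgeProbability-loopˡ {i} {h} = edgeProbability-0 {(i , i)} {h} λ S eq →
      Oriented.present-loopless {n} S {i , i}
        (Supporting.g-present (isEdge⇒supporting S (i , i) h eq)) ≡.refl

    edgeProbability-loopʳ : ∀ {g k} → edgeProbability g (k , k) ≈ 0#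
    edgeProbability-loopʳ {g} {k} = edgeProbability-0 {g} {(k , k)} λ S eq →
      Oriented.present-loopless {n} S {k , k}
        (Supporting.h-present (isEdge⇒supporting S g (k , k) eq)) ≡.refl

    edgeProbability-same : ∀ {g} → edgeProbability g g ≈ 0#
    edgeProbability-same {g} = edgeProbability-0 {g} {g} λ S eq →
      Supporting.g≢h (isEdge⇒supporting S g g eq) ≡.refl

    edgeProbability-reverse : ∀ {i j} → i ≢ j → edgeProbability (i , j) (j , i) ≈ 0#
    edgeProbability-reverse {i} {j} i≢j = edgeProbability-0 {i , j} {j , i} λ S → isEdge-reverse S
      where
      isEdge-reverse : ∀ S → isEdge S (i , j) (j , i) ≢ true
      isEdge-reverse S = go (i Fin.≟ j) (j Fin.≟ i) (i Fin.≟ i) (j Fin.≟ j)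
        where
        go : ∀ d₁ d₂ d₃ d₄ → isEdgeBy S i j j i d₁ d₂ d₃ d₄ ≢ true
        go (yes i≡j) _ _ _ = contradiction i≡j i≢j
        go (no _) (yes j≡i) _ _ = contradiction (≡.sym j≡i) i≢j
        go (no _) (no _) (yes _) (yes _) = λ ()
        go (no _) (no _) (no i≢i) _ = contradiction ≡.refl i≢i
        go (no _) (no _) (yes _) (no j≢j) = contradiction ≡.refl j≢j

    edgeProbability-≡ : ∀ {g h} {f : Subset (length (completeArcs n)) → Bool} →
                        (∀ S → isEdge S g h ≡ f S) → edgeProbability g h ≈ expectation p (𝟙 ∘ f)
    edgeProbability-≡ eq = expectation-cong p (λ S → reflexive (≡.cong 𝟙 (eq S)))

    edgeProbability-source : ∀ {i j l} → i ≢ j → i ≢ l → j ≢ l → edgeProbability (i , j) (i , l) ≈ shared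
    edgeProbability-source {i} {j} {l} i≢j i≢l j≢l = trans (edgeProbability-≡ {i , j} {i , l} by-kind)
      (sharedEnd-probability i≢j i≢l
        (λ { (inj₁ (_ , l≡j)) → j≢l (≡.sym l≡j) ; (inj₂ (i≡j , _)) → i≢j i≡j }))
      where
      by-kind : ∀ S → isEdge S (i , j) (i , l) ≡ sharedEnd S (i , j) (i , l)
      by-kind S = go (i Fin.≟ i) (j Fin.≟ l) (i Fin.≟ l) (j Fin.≟ i)
        where
        go : ∀ d₁ d₂ d₃ d₄ → isEdgeBy S i j i l d₁ d₂ d₃ d₄ ≡ sharedEnd S (i , j) (i , l)
        go (yes _) (yes j≡l) _ _ = contradiction j≡l j≢l
        go (yes _) (no _) _ _ = ≡.refl
        go (no i≢i) _ _ _ = contradiction ≡.refl i≢i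

    edgeProbability-target : ∀ {i j k} → i ≢ j → k ≢ j → i ≢ k → edgeProbability (i , j) (k , j) ≈ shared
    edgeProbability-target {i} {j} {k} i≢j k≢j i≢k = trans (edgeProbability-≡ {i , j} {k , j} by-kind)
      (sharedEnd-probability i≢j k≢j
        (λ { (inj₁ (k≡i , _)) → i≢k (≡.sym k≡i) ; (inj₂ (k≡j , _)) → k≢j k≡j }))
      where
      by-kind : ∀ S → isEdge S (i , j) (k , j) ≡ sharedEnd S (i , j) (k , j)
      by-kind S = go (i Fin.≟ k) (j Fin.≟ j) (i Fin.≟ j) (j Fin.≟ k)
        where
        go : ∀ d₁ d₂ d₃ d₄ → isEdgeBy S i j k j d₁ d₂ d₃ d₄ ≡ sharedEnd S (i , j) (k , j)
        go (yes i≡k) _ _ _ = contradiction i≡k i≢k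
        go (no _) (yes _) _ _ = ≡.refl
        go (no _) (no j≢j) _ _ = contradiction ≡.refl j≢j

    edgeProbability-into : ∀ {i j k} → k ≢ i → i ≢ j → k ≢ j → edgeProbability (i , j) (k , i) ≈ path
    edgeProbability-into {i} {j} {k} k≢i i≢j k≢j =
      trans (edgeProbability-≡ {i , j} {k , i} by-kind) (pathEdge-probability k≢i i≢j k≢j)
      where
      by-kind : ∀ S → isEdge S (i , j) (k , i) ≡ pathEdge S k i j
      by-kind S = go (i Fin.≟ k) (j Fin.≟ i) (i Fin.≟ i) (j Fin.≟ k)
        where
        go : ∀ d₁ d₂ d₃ d₄ → isEdgeBy S i j k i d₁ d₂ d₃ d₄ ≡ pathEdge S k i j
        go (yes i≡k) _ _ _ = contradiction (≡.sym i≡k) k≢i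
        go (no _) (yes j≡i) _ _ = contradiction (≡.sym j≡i) i≢j
        go (no _) (no _) (no i≢i) _ = contradiction ≡.refl i≢i
        go (no _) (no _) (yes _) (yes j≡k) = contradiction (≡.sym j≡k) k≢j
        go (no _) (no _) (yes _) (no _) = ≡.refl

    edgeProbability-out : ∀ {i j l} → i ≢ j → j ≢ l → i ≢ l → edgeProbability (i , j) (j , l) ≈ path
    edgeProbability-out {i} {j} {l} i≢j j≢l i≢l =
      trans (edgeProbability-≡ {i , j} {j , l} by-kind) (pathEdge-probability i≢j j≢l i≢l)
      where
      by-kind : ∀ S → isEdge S (i , j) (j , l) ≡ pathEdge S i j l
      by-kind S = go (i Fin.≟ j) (j Fin.≟ l) (i Fin.≟ l) (j Fin.≟ j)
        where
        go : ∀ d₁ d₂ d₃ d₄ → isEdgeBy S i j j l d₁ d₂ d₃ d₄ ≡ pathEdge S i j l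
        go (yes i≡j) _ _ _ = contradiction i≡j i≢j
        go (no _) (yes j≡l) _ _ = contradiction j≡l j≢l
        go (no _) (no _) (yes i≡l) _ = contradiction i≡l i≢l
        go (no _) (no _) (no _) (yes _) = ≡.refl
        go (no _) (no _) (no _) (no j≢j) = contradiction ≡.refl j≢j

    edgeProbability-disjoint : ∀ {i j k l} → i ≢ j → k ≢ l → i ≢ k → j ≢ l → i ≢ l → j ≢ k →
                               edgeProbability (i , j) (k , l) ≈ crossing
    edgeProbability-disjoint {i} {j} {k} {l} i≢j k≢l i≢k j≢l i≢l j≢k =
      trans (edgeProbability-≡ {i , j} {k , l} by-kind)
        (disjointEdge-probability i≢j k≢l i≢k j≢l i≢l j≢k)
      where
      by-kind : ∀ S → isEdge S (i , j) (k , l) ≡ disjointEdge S i j k l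
      by-kind S = go (i Fin.≟ k) (j Fin.≟ l) (i Fin.≟ l) (j Fin.≟ k)
        where
        go : ∀ d₁ d₂ d₃ d₄ → isEdgeBy S i j k l d₁ d₂ d₃ d₄ ≡ disjointEdge S i j k l
        go (yes i≡k) _ _ _ = contradiction i≡k i≢k
        go (no _) (yes j≡l) _ _ = contradiction j≡l j≢l
        go (no _) (no _) (yes i≡l) _ = contradiction i≡l i≢l
        go (no _) (no _) (no _) (yes j≡k) = contradiction j≡k j≢k
        go (no _) (no _) (no _) (no _) = ≡.refl

    private
      N : Carrier
      N = fromℕ n

    -- Lengths become polynomials in `N` by subtraction in the field. The removed nodes exist, so
    -- nothing is truncated.
    fromℕ-pred : ∀ {l m} → suc l ≡ m → fromℕ l ≈ fromℕ m - 1#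
    fromℕ-pred {l} ≡.refl = solve 1 (λ x → x := :1 :+ x :- :1) refl (fromℕ l)

    fromℕ-pred₂ : ∀ {l m} → suc (suc l) ≡ m → fromℕ l ≈ fromℕ m - 1# - 1#
    fromℕ-pred₂ {l} ≡.refl = solve 1 (λ x → x := :1 :+ (:1 :+ x) :- :1 :- :1) refl (fromℕ l)

    fromℕ-pred₃ : ∀ {l m} → suc (suc (suc l)) ≡ m → fromℕ l ≈ fromℕ m - 1# - 1# - 1#
    fromℕ-pred₃ {l} ≡.refl =
      solve 1 (λ x → x := :1 :+ (:1 :+ (:1 :+ x)) :- :1 :- :1 :- :1) refl (fromℕ l)

    ∑-without₁ : ∀ i {f y} → f i ≈ 0# → (∀ {u} → u ≢ i → f u ≈ y) →
                 ∑ (allFin n) f ≈ (N - 1#) * y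
    ∑-without₁ i {f} {y} fi≈0 f≈y = begin
      ∑ (allFin n) f
        ≈⟨ ∑-remove Fin._≟_ (Unique.allFin⁺ n) (∈-allFin i) f ⟩
      f i + ∑ (without₁ i) f
        ≈⟨ +-cong fi≈0 (∑-const (without₁ i) (λ u∈ → f≈y (∈-without₁⁻ u∈))) ⟩
      0# + fromℕ (length (without₁ i)) * y
        ≈⟨ trans (+-identityˡ _) (*-congʳ (fromℕ-pred (length-without₁ i))) ⟩
      (N - 1#) * y ∎

    ∑-without₂ : ∀ {i j} → i ≢ j → ∀ {f y} → (∀ {u} → u ≢ i → u ≢ j → f u ≈ y) →
                 ∑ (allFin n) f ≈ f i + (f j + (N - 1# - 1#) * y)
    ∑-without₂ {i} {j} i≢j {f} {y} f≈y = begin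
      ∑ (allFin n) f
        ≈⟨ ∑-remove Fin._≟_ (Unique.allFin⁺ n) (∈-allFin i) f ⟩
      f i + ∑ (without₁ i) f
        ≈⟨ +-congˡ (∑-remove Fin._≟_ (without₁! i) (∈-without₁ i≢j) f) ⟩
      f i + (f j + ∑ (without₂ i j) f)
        ≈⟨ +-congˡ (+-congˡ (∑-const (without₂ i j) (λ u∈ →
             f≈y (proj₁ (∈-without₂⁻ u∈)) (proj₂ (∈-without₂⁻ u∈))))) ⟩
      f i + (f j + fromℕ (length (without₂ i j)) * y)
        ≈⟨ +-congˡ (+-congˡ (*-congʳ (fromℕ-pred₂ (length-without₂ i≢j)))) ⟩
      f i + (f j + (N - 1# - 1#) * y) ∎

    ∑-others : ∀ {i j k} → i ≢ j → i ≢ k → j ≢ k → ∀ {f y} →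
               (∀ {u} → u ≢ i → u ≢ j → u ≢ k → f u ≈ y) →
               ∑ (allFin n) f ≈ f i + (f j + (f k + (N - 1# - 1# - 1#) * y))
    ∑-others {i} {j} {k} i≢j i≢k j≢k {f} {y} f≈y = begin
      ∑ (allFin n) f
        ≈⟨ ∑-remove Fin._≟_ (Unique.allFin⁺ n) (∈-allFin i) f ⟩
      f i + ∑ (without₁ i) f
        ≈⟨ +-congˡ (∑-remove Fin._≟_ (without₁! i) (∈-without₁ i≢j) f) ⟩
      f i + (f j + ∑ (without₂ i j) f)
        ≈⟨ +-congˡ (+-congˡ (∑-remove Fin._≟_ (without₂! i j) (∈-without₂ i≢k j≢k) f)) ⟩
      f i + (f j + (f k + ∑ (others i j k) f))
        ≈⟨ +-congˡ (+-congˡ (+-congˡ (∑-const (others i j k) λ u∈ →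
             let ≢i , ≢j , ≢k = ∈-others⁻ {n} {i} {j} {k} u∈ in f≈y ≢i ≢j ≢k))) ⟩
      f i + (f j + (f k + fromℕ (length (others i j k)) * y))
        ≈⟨ +-congˡ (+-congˡ (+-congˡ (*-congʳ (fromℕ-pred₃ (length-others i≢j i≢k j≢k))))) ⟩
      f i + (f j + (f k + (N - 1# - 1# - 1#) * y)) ∎

    module _ {i j : Fin n} (i≢j : i ≢ j) where

      -- With `(i , j)` fixed, `k` decides which kinds occur: `i` gives common sources, `j` gives
      -- paths onwards, and any other `k` gives one path, one common target and otherwise disjoint
      -- arcs, up to terms of probability 0.
      row : Fin n → Carrier
      row k = ∑ (allFin n) (λ l → edgeProbability (i , j) (k , l))

      row-i : row i ≈ (N - 1# - 1#) * shared
      row-i = begin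
        row i
          ≈⟨ ∑-without₂ i≢j (λ u≢i u≢j →
               edgeProbability-source i≢j (u≢i ∘ ≡.sym) (u≢j ∘ ≡.sym)) ⟩
        edgeProbability (i , j) (i , i) + (edgeProbability (i , j) (i , j) + (N - 1# - 1#) * shared)
          ≈⟨ +-cong (edgeProbability-loopʳ {i , j} {i}) (+-congʳ (edgeProbability-same {i , j})) ⟩
        0# + (0# + (N - 1# - 1#) * shared)
          ≈⟨ trans (+-identityˡ _) (+-identityˡ _) ⟩
        (N - 1# - 1#) * shared ∎

      row-j : row j ≈ (N - 1# - 1#) * path
      row-j = begin
        row j
          ≈⟨ ∑-without₂ i≢j (λ u≢i u≢j →
               edgeProbability-out i≢j (u≢j ∘ ≡.sym) (u≢i ∘ ≡.sym)) ⟩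
        edgeProbability (i , j) (j , i) + (edgeProbability (i , j) (j , j) + (N - 1# - 1#) * path)
          ≈⟨ +-cong (edgeProbability-reverse i≢j) (+-congʳ (edgeProbability-loopʳ {i , j} {j})) ⟩
        0# + (0# + (N - 1# - 1#) * path)
          ≈⟨ trans (+-identityˡ _) (+-identityˡ _) ⟩
        (N - 1# - 1#) * path ∎

      row-other : ∀ {k} → k ≢ i → k ≢ j → row k ≈ path + (shared + (N - 1# - 1# - 1#) * crossing)
      row-other {k} k≢i k≢j = begin
        row k
          ≈⟨ ∑-others i≢j (k≢i ∘ ≡.sym) (k≢j ∘ ≡.sym) (λ u≢i u≢j u≢k →
               edgeProbability-disjoint i≢j (u≢k ∘ ≡.sym) (k≢i ∘ ≡.sym) (u≢j ∘ ≡.sym)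
                 (u≢i ∘ ≡.sym) (k≢j ∘ ≡.sym)) ⟩
        edgeProbability (i , j) (k , i) + (edgeProbability (i , j) (k , j) +
          (edgeProbability (i , j) (k , k) + (N - 1# - 1# - 1#) * crossing))
          ≈⟨ +-cong (edgeProbability-into k≢i i≢j k≢j)
               (+-cong (edgeProbability-target i≢j k≢j (k≢i ∘ ≡.sym))
                 (trans (+-congʳ (edgeProbability-loopʳ {i , j} {k})) (+-identityˡ _))) ⟩
        path + (shared + (N - 1# - 1# - 1#) * crossing) ∎

      ∑-row : ∑ (allFin n) row ≈
              (N - 1# - 1#) * ((shared + path) + (shared + path) + (N - 1# - 1# - 1#) * crossing)
      ∑-row = begin
        ∑ (allFin n) row
          ≈⟨ ∑-without₂ i≢j row-other ⟩
        row i + (row j + (N - 1# - 1#) * (path + (shared + (N - 1# - 1# - 1#) * crossing)))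
          ≈⟨ +-cong row-i (+-congʳ row-j) ⟩
        M * shared + (M * path + M * (path + (shared + R)))
          ≈⟨ solve 4 (λ M s t R → M :* s :+ (M :* t :+ M :* (t :+ (s :+ R)))
               := M :* ((s :+ t) :+ (s :+ t) :+ R)) refl M shared path R ⟩
        M * ((shared + path) + (shared + path) + R) ∎
        where
        M R : Carrier
        M = N - 1# - 1#
        R = (N - 1# - 1# - 1#) * crossing

    ∑-edgeProbability :
      ∑ (allFin n) (λ i → ∑ (allFin n) (λ j → ∑ (allFin n) (λ k → ∑ (allFin n) (λ l →
        edgeProbability (i , j) (k , l))))) ≈
      N * ((N - 1#) * ((N - 1# - 1#) *
        ((shared + path) + (shared + path) + (N - 1# - 1# - 1#) * crossing)))
    ∑-edgeProbability = trans
      (∑-const (allFin n) (λ {i} _ → ∑-without₁ i (diagonal i) (λ u≢i → ∑-row (u≢i ∘ ≡.sym))))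
      (*-congʳ (reflexive (≡.cong fromℕ (length-tabulate {n = n} (λ i → i)))))
      where
      zeros : ∀ {f : Fin n → Carrier} → (∀ u → f u ≈ 0#) → ∑ (allFin n) f ≈ 0#
      zeros f≈0 = trans (∑-const (allFin n) (λ {u} _ → f≈0 u)) (zeroʳ _)
      diagonal : ∀ i → ∑ (allFin n) (λ k → ∑ (allFin n) (λ l → edgeProbability (i , i) (k , l))) ≈ 0#
      diagonal i = zeros (λ k → zeros (λ l → edgeProbability-loopˡ {i} {k , l}))

-- Binomial coefficients and the exact formula

-- The identity (k + 1) C(n, k + 1) = (n - k) C(n, k) with the subtraction moved to the other side,
-- so that it is meaningful in ℕ for k > n too.
C-step : ∀ n k → suc k *ₙ (n C suc k) ℕ.+ k *ₙ (n C k) ≡ n *ₙ (n C k)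
C-step zero    zero    = ≡.refl
C-step zero    (suc k) = ≡.cong₂ ℕ._+_ (ℕ.*-zeroʳ k) (ℕ.*-zeroʳ k)
C-step (suc n) zero    = ≡.trans (ℕ.+-identityʳ _) (≡.trans (ℕ.*-identityˡ _)
  (≡.trans (nC1≡n (suc n)) (≡.sym (ℕ.*-identityʳ (suc n)))))
C-step (suc n) (suc k) = begin
  suc (suc k) *ₙ (suc n C suc (suc k)) ℕ.+ suc k *ₙ (suc n C suc k)
    ≡⟨ ≡.cong₂ (λ x y → suc (suc k) *ₙ x ℕ.+ suc k *ₙ y)
         (nCk+nC[k+1]≡[n+1]C[k+1] n (suc k)) (nCk+nC[k+1]≡[n+1]C[k+1] n k) ⟨
  suc (suc k) *ₙ (c₁ ℕ.+ c₂) ℕ.+ suc k *ₙ (c₀ ℕ.+ c₁)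
    -- Regrouped so that the induction hypotheses for `suc k` and `k` appear as summands.
    ≡⟨ solve 4 (λ k a b c →
         (con 2 :+ k) :* (b :+ c) :+ (con 1 :+ k) :* (a :+ b) :=
         ((con 2 :+ k) :* c :+ (con 1 :+ k) :* b) :+ ((con 1 :+ k) :* b :+ k :* a) :+ (a :+ b))
         ≡.refl k c₀ c₁ c₂ ⟩
  (suc (suc k) *ₙ c₂ ℕ.+ suc k *ₙ c₁) ℕ.+ (suc k *ₙ c₁ ℕ.+ k *ₙ c₀) ℕ.+ (c₀ ℕ.+ c₁)
    ≡⟨ ≡.cong₂ (λ x y → x ℕ.+ y ℕ.+ (c₀ ℕ.+ c₁)) (C-step n (suc k)) (C-step n k) ⟩
  n *ₙ c₁ ℕ.+ n *ₙ c₀ ℕ.+ (c₀ ℕ.+ c₁)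
    ≡⟨ solve 3 (λ n a b → n :* b :+ n :* a :+ (a :+ b) := (con 1 :+ n) :* (a :+ b)) ≡.refl n c₀ c₁ ⟩
  suc n *ₙ (c₀ ℕ.+ c₁)
    ≡⟨ ≡.cong (suc n *ₙ_) (nCk+nC[k+1]≡[n+1]C[k+1] n k) ⟩
  suc n *ₙ (suc n C suc k) ∎
  where
  open ≡.≡-Reasoning
  open ℕSolver.+-*-Solver
  c₀ c₁ c₂ : ℕ
  c₀ = n C k
  c₁ = n C suc k
  c₂ = n C suc (suc k)

module ExpectedEdgeCount {c ℓ₁ ℓ₂ : Level} (ℝ : Reals c ℓ₁ ℓ₂) where

  open Theory ℝ hiding (zero)
  open OrderedField ℝ
  open OrderProperties ℝ
  open Adjacency
  open Expectation ℝ
  open EdgeCriterion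
  open UnorderedPairs
  open EdgeExpectation ℝ
  open SetoidReasoning setoid

  module _ (n : ℕ) where

    private
      N c₁ c₂ c₃ c₄ : Carrier
      N  = fromℕ n
      c₁ = fromℕ (n C 1)
      c₂ = fromℕ (n C 2)
      c₃ = fromℕ (n C 3)
      c₄ = fromℕ (n C 4)

    fromℕ-C-step : ∀ k → fromℕ (suc k) * fromℕ (n C suc k) ≈ (N - fromℕ k) * fromℕ (n C k)
    fromℕ-C-step k = begin
      fromℕ (suc k) * fromℕ (n C suc k)
        ≈⟨ solve 3 (λ x y z → x := x :+ y :* z :- y :* z) refl _ (fromℕ k) (fromℕ (n C k)) ⟩
      fromℕ (suc k) * fromℕ (n C suc k) + fromℕ k * fromℕ (n C k) - fromℕ k * fromℕ (n C k)
        ≈⟨ +-congʳ (trans (fromℕ-+ (suc k *ₙ (n C suc k)) (k *ₙ (n C k)))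
             (+-cong (fromℕ-* (suc k) (n C suc k)) (fromℕ-* k (n C k)))) ⟨
      fromℕ (suc k *ₙ (n C suc k) ℕ.+ k *ₙ (n C k)) - fromℕ k * fromℕ (n C k)
        ≈⟨ +-congʳ (trans (reflexive (≡.cong fromℕ (C-step n k))) (fromℕ-* n (n C k))) ⟩
      N * fromℕ (n C k) - fromℕ k * fromℕ (n C k)
        ≈⟨ solve 3 (λ N k y → N :* y :- k :* y := (N :- k) :* y) refl N (fromℕ k) (fromℕ (n C k)) ⟩
      (N - fromℕ k) * fromℕ (n C k) ∎

    falling₃ : Carrier
    falling₃ = N * (N - 1#) * (N - 1# - 1#)

    6C₃ : fromℕ (6 *ₙ (n C 3)) ≈ falling₃
    6C₃ = begin
      fromℕ (6 *ₙ (n C 3))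
        ≈⟨ fromℕ-* 6 (n C 3) ⟩
      fromℕ 6 * c₃
        ≈⟨ solve 1 (λ x → :fromℕ 6 :* x := :fromℕ 2 :* (:fromℕ 3 :* x)) refl c₃ ⟩
      fromℕ 2 * (fromℕ 3 * c₃)
        ≈⟨ *-congˡ (fromℕ-C-step 2) ⟩
      fromℕ 2 * ((N - fromℕ 2) * c₂)
        ≈⟨ solve 2 (λ N x → :fromℕ 2 :* ((N :- :fromℕ 2) :* x) := (N :- :fromℕ 2) :* (:fromℕ 2 :* x)) refl N c₂ ⟩
      (N - fromℕ 2) * (fromℕ 2 * c₂)
        ≈⟨ *-congˡ (fromℕ-C-step 1) ⟩
      (N - fromℕ 2) * ((N - fromℕ 1) * c₁)
        ≈⟨ *-congˡ (*-congˡ (reflexive (≡.cong fromℕ (nC1≡n n)))) ⟩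
      (N - fromℕ 2) * ((N - fromℕ 1) * N)
        ≈⟨ solve 1 (λ N → (N :- :fromℕ 2) :* ((N :- :fromℕ 1) :* N)
             := N :* (N :- :1) :* (N :- :1 :- :1)) refl N ⟩
      falling₃ ∎

    -- 24 C(n, 4) is a falling factorial, whereas the coefficient 12 alone would leave a factor 1/2.
    12C₄ : fromℕ (12 *ₙ (n C 4)) + fromℕ (12 *ₙ (n C 4)) ≈ falling₃ * (N - 1# - 1# - 1#)
    12C₄ = begin
      fromℕ (12 *ₙ (n C 4)) + fromℕ (12 *ₙ (n C 4))
        ≈⟨ +-cong (fromℕ-* 12 (n C 4)) (fromℕ-* 12 (n C 4)) ⟩
      fromℕ 12 * c₄ + fromℕ 12 * c₄
        ≈⟨ solve 1 (λ x → :fromℕ 12 :* x :+ :fromℕ 12 :* x := :fromℕ 6 :* (:fromℕ 4 :* x)) refl c₄ ⟩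
      fromℕ 6 * (fromℕ 4 * c₄)
        ≈⟨ *-congˡ (fromℕ-C-step 3) ⟩
      fromℕ 6 * ((N - fromℕ 3) * c₃)
        ≈⟨ solve 2 (λ N x → :fromℕ 6 :* ((N :- :fromℕ 3) :* x)
             := :fromℕ 6 :* x :* (N :- :1 :- :1 :- :1)) refl N c₃ ⟩
      fromℕ 6 * c₃ * (N - 1# - 1# - 1#)
        ≈⟨ *-congʳ (trans (sym (fromℕ-* 6 (n C 3))) 6C₃) ⟩
      falling₃ * (N - 1# - 1# - 1#) ∎

    edgeProbability-sym : ∀ p (g h : Orientation n) → edgeProbability p g h ≈ edgeProbability p h g
    edgeProbability-sym p g h = expectation-cong p λ S → reflexive (≡.cong 𝟙
      (Bool.⇔→≡ (mk⇔ (EdgeCount.isEdge-swap ℝ (graph S) g h) (EdgeCount.isEdge-swap ℝ (graph S) h g))))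

    doubled-expectation : ∀ p → let EK = 𝔼 p (EdgeCount.edgeCount ℝ {n}) in
      EK + EK ≈ falling₃ * ((shared p {n} + path p {n}) + (shared p {n} + path p {n}) +
                            (N - 1# - 1# - 1#) * crossing p {n})
    doubled-expectation p = begin
      EK + EK
        ≈⟨ +-cong EK≈ EK≈ ⟩
      ∑ (pairs os) (λ (g , h) → edgeProbability p g h) + ∑ (pairs os) (λ (g , h) → edgeProbability p g h)
        ≈⟨ ∑-pairs os (edgeProbability p) (edgeProbability-sym p) (λ g → edgeProbability-same p {n} {g}) ⟩
      ∑ os (λ g → ∑ os (edgeProbability p g))
        ≈⟨ ∑-cartesianProduct (allFin n) (allFin n) (λ g → ∑ os (edgeProbability p g)) ⟩
      ∑ (allFin n) (λ i → ∑ (allFin n) (λ j → ∑ os (edgeProbability p (i , j))))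
        ≈⟨ ∑-cong (allFin n) (λ {i} _ → ∑-cong (allFin n) (λ {j} _ →
             ∑-cartesianProduct (allFin n) (allFin n) (edgeProbability p (i , j)))) ⟩
      ∑ (allFin n) (λ i → ∑ (allFin n) (λ j → ∑ (allFin n) (λ k → ∑ (allFin n) (λ l →
        edgeProbability p (i , j) (k , l)))))
        ≈⟨ ∑-edgeProbability p {n} ⟩
      N * ((N - 1#) * ((N - 1# - 1#) * total))
        ≈⟨ solve 4 (λ a b c d → a :* (b :* (c :* d)) := a :* b :* c :* d) refl
             N (N - 1#) (N - 1# - 1#) total ⟩
      falling₃ * total ∎
      where
      EK total : Carrier
      EK = 𝔼 p (EdgeCount.edgeCount ℝ {n})
      total = (shared p {n} + path p {n}) + (shared p {n} + path p {n}) +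
              (N - 1# - 1# - 1#) * crossing p {n}
      os : List (Orientation n)
      os = cartesianProduct (allFin n) (allFin n)
      EK≈ : EK ≈ ∑ (pairs os) (λ (g , h) → edgeProbability p g h)
      EK≈ = trans
        (expectation-cong p (λ S → fromℕ-length-filter (λ (g , h) → isEdge S g h) (pairs os)))
        (expectation-∑ p (pairs os) (λ (g , h) S → 𝟙 (isEdge S g h)))

    -- Compared after doubling, where the left side is a sum over all ordered pairs and the
    -- coefficients are falling factorials; then 2 is cancelled.
    expectedEdgeCount : ∀ p → 𝔼 p (EdgeCount.edgeCount ℝ {n}) ≈
      fromℕ (12 *ₙ (n C 4)) * p ^ 2 * (1# - p ^ 2)
      + fromℕ (6 *ₙ (n C 3)) * p ^ 2 * (1# + (1# - p) * (1# - p ^ 2) ^ (n ∸ 3))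
    expectedEdgeCount p = x+x≈y+y⇒x≈y (begin
      EK + EK
        ≈⟨ doubled-expectation p ⟩
      falling₃ * ((shared p {n} + path p {n}) + (shared p {n} + path p {n}) + L * crossing p {n})
        ≈⟨ solve 4 (λ D L p R →
             D :* ((p :* (p :* :1) :+ p :* (p :* ((:1 :- p) :* R))) :+
                   (p :* (p :* :1) :+ p :* (p :* ((:1 :- p) :* R))) :+
                   L :* (p :* (p :* ((:1 :- p :^ 2) :* :1)))) :=
             D :* L :* (p :^ 2 :* (:1 :- p :^ 2)) :+
             (D :* (p :^ 2 :* (:1 :+ (:1 :- p) :* R)) :+ D :* (p :^ 2 :* (:1 :+ (:1 :- p) :* R))))
             refl falling₃ L p R ⟩
      falling₃ * L * S + (falling₃ * T + falling₃ * T)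
        ≈⟨ +-cong (*-congʳ 12C₄) (+-cong (*-congʳ 6C₃) (*-congʳ 6C₃)) ⟨
      (X + X) * S + (Y * T + Y * T)
        ≈⟨ solve 4 (λ X Y S T → (X :+ X) :* S :+ (Y :* T :+ Y :* T)
             := (X :* S :+ Y :* T) :+ (X :* S :+ Y :* T)) refl X Y S T ⟩
      (X * S + Y * T) + (X * S + Y * T)
        ≈⟨ +-cong assoc assoc ⟨
      formula + formula ∎)
      where
      EK L R X Y S T formula : Carrier
      EK = 𝔼 p (EdgeCount.edgeCount ℝ {n})
      L = N - 1# - 1# - 1#
      R = (1# - p ^ 2) ^ (n ∸ 3)
      X = fromℕ (12 *ₙ (n C 4))
      Y = fromℕ (6 *ₙ (n C 3))
      S = p ^ 2 * (1# - p ^ 2)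
      T = p ^ 2 * (1# + (1# - p) * R)
      formula = X * p ^ 2 * (1# - p ^ 2) + Y * p ^ 2 * (1# + (1# - p) * R)
      assoc : formula ≈ X * S + Y * T
      assoc = +-cong (*-assoc X (p ^ 2) (1# - p ^ 2)) (*-assoc Y (p ^ 2) (1# + (1# - p) * R))

-- Asymptotic relations from inequalities between products

module Ratios {c ℓ₁ ℓ₂ : Level} (ℝ : Reals c ℓ₁ ℓ₂) where

  open Theory ℝ hiding (zero)
  open OrderedField ℝ
  open OrderProperties ℝ
  open ≤-Reasoning

  module _ {x y : Carrier} (y#0 : y # 0#) (0≤x : 0# ≤ x) (0<y : 0# < y) where

    ratio-≤ : ∀ {M} → x ≤ M * y → ∣ divide x y y#0 ∣ ≤ M
    ratio-≤ {M} x≤My = *-cancelʳ-≤ 0<y (begin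
      ∣ divide x y y#0 ∣ * y  ≈⟨ ∣divide∣*≈ y#0 0≤x 0<y ⟩
      x                       ≤⟨ x≤My ⟩
      M * y                   ∎)

    ratio-≥ : ∀ {M} → M * y ≤ x → M ≤ ∣ divide x y y#0 ∣
    ratio-≥ {M} My≤x = *-cancelʳ-≤ 0<y (begin
      M * y                   ≤⟨ My≤x ⟩
      x                       ≈⟨ ∣divide∣*≈ y#0 0≤x 0<y ⟨
      ∣ divide x y y#0 ∣ * y  ∎)

    ratio-≤⁻ : ∀ {M} → ∣ divide x y y#0 ∣ ≤ M → x ≤ M * y
    ratio-≤⁻ {M} ratio≤M = begin
      x                       ≈⟨ ∣divide∣*≈ y#0 0≤x 0<y ⟨
      ∣ divide x y y#0 ∣ * y  ≤⟨ *-monoʳ-≤ (<⇒≤ 0<y) ratio≤M ⟩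
      M * y                   ∎

    ratio-≥⁻ : ∀ {M} → M ≤ ∣ divide x y y#0 ∣ → M * y ≤ x
    ratio-≥⁻ {M} M≤ratio = begin
      M * y                   ≤⟨ *-monoʳ-≤ (<⇒≤ 0<y) M≤ratio ⟩
      ∣ divide x y y#0 ∣ * y  ≈⟨ ∣divide∣*≈ y#0 0≤x 0<y ⟩
      x                       ∎

  reciprocal : ∀ x → 0# < x → Σ[ y ∈ Carrier ] 0# < y × y * x ≈ 1#
  reciprocal x 0<x = y , ≤∧#⇒< 0≤y (#-sym y#0) , yx≈1
    where
    x#0 : x # 0#
    x#0 = #-sym (<⇒# 0<x)
    y : Carrier
    y = divide 1# x x#0
    yx≈1 : y * x ≈ 1#
    yx≈1 = divide-* 1# x x#0
    0≤y : 0# ≤ y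
    0≤y = divide-nonneg x#0 (<⇒≤ 0<1) 0<x
    y#0 : y # 0#
    y#0 = x*y#0⇒x#0 (#-congʳ (sym yx≈1) 1#0)

  -- Both bounds are stated as products, so the estimates stay free of division; the lower constant
  -- of the ratio is the reciprocal of `B`.
  ≃-bounds : ∀ {a b : Sequence} {B D} → 0# < B →
             Eventually (λ n → 0# ≤ a n × 0# < b n × b n ≤ B * a n × a n ≤ D * b n) → a ≃ b
  ≃-bounds {a} {b} {B} {D} 0<B (n₀ , bounds) =
    (δ , 0<δ , n₀ , λ n n₀≤n → let 0≤a , 0<b , b≤Ba , _ = bounds n n₀≤n in
       #-sym (<⇒# 0<b) , ratio-≥ _ 0≤a 0<b (begin
         δ * b n        ≤⟨ *-monoˡ-≤ (<⇒≤ 0<δ) b≤Ba ⟩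
         δ * (B * a n)  ≈⟨ solve 3 (λ x y z → x :* (y :* z) := (x :* y) :* z) refl δ B (a n) ⟩
         (δ * B) * a n  ≈⟨ trans (*-congʳ δB≈1) (*-identityˡ (a n)) ⟩
         a n            ∎)) ,
    (D , n₀ , λ n n₀≤n → let 0≤a , 0<b , _ , a≤Db = bounds n n₀≤n in
       #-sym (<⇒# 0<b) , ratio-≤ _ 0≤a 0<b a≤Db)
    where
    δ : Carrier
    δ = proj₁ (reciprocal B 0<B)
    0<δ : 0# < δ
    0<δ = proj₁ (proj₂ (reciprocal B 0<B))
    δB≈1 : δ * B ≈ 1#
    δB≈1 = proj₂ (proj₂ (reciprocal B 0<B))

  n⁻¹-positive : ∀ n → 1 ℕ.≤ n → 0# < n⁻¹ n
  n⁻¹-positive (suc n) _ = proj₁ (proj₂ (reciprocal (fromℕ (suc n)) (0<fromℕ-suc n)))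

  n⁻¹-inverse : ∀ n → 1 ℕ.≤ n → n⁻¹ n * fromℕ n ≈ 1#
  n⁻¹-inverse (suc n) _ = divide-* 1# (fromℕ (suc n)) (#-sym (<⇒# (0<fromℕ-suc n)))

-- Pointwise estimates for a single n

module Asymptotics {ℓ₀ ℓ₁ ℓ₂ : Level} (ℝ : Reals ℓ₀ ℓ₁ ℓ₂) where

  open Theory ℝ hiding (zero)
  open OrderedField ℝ
  open OrderProperties ℝ
  open ≤-Reasoning

  module Estimates {N p : Carrier} (1≤N : 1# ≤ N) (0<p : 0# < p) (p<1 : p < 1#) where

    private
      q S F H A : Carrier
      q = 1# - p
      S = p ^ 2
      F = N ^ 4 * p ^ 2 * (1# - p)
      H = N ^ 3 * p ^ 2
      A = F + H

    0<N : 0# < N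
    0<N = <-≤-trans 0<1 1≤N

    0<q : 0# < 1# - p
    0<q = <-difference p<1

    0<F : 0# < F
    0<F = *-positive (*-positive (^-positive 4 0<N) (^-positive 2 0<p)) 0<q

    0<H : 0# < H
    0<H = *-positive (^-positive 3 0<N) (^-positive 2 0<p)

    0<A : 0# < A
    0<A = <-≤-trans 0<F (≤-trans (≤-reflexive (sym (+-identityʳ F))) (+-monoʳ-≤ F (<⇒≤ 0<H)))

    F≤A : F ≤ A
    F≤A = ≤-trans (≤-reflexive (sym (+-identityʳ F))) (+-monoʳ-≤ F (<⇒≤ 0<H))

    H≤A : H ≤ A
    H≤A = ≤-trans (≤-reflexive (sym (+-identityˡ H))) (+-monoˡ-≤ H (<⇒≤ 0<F))

    -- The ratio of the two terms of `A` is `q * N`, the quantity on which the case distinction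
    -- depends.
    F≈ : F ≈ q * N * H
    F≈ = solve 2 (λ N p → N :^ 4 :* p :^ 2 :* (:1 :- p) := (:1 :- p) :* N :* (N :^ 3 :* p :^ 2)) refl N p

    A≤2H : q * N ≤ 1# → A ≤ fromℕ 2 * H
    A≤2H qN≤1 = begin
      F + H           ≈⟨ +-congʳ F≈ ⟩
      q * N * H + H   ≤⟨ +-monoˡ-≤ H (*-monoʳ-≤ (<⇒≤ 0<H) qN≤1) ⟩
      1# * H + H      ≈⟨ solve 1 (λ H → :1 :* H :+ H := :fromℕ 2 :* H) refl H ⟩
      fromℕ 2 * H     ∎

    -- `B` is the reciprocal of `δ`, so `H = B δ H` is at most `B (q N) H = B F`.
    A≤F : ∀ {δ B} → 0# ≤ B → B * δ ≈ 1# → δ ≤ q * N → A ≤ (1# + B) * F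
    A≤F {δ} {B} 0≤B Bδ≈1 δ≤qN = begin
      F + H                  ≈⟨ +-congˡ (trans (*-congʳ Bδ≈1) (*-identityˡ H)) ⟨
      F + B * δ * H          ≤⟨ +-monoʳ-≤ F (*-monoʳ-≤ (<⇒≤ 0<H) (*-monoˡ-≤ 0≤B δ≤qN)) ⟩
      F + B * (q * N) * H    ≈⟨ +-congˡ (solve 4 (λ B q N H → B :* (q :* N) :* H := B :* (q :* N :* H)) refl B q N H) ⟩
      F + B * (q * N * H)    ≈⟨ +-congˡ (*-congˡ F≈) ⟨
      F + B * F              ≈⟨ solve 2 (λ F B → F :+ B :* F := (:1 :+ B) :* F) refl F B ⟩
      (1# + B) * F           ∎

    -- With x = p N², the terms of `A` are x² (1 - p) and x² / N, each at most x².
    A≤2x² : A ≤ fromℕ 2 * (p * N ^ 2) ^ 2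
    A≤2x² = begin
      F + H
        ≤⟨ +-mono-≤ (*-monoˡ-≤ (<⇒≤ 0<N⁴S) q≤1) H≤N⁴S ⟩
      N ^ 4 * p ^ 2 * 1# + N ^ 4 * p ^ 2
        ≈⟨ solve 2 (λ N p → N :^ 4 :* p :^ 2 :* :1 :+ N :^ 4 :* p :^ 2
             := :fromℕ 2 :* (p :* N :^ 2) :^ 2) refl N p ⟩
      fromℕ 2 * (p * N ^ 2) ^ 2 ∎
      where
      0<N⁴S : 0# < N ^ 4 * p ^ 2
      0<N⁴S = *-positive (^-positive 4 0<N) (^-positive 2 0<p)
      q≤1 : q ≤ 1#
      q≤1 = difference-≤ (≤-trans (<⇒≤ 0<p) (≤-reflexive (solve 1 (λ p → p := :1 :- (:1 :- p)) refl p)))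
      H≤N⁴S : H ≤ N ^ 4 * p ^ 2
      H≤N⁴S = begin
        H                ≈⟨ *-identityˡ H ⟨
        1# * H           ≤⟨ *-monoʳ-≤ (<⇒≤ 0<H) 1≤N ⟩
        N * H            ≈⟨ solve 2 (λ N p → N :* (N :^ 3 :* p :^ 2) := N :^ 4 :* p :^ 2) refl N p ⟩
        N ^ 4 * p ^ 2    ∎

    -- For p > 1/4 the term `H` alone suffices, because 16 H = N³ (4 p)².
    N≤16A : 1# < fromℕ 4 * p → N ≤ fromℕ 16 * A
    N≤16A 1<4p = begin
      N
        ≈⟨ *-identityʳ N ⟨
      N * 1#
        ≤⟨ *-monoˡ-≤ (<⇒≤ 0<N) (1≤x*y (1≤x*y 1≤N 1≤N) (1≤x*y (<⇒≤ 1<4p) (<⇒≤ 1<4p))) ⟩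
      N * (N * N * (fromℕ 4 * p * (fromℕ 4 * p)))
        ≈⟨ solve 2 (λ N p → N :* (N :* N :* (:fromℕ 4 :* p :* (:fromℕ 4 :* p)))
             := :fromℕ 16 :* (N :^ 3 :* p :^ 2)) refl N p ⟩
      fromℕ 16 * H
        ≤⟨ *-monoˡ-≤ (fromℕ-nonneg 16) H≤A ⟩
      fromℕ 16 * A ∎

    -- For 1 - p > 1/2 the term `F` alone suffices: 4 F = x (x · 4 q), and the bracket is at least
    -- 1.
    x≤4A : fromℕ 2 < fromℕ 4 * q → 1# ≤ p * N ^ 2 → p * N ^ 2 ≤ fromℕ 4 * A
    x≤4A 2<4q 1≤x = begin
      x
        ≈⟨ *-identityʳ x ⟨
      x * 1#
        ≤⟨ *-monoˡ-≤ 0≤x (1≤x*y 1≤x (≤-trans 1≤2 (<⇒≤ 2<4q))) ⟩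
      x * (x * (fromℕ 4 * q))
        ≈⟨ solve 2 (λ N p → p :* N :^ 2 :* (p :* N :^ 2 :* (:fromℕ 4 :* (:1 :- p)))
             := :fromℕ 4 :* (N :^ 4 :* p :^ 2 :* (:1 :- p))) refl N p ⟩
      fromℕ 4 * F
        ≤⟨ *-monoˡ-≤ (fromℕ-nonneg 4) F≤A ⟩
      fromℕ 4 * A ∎
      where
      x : Carrier
      x = p * N ^ 2
      0≤x : 0# ≤ x
      0≤x = ≤-trans (<⇒≤ 0<1) 1≤x
      1≤2 : 1# ≤ fromℕ 2
      1≤2 = ≤-trans (≤-reflexive (sym (+-identityʳ 1#))) (fromℕ-mono-≤ {1} {2} (s≤s z≤n))

    -- `p` cannot be compared with a single threshold. Locating 4 p across the gap between 1 and 2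
    -- gives the overlapping cases p > 1/4 and p < 1/2.
    large-or : 1# < fromℕ 4 * p ⊎ fromℕ 2 < fromℕ 4 * q
    large-or with <-cotrans 1<2 (fromℕ 4 * p)
      where
      1<2 : 1# < fromℕ 2
      1<2 = <-respˡ-≈ (+-identityʳ 1#) (fromℕ-mono-< {1} {2} (s≤s (s≤s z≤n)))
    ... | inj₁ 1<4p = inj₁ 1<4p
    ... | inj₂ 4p<2 = inj₂ (difference-< (<-respʳ-≈
      (solve 1 (λ p → :fromℕ 2 :- :fromℕ 4 :* p := :fromℕ 4 :* (:1 :- p) :- :fromℕ 2) refl p)
      (<-difference 4p<2)))

    module Bounds {X Y R E : Carrier} (6≤N : fromℕ 6 ≤ N) (0≤R : 0# ≤ R) (R≤1 : R ≤ 1#)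
      (X+X≈ : X + X ≈ N * (N - 1#) * (N - 1# - 1#) * (N - 1# - 1# - 1#))
      (Y≈ : Y ≈ N * (N - 1#) * (N - 1# - 1#))
      (E≈ : E ≈ X * p ^ 2 * (1# - p ^ 2) + Y * p ^ 2 * (1# + (1# - p) * R)) where

      private
        a b c U V : Carrier
        a = N - 1#
        b = N - 1# - 1#
        c = N - 1# - 1# - 1#
        U = S * (1# - p ^ 2)
        V = S * (1# + q * R)

      E+E≈ : E + E ≈ N * a * b * c * U + (N * a * b * V + N * a * b * V)
      E+E≈ = trans (+-cong E≈ E≈) (trans
        (solve 6 (λ X Y s u s′ v → (X :* s :* u :+ Y :* s′ :* v) :+ (X :* s :* u :+ Y :* s′ :* v)
          := (X :+ X) :* (s :* u) :+ (Y :* (s′ :* v) :+ Y :* (s′ :* v))) refl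
          X Y (p ^ 2) (1# - p ^ 2) (p ^ 2) (1# + q * R))
        (+-cong (*-congʳ X+X≈) (+-cong (*-congʳ Y≈) (*-congʳ Y≈))))

      -- The largest shift in the falling factorial is 3, and N ≥ 3 + 3 keeps every factor at least
      -- N / 2; hence the bound 6.
      N-m : ∀ m → fromℕ (m ℕ.+ m) ≤ fromℕ 6 → N ≤ fromℕ 2 * (N - fromℕ m)
      N-m m 2m≤6 = difference-≤ (≤-trans (≤-difference (≤-trans (≤-trans (≤-reflexive (sym (fromℕ-+ m m))) 2m≤6) 6≤N))
        (≤-reflexive (solve 2 (λ N m → N :- (m :+ m) := :fromℕ 2 :* (N :- m) :- N) refl N (fromℕ m))))

      N≤2a : N ≤ fromℕ 2 * a
      N≤2a = ≤-trans (N-m 1 (fromℕ-mono-≤ {2} {6} (s≤s (s≤s z≤n))))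
        (≤-reflexive (solve 1 (λ N → :fromℕ 2 :* (N :- :fromℕ 1) := :fromℕ 2 :* (N :- :1)) refl N))

      N≤2b : N ≤ fromℕ 2 * b
      N≤2b = ≤-trans (N-m 2 (fromℕ-mono-≤ {4} {6} (s≤s (s≤s (s≤s (s≤s z≤n))))))
        (≤-reflexive (solve 1 (λ N → :fromℕ 2 :* (N :- :fromℕ 2) := :fromℕ 2 :* (N :- :1 :- :1)) refl N))

      N≤2c : N ≤ fromℕ 2 * c
      N≤2c = ≤-trans (N-m 3 ≤-refl)
        (≤-reflexive (solve 1 (λ N → :fromℕ 2 :* (N :- :fromℕ 3) := :fromℕ 2 :* (N :- :1 :- :1 :- :1)) refl N))

      half-nonneg : ∀ {x} → N ≤ fromℕ 2 * x → 0# ≤ x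
      half-nonneg {x} N≤2x = *-cancelʳ-≤ (0<fromℕ-suc 1) (begin
        0# * fromℕ 2  ≈⟨ zeroˡ _ ⟩
        0#            ≤⟨ <⇒≤ 0<N ⟩
        N             ≤⟨ N≤2x ⟩
        fromℕ 2 * x   ≈⟨ *-comm _ _ ⟩
        x * fromℕ 2   ∎)

      x-1≤x : ∀ x → x - 1# ≤ x
      x-1≤x x = difference-≤ (≤-trans (<⇒≤ 0<1) (≤-reflexive (solve 1 (λ x → :1 := x :- (x :- :1)) refl x)))

      0≤q : 0# ≤ q
      0≤q = <⇒≤ 0<q
      0≤S : 0# ≤ S
      0≤S = <⇒≤ (^-positive 2 0<p)
      0≤N : 0# ≤ N
      0≤N = <⇒≤ 0<N

      -- From 1 - p² = (1 - p)(1 + p), where 1 + p lies between 1 and 2; `U≤2Sq` is the other half.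
      Sq≤U : S * q ≤ U
      Sq≤U = *-monoˡ-≤ 0≤S (begin
        q             ≈⟨ *-identityʳ q ⟨
        q * 1#        ≤⟨ *-monoˡ-≤ 0≤q (≤-trans (≤-reflexive (sym (+-identityʳ 1#))) (+-monoʳ-≤ 1# (<⇒≤ 0<p))) ⟩
        q * (1# + p)  ≈⟨ solve 1 (λ p → (:1 :- p) :* (:1 :+ p) := :1 :- p :^ 2) refl p ⟩
        1# - p ^ 2    ∎)

      U≤2Sq : U ≤ S * q * fromℕ 2
      U≤2Sq = begin
        S * (1# - p ^ 2)    ≈⟨ solve 2 (λ S p → S :* (:1 :- p :^ 2) := S :* (:1 :- p) :* (:1 :+ p)) refl S p ⟩
        S * q * (1# + p)    ≤⟨ *-monoˡ-≤ (*-nonneg 0≤S 0≤q) (+-monoʳ-≤ 1# (≤-trans (<⇒≤ p<1) (≤-reflexive (sym (+-identityʳ 1#))))) ⟩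
        S * q * fromℕ 2     ∎

      S≤V : S ≤ V
      S≤V = begin
        S                 ≈⟨ solve 1 (λ S → S := S :* (:1 :+ :0)) refl S ⟩
        S * (1# + 0#)     ≤⟨ *-monoˡ-≤ 0≤S (+-monoʳ-≤ 1# (*-nonneg 0≤q 0≤R)) ⟩
        S * (1# + q * R)  ∎

      V≤2S : V ≤ S * fromℕ 2
      V≤2S = *-monoˡ-≤ 0≤S (+-monoʳ-≤ 1# (begin
        q * R     ≤⟨ *-mono-≤ 0≤q 0≤R q≤1 R≤1 ⟩
        1# * 1#   ≈⟨ solve 0 (:1 :* :1 := :1 :+ :0) refl ⟩
        1# + 0#   ∎))
        where
        q≤1 : q ≤ 1#
        q≤1 = difference-≤ (≤-trans (<⇒≤ 0<p) (≤-reflexive (solve 1 (λ p → p := :1 :- (:1 :- p)) refl p)))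

      -- Replacing a shifted factor by `N` costs 2 each time, hence 8 for the quartic and 4 for the
      -- cubic term.
      A≤16E : A ≤ fromℕ 16 * E
      A≤16E = begin
        F + H
          ≈⟨ +-cong (solve 3 (λ N S q → N :^ 4 :* S :* q := N :* N :* N :* N :* (S :* q)) refl N S q)
               (solve 2 (λ N S → N :^ 3 :* S := N :* N :* N :* S) refl N S) ⟩
        N * N * N * N * (S * q) + N * N * N * S
          ≤⟨ +-mono-≤
               (*-mono-≤ (*-nonneg 0≤N³ 0≤N) (*-nonneg 0≤S 0≤q) (*-mono-≤ 0≤N³ 0≤N N³≤ N≤2c) Sq≤U)
               (*-mono-≤ 0≤N³ 0≤S N³≤ S≤V) ⟩
        N * (fromℕ 2 * a) * (fromℕ 2 * b) * (fromℕ 2 * c) * U + N * (fromℕ 2 * a) * (fromℕ 2 * b) * V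
          ≈⟨ +-cong
               (solve 5 (λ N a b c U → N :* (:fromℕ 2 :* a) :* (:fromℕ 2 :* b) :* (:fromℕ 2 :* c) :* U
                 := :fromℕ 8 :* (N :* a :* b :* c :* U)) refl N a b c U)
               (solve 4 (λ N a b V → N :* (:fromℕ 2 :* a) :* (:fromℕ 2 :* b) :* V
                 := :fromℕ 4 :* (N :* a :* b :* V)) refl N a b V) ⟩
        fromℕ 8 * Z + fromℕ 4 * W
          -- `E + E` consists of `Z` and two copies of `W`, so completing 8 (E + E) takes 16 copies
          -- of `W`.
          ≤⟨ +-monoʳ-≤ (fromℕ 8 * Z) (*-monoʳ-≤ 0≤W (fromℕ-mono-≤ {4} {16} (s≤s (s≤s (s≤s (s≤s z≤n)))))) ⟩
        fromℕ 8 * Z + fromℕ 16 * W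
          ≈⟨ solve 2 (λ Z W → :fromℕ 8 :* Z :+ :fromℕ 16 :* W := :fromℕ 8 :* (Z :+ (W :+ W))) refl Z W ⟩
        fromℕ 8 * (Z + (W + W))
          ≈⟨ *-congˡ E+E≈ ⟨
        fromℕ 8 * (E + E)
          ≈⟨ solve 1 (λ E → :fromℕ 8 :* (E :+ E) := :fromℕ 16 :* E) refl E ⟩
        fromℕ 16 * E ∎
        where
        Z W : Carrier
        Z = N * a * b * c * U
        W = N * a * b * V
        0≤N³ : 0# ≤ N * N * N
        0≤N³ = *-nonneg (*-nonneg 0≤N 0≤N) 0≤N
        N³≤ : N * N * N ≤ N * (fromℕ 2 * a) * (fromℕ 2 * b)
        N³≤ = *-mono-≤ (*-nonneg 0≤N 0≤N) 0≤N (*-monoˡ-≤ 0≤N N≤2a) N≤2b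
        0≤W : 0# ≤ W
        0≤W = *-nonneg (*-nonneg (*-nonneg 0≤N (half-nonneg N≤2a)) (half-nonneg N≤2b)) (≤-trans 0≤S S≤V)

      0≤E : 0# ≤ E
      0≤E = *-cancelʳ-≤ (0<fromℕ-suc 15) (begin
        0# * fromℕ 16  ≈⟨ zeroˡ _ ⟩
        0#             ≤⟨ <⇒≤ 0<A ⟩
        A              ≤⟨ A≤16E ⟩
        fromℕ 16 * E   ≈⟨ *-comm _ _ ⟩
        E * fromℕ 16   ∎)

      -- As `E` is nonnegative, it is at most `E + E`, whose expression has no halves; that is
      -- bounded by 2 F + 4 H.
      E≤4A : E ≤ fromℕ 4 * A
      E≤4A = begin
        E
          ≈⟨ +-identityʳ E ⟨
        E + 0#
          ≤⟨ +-monoʳ-≤ E 0≤E ⟩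
        E + E
          ≈⟨ E+E≈ ⟩
        N * a * b * c * U + (W + W)
          ≤⟨ +-mono-≤ (*-mono-≤ (*-nonneg 0≤Nab (half-nonneg N≤2c)) (≤-trans (*-nonneg 0≤S 0≤q) Sq≤U)
                        (*-mono-≤ 0≤Nab (half-nonneg N≤2c) Nab≤ c≤N) U≤2Sq)
               (+-mono-≤ W≤ W≤) ⟩
        N * N * N * N * (S * q * fromℕ 2) + (N * N * N * (S * fromℕ 2) + N * N * N * (S * fromℕ 2))
          ≈⟨ solve 3 (λ N S q → N :* N :* N :* N :* (S :* q :* :fromℕ 2) :+
               (N :* N :* N :* (S :* :fromℕ 2) :+ N :* N :* N :* (S :* :fromℕ 2))
               := :fromℕ 2 :* (N :^ 4 :* S :* q) :+ :fromℕ 4 :* (N :^ 3 :* S)) refl N S q ⟩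
        fromℕ 2 * F + fromℕ 4 * H
          ≤⟨ +-monoˡ-≤ (fromℕ 4 * H) (*-monoʳ-≤ (<⇒≤ 0<F) (fromℕ-mono-≤ {2} {4} (s≤s (s≤s z≤n)))) ⟩
        fromℕ 4 * F + fromℕ 4 * H
          ≈⟨ distribˡ (fromℕ 4) F H ⟨
        fromℕ 4 * A ∎
        where
        W : Carrier
        W = N * a * b * V
        b≤N : b ≤ N
        b≤N = ≤-trans (x-1≤x a) (x-1≤x N)
        c≤N : c ≤ N
        c≤N = ≤-trans (x-1≤x b) b≤N
        0≤Na : 0# ≤ N * a
        0≤Na = *-nonneg 0≤N (half-nonneg N≤2a)
        0≤Nab : 0# ≤ N * a * b
        0≤Nab = *-nonneg 0≤Na (half-nonneg N≤2b)
        Nab≤ : N * a * b ≤ N * N * N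
        Nab≤ = *-mono-≤ 0≤Na (half-nonneg N≤2b) (*-monoˡ-≤ 0≤N (x-1≤x N)) b≤N
        W≤ : W ≤ N * N * N * (S * fromℕ 2)
        W≤ = *-mono-≤ 0≤Nab (≤-trans 0≤S S≤V) Nab≤ V≤2S

-- Asymptotics of the expected edge count

module EdgeCountAsymptotics {ℓ₀ ℓ₁ ℓ₂ : Level} (ℝ : Reals ℓ₀ ℓ₁ ℓ₂)
  (p : Theory.Sequence ℝ) (0<p<1 : ∀ n → Reals._<_ ℝ (Reals.0# ℝ) (p n) × Reals._<_ ℝ (p n) (Reals.1# ℝ)) where

  open Theory ℝ hiding (zero)
  open OrderedField ℝ
  open OrderProperties ℝ
  open Ratios ℝ
  open ≤-Reasoning
  open ExpectedEdgeCount ℝ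

  EK F H A x : Sequence
  EK n = 𝔼 (p n) (EdgeCount.edgeCount ℝ {n})
  F n = fromℕ n ^ 4 * p n ^ 2 * (1# - p n)
  H n = fromℕ n ^ 3 * p n ^ 2
  A n = F n + H n
  x n = p n * fromℕ n ^ 2

  1≤fromℕ : ∀ {n} → 1 ℕ.≤ n → 1# ≤ fromℕ n
  1≤fromℕ 1≤n = ≤-trans (≤-reflexive (sym (+-identityʳ 1#))) (fromℕ-mono-≤ 1≤n)

  module At {n : ℕ} (1≤n : 1 ℕ.≤ n) where

    open Asymptotics.Estimates ℝ (1≤fromℕ 1≤n) (proj₁ (0<p<1 n)) (proj₂ (0<p<1 n)) public

    0<n⁻² : 0# < n⁻² n
    0<n⁻² = ^-positive 2 (n⁻¹-positive n 1≤n)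

    fromℕ*n⁻¹ : fromℕ n * n⁻¹ n ≈ 1#
    fromℕ*n⁻¹ = trans (*-comm _ _) (n⁻¹-inverse n 1≤n)

    -- Thus `x n` is the quotient of `p n` by `n⁻² n`, with the division cleared.
    x*n⁻² : x n * n⁻² n ≈ p n
    x*n⁻² = trans (solve 3 (λ p N i → p :* N :^ 2 :* i :^ 2 := p :* (N :* i) :* (N :* i)) refl
        (p n) (fromℕ n) (n⁻¹ n))
      (trans (*-cong (*-congˡ fromℕ*n⁻¹) fromℕ*n⁻¹)
        (trans (*-identityʳ _) (*-identityʳ _)))

    0≤x : 0# ≤ x n
    0≤x = *-nonneg (<⇒≤ (proj₁ (0<p<1 n))) (^-nonneg 2 (fromℕ-nonneg n))

  module _ {n : ℕ} (6≤n : 6 ℕ.≤ n) where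

    private
      1≤n : 1 ℕ.≤ n
      1≤n = ℕ.≤-trans (s≤s z≤n) 6≤n
      r : Carrier
      r = 1# - p n ^ 2

    0≤r : 0# ≤ r
    0≤r = ≤-difference (^-≤-1 2 (<⇒≤ (proj₁ (0<p<1 n))) (<⇒≤ (proj₂ (0<p<1 n))))

    r≤1 : r ≤ 1#
    r≤1 = difference-≤ (≤-trans (^-nonneg 2 (<⇒≤ (proj₁ (0<p<1 n))))
      (≤-reflexive (solve 1 (λ s → s := :1 :- (:1 :- s)) refl (p n ^ 2))))

    open At.Bounds 1≤n {fromℕ (12 *ₙ (n C 4))} {fromℕ (6 *ₙ (n C 3))} {r ^ (n ∸ 3)} {EK n}
      (fromℕ-mono-≤ 6≤n) (^-nonneg (n ∸ 3) 0≤r) (^-≤-1 (n ∸ 3) 0≤r r≤1)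
      (12C₄ n) (6C₃ n) (expectedEdgeCount n (p n)) public using (0≤E; A≤16E; E≤4A)

  EK≃A : EK ≃ A
  EK≃A = ≃-bounds (0<fromℕ-suc 15) (6 , λ n 6≤n →
    0≤E 6≤n , At.0<A (ℕ.≤-trans (s≤s z≤n) 6≤n) , A≤16E 6≤n , E≤4A 6≤n)

  A≃H : (λ n → 1# - p n) ≪ n⁻¹ → A ≃ H
  -- The hypothesis is applied with ε = 1. Starting at `suc n₀` avoids the placeholder value of
  -- `n⁻¹` at 0.
  A≃H q≪n⁻¹ = ≃-bounds 0<1 (suc n₀ , λ n n₀<n → let open At (ℕ.≤-trans (s≤s z≤n) n₀<n) in
      <⇒≤ 0<A , 0<H , ≤-trans H≤A (≤-reflexive (sym (*-identityˡ (A n)))) , A≤2H (qN≤1 n n₀<n))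
    where
    n₀ : ℕ
    n₀ = proj₁ (q≪n⁻¹ 1# 0<1)
    qN≤1 : ∀ n → n₀ ℕ.< n → (1# - p n) * fromℕ n ≤ 1#
    qN≤1 n n₀<n = begin
      (1# - p n) * fromℕ n     ≤⟨ *-monoʳ-≤ (fromℕ-nonneg n) (ratio-≤⁻ (proj₁ ratio) (<⇒≤ 0<q)
                                    (n⁻¹-positive n 1≤n) (proj₂ ratio)) ⟩
      1# * n⁻¹ n * fromℕ n     ≈⟨ *-congʳ (*-identityˡ (n⁻¹ n)) ⟩
      n⁻¹ n * fromℕ n          ≈⟨ n⁻¹-inverse n 1≤n ⟩
      1#                       ∎
      where
      1≤n : 1 ℕ.≤ n
      1≤n = ℕ.≤-trans (s≤s z≤n) n₀<n
      open At 1≤n using (0<q)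
      ratio : Σ[ n⁻¹#0 ∈ n⁻¹ n # 0# ] ∣ divide (1# - p n) (n⁻¹ n) n⁻¹#0 ∣ ≤ 1#
      ratio = proj₂ (q≪n⁻¹ 1# 0<1) n (ℕ.<⇒≤ n₀<n)

  A≃F : (λ n → 1# - p n) ≳ n⁻¹ → A ≃ F
  A≃F (δ , 0<δ , n₀ , q≳n⁻¹) = ≃-bounds 0<1 (suc n₀ , λ n n₀<n →
      let open At (ℕ.≤-trans (s≤s z≤n) n₀<n) in
      <⇒≤ 0<A , 0<F , ≤-trans F≤A (≤-reflexive (sym (*-identityˡ (A n)))) ,
      A≤F (<⇒≤ (proj₁ (proj₂ (reciprocal δ 0<δ)))) (proj₂ (proj₂ (reciprocal δ 0<δ))) (δ≤qN n n₀<n))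
    where
    δ≤qN : ∀ n → n₀ ℕ.< n → δ ≤ (1# - p n) * fromℕ n
    δ≤qN n n₀<n = begin
      δ                        ≈⟨ *-identityʳ δ ⟨
      δ * 1#                   ≈⟨ *-congˡ (n⁻¹-inverse n 1≤n) ⟨
      δ * (n⁻¹ n * fromℕ n)    ≈⟨ *-assoc δ (n⁻¹ n) (fromℕ n) ⟨
      δ * n⁻¹ n * fromℕ n      ≤⟨ *-monoʳ-≤ (fromℕ-nonneg n) (ratio-≥⁻ (proj₁ ratio) (<⇒≤ 0<q)
                                    (n⁻¹-positive n 1≤n) (proj₂ ratio)) ⟩
      (1# - p n) * fromℕ n     ∎
      where
      1≤n : 1 ℕ.≤ n
      1≤n = ℕ.≤-trans (s≤s z≤n) n₀<n
      open At 1≤n using (0<q)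
      ratio : Σ[ n⁻¹#0 ∈ n⁻¹ n # 0# ] δ ≤ ∣ divide (1# - p n) (n⁻¹ n) n⁻¹#0 ∣
      ratio = q≳n⁻¹ n (ℕ.<⇒≤ n₀<n)

  EK→∞⇒p≫n⁻² : TendsTo∞ EK → p ≫ n⁻²
  EK→∞⇒p≫n⁻² EK→∞ M = 6 ℕ.+ n₀ , λ n 6+n₀≤n →
      let 6≤n = ℕ.≤-trans (ℕ.m≤m+n 6 n₀) 6+n₀≤n
          open At (ℕ.≤-trans (s≤s z≤n) 6≤n)
      in #-sym (<⇒# 0<n⁻²) , ratio-≥ _ (<⇒≤ (proj₁ (0<p<1 n))) 0<n⁻²
           (≤-trans (*-monoʳ-≤ (<⇒≤ 0<n⁻²) (M≤x 6≤n (proj₂ (EK→∞ bound) n (ℕ.≤-trans (ℕ.m≤n+m n₀ 6) 6+n₀≤n))))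
             (≤-reflexive x*n⁻²))
    where
    bound : Carrier
    -- By EK ≤ 4 A and A ≤ 2 x², a value x < M would force EK ≤ 8 M²; the added 1 makes this a
    -- contradiction.
    bound = 1# + fromℕ 8 * (M * M)
    n₀ : ℕ
    n₀ = proj₁ (EK→∞ bound)
    M≤x : ∀ {n} → 6 ℕ.≤ n → bound ≤ EK n → M ≤ x n
    M≤x {n} 6≤n bound≤EK x<M = <-irrefl refl (begin-strict
      fromℕ 8 * (M * M)             ≈⟨ +-identityˡ _ ⟨
      0# + fromℕ 8 * (M * M)        <⟨ <-respˡ-≈ (+-comm _ _) (<-respʳ-≈ (+-comm _ _) (+-monoʳ-< (fromℕ 8 * (M * M)) 0<1)) ⟩
      bound                         ≤⟨ bound≤EK ⟩
      EK n                          ≤⟨ E≤4A 6≤n ⟩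
      fromℕ 4 * A n                 ≤⟨ *-monoˡ-≤ (fromℕ-nonneg 4) A≤2x² ⟩
      fromℕ 4 * (fromℕ 2 * x n ^ 2) ≈⟨ solve 1 (λ x → :fromℕ 4 :* (:fromℕ 2 :* x :^ 2) := :fromℕ 8 :* (x :* x)) refl (x n) ⟩
      fromℕ 8 * (x n * x n)         ≤⟨ *-monoˡ-≤ (fromℕ-nonneg 8) (*-mono-≤ 0≤x 0≤x (<⇒≤ x<M) (<⇒≤ x<M)) ⟩
      fromℕ 8 * (M * M)             ∎)
      where open At (ℕ.≤-trans (s≤s z≤n) 6≤n)

  p≫n⁻²⇒EK→∞ : p ≫ n⁻² → TendsTo∞ EK
  -- For p > 1/4, the bounds N ≤ 16 A and A ≤ 16 EK turn n ≥ 16 · 16 m into EK ≥ m.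
  p≫n⁻²⇒EK→∞ p≫n⁻² M = 6 ℕ.+ (16 *ₙ (16 *ₙ m) ℕ.+ n₀) , λ n n≥ →
      let n≥′ = ℕ.≤-trans (ℕ.m≤n+m (16 *ₙ (16 *ₙ m) ℕ.+ n₀) 6) n≥ in
      ≤-trans (<⇒≤ M<m) (m≤EK (ℕ.≤-trans (ℕ.m≤m+n 6 _) n≥)
        (ℕ.≤-trans (ℕ.m≤m+n (16 *ₙ (16 *ₙ m)) n₀) n≥′)
        (proj₂ (p≫n⁻² L) n (ℕ.≤-trans (ℕ.m≤n+m n₀ (16 *ₙ (16 *ₙ m))) n≥′)))
    where
    m : ℕ
    m = proj₁ (archimedean M)
    M<m : M < fromℕ m
    M<m = proj₂ (archimedean M)
    -- For 1 - p > 1/2, the bounds x ≤ 4 A and A ≤ 16 EK ask for x ≥ 4 · 16 m; the successor keeps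
    -- `L` at least 1, as `x≤4A` requires of x.
    L : Carrier
    L = fromℕ (suc (4 *ₙ (16 *ₙ m)))
    n₀ : ℕ
    n₀ = proj₁ (p≫n⁻² L)
    -- The thresholds are kept as nested products so that their positive factors can be cancelled
    -- one at a time.
    cancel : ∀ j k l {y} → fromℕ (suc j *ₙ (suc k *ₙ l)) ≤ fromℕ (suc j) * (fromℕ (suc k) * y) → fromℕ l ≤ y
    cancel j k l {y} jkl≤ = *-cancelˡ (0<fromℕ-suc k) (*-cancelˡ (0<fromℕ-suc j) (begin
      fromℕ (suc j) * (fromℕ (suc k) * fromℕ l)  ≈⟨ *-congˡ (fromℕ-* (suc k) l) ⟨
      fromℕ (suc j) * fromℕ (suc k *ₙ l)         ≈⟨ fromℕ-* (suc j) (suc k *ₙ l) ⟨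
      fromℕ (suc j *ₙ (suc k *ₙ l))              ≤⟨ jkl≤ ⟩
      fromℕ (suc j) * (fromℕ (suc k) * y)        ∎))
      where
      *-cancelˡ : ∀ {z} → 0# < z → ∀ {u v} → z * u ≤ z * v → u ≤ v
      *-cancelˡ {z} 0<z {u} {v} zu≤zv = *-cancelʳ-≤ 0<z
        (≤-trans (≤-reflexive (*-comm u z)) (≤-trans zu≤zv (≤-reflexive (*-comm z v))))
    m≤EK : ∀ {n} → 6 ℕ.≤ n → 16 *ₙ (16 *ₙ m) ℕ.≤ n →
           Σ[ n⁻²#0 ∈ n⁻² n # 0# ] L ≤ ∣ divide (p n) (n⁻² n) n⁻²#0 ∣ → fromℕ m ≤ EK n
    m≤EK {n} 6≤n 256m≤n (n⁻²#0 , L≤ratio) = [ large-p , large-1-p ]′ large-or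
      where
      open At (ℕ.≤-trans (s≤s z≤n) 6≤n)
      L≤x : L ≤ x n
      L≤x = *-cancelʳ-≤ 0<n⁻² (≤-trans (ratio-≥⁻ n⁻²#0 (<⇒≤ (proj₁ (0<p<1 n))) 0<n⁻² L≤ratio)
        (≤-reflexive (sym x*n⁻²)))
      1≤L : 1# ≤ L
      1≤L = 1≤fromℕ {suc (4 *ₙ (16 *ₙ m))} (s≤s z≤n)
      large-p : 1# < fromℕ 4 * p n → fromℕ m ≤ EK n
      large-p 1<4p = cancel 15 15 m (begin
        fromℕ (16 *ₙ (16 *ₙ m))        ≤⟨ fromℕ-mono-≤ {16 *ₙ (16 *ₙ m)} {n} 256m≤n ⟩
        fromℕ n                        ≤⟨ N≤16A 1<4p ⟩
        fromℕ 16 * A n                 ≤⟨ *-monoˡ-≤ (fromℕ-nonneg 16) (A≤16E 6≤n) ⟩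
        fromℕ 16 * (fromℕ 16 * EK n)   ∎)
      large-1-p : fromℕ 2 < fromℕ 4 * (1# - p n) → fromℕ m ≤ EK n
      large-1-p 2<4q = cancel 3 15 m (begin
        fromℕ (4 *ₙ (16 *ₙ m))         ≤⟨ fromℕ-mono-≤ {4 *ₙ (16 *ₙ m)} {suc (4 *ₙ (16 *ₙ m))} (ℕ.n≤1+n _) ⟩
        L                              ≤⟨ L≤x ⟩
        x n                            ≤⟨ x≤4A 2<4q (≤-trans 1≤L L≤x) ⟩
        fromℕ 4 * A n                  ≤⟨ *-monoˡ-≤ (fromℕ-nonneg 4) (A≤16E 6≤n) ⟩
        fromℕ 4 * (fromℕ 16 * EK n)    ∎)

theorem3p1 : ∀ {c ℓ₁ ℓ₂} (ℝ : Reals c ℓ₁ ℓ₂) → let open Theory ℝ in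
  Σ[ K ∈ (∀ n → Graph n → ℕ) ]
    (∀ n (G : Graph n) → symmetricEdgePolytope G HasEdgeCount K n G) ×
    ((p : Sequence) → (∀ n → 0# < p n × p n < 1#) →
      let EK : Sequence
          EK n = 𝔼 (p n) (K n)

          A : Sequence
          A n = fromℕ n ^ 4 * p n ^ 2 * (1# - p n) + fromℕ n ^ 3 * p n ^ 2
      in
      (∀ n → EK n ≈
        fromℕ (12 *ₙ (n C 4)) * p n ^ 2 * (1# - p n ^ 2)
        + fromℕ (6 *ₙ (n C 3)) * p n ^ 2
          * (1# + (1# - p n) * (1# - p n ^ 2) ^ (n ∸ 3))) ×
      (EK ≃ A) ×
      ((λ n → 1# - p n) ≪ n⁻¹ → A ≃ (λ n → fromℕ n ^ 3 * p n ^ 2)) ×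
      ((λ n → 1# - p n) ≳ n⁻¹ →
        A ≃ (λ n → fromℕ n ^ 4 * p n ^ 2 * (1# - p n))) ×
      (TendsTo∞ EK ⇔ p ≫ n⁻²))
theorem3p1 ℝ = (λ n G → EdgeCount.edgeCount ℝ G) , (λ n G → EdgeCount.hasEdgeCount ℝ G) ,
  λ p 0<p<1 → let open EdgeCountAsymptotics ℝ p 0<p<1 in
    (λ n → ExpectedEdgeCount.expectedEdgeCount ℝ n (p n)) , EK≃A , A≃H , A≃F ,
    mk⇔ EK→∞⇒p≫n⁻² p≫n⁻²⇒EK→∞
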